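{- Let $\mu\in\mathbb N^\ell$ and let $\ell(\mu)$ be the number of nonzero entries of $\mu$. If $n\ge\ell(\mu)$ (with $n\ge2$), then the regular subgraph of the $\widehat{\mathfrak{sl}}_n$-crystal $\mathcal H^\mu$ is connected (as an undirected graph).
   Context: $\mathbb N=\{0,1,\dots\}$. $\mathcal H^\mu=\mathcal H^{1,\mu_\ell}\otimes\cdots\otimes\mathcal H^{1,\mu_1}$ is the set of $H=h_\ell\otimes\cdots\otimes h_1$ with $h_j$ a weakly increasing word of length $\mu_j$ over $\{1,\dots,n\}$, with operators $e_i,f_i:\mathcal H^\mu\to\mathcal H^\mu\sqcup\{\mathbf 0\}$, $0\le i\le n-1$, as follows. For $1\le i\le n-1$ take the word $w=h_\ell\cdots h_1$, replace each $i$ by ")" and each $i+1$ by "(", ignore other letters, and delete successively adjacent pairs "(" ")" until the remaining string is $)\cdots)(\cdots($. $e_i(H)$ changes the $i+1$ of the leftmost remaining "(" into $i$ ($e_i(H)=\mathbf 0$ if none); $f_i(H)$ changes the $i$ of the rightmost remaining ")" into $i+1$ ($\mathbf 0$ if none). For $i=0$ use the word obtained by reversing each $h_j$ before concatenating, with $n$ as ")" and $1$ as "("; $e_0$ changes a $1$ into $n$, $f_0$ changes an $n$ into $1$ by the same rule; words are re-sorted. The crystal graph has vertex set $\mathcal H^\mu$ and arrows $H\xrightarrow{i}f_i(H)$ whenever $f_i(H)\ne\mathbf 0$. Energy. For words $a,b$ of lengths $K\le L$: place the letters of $a$ as dots in a right column of boxes $1,\dots,n$ (top to bottom), those of $b$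 in a left column. Pair each right dot (any order) with the lowest unpaired left dot in a strictly higher box; if none exists, with the lowest unpaired left dot (a winding pair). Move the unpaired left dots to the same boxes of the right column; the right column is now $b'$, the left $a'$; $\mathcal R(a\otimes b)=b'\otimes a'$, $W(a\otimes b)$ = number of winding pairs. For $K>L$, $\mathcal R$ is the inverse of this map and $W(a\otimes b)=W(\mathcal R(a\otimes b))$. $\sigma_i$ applies $\mathcal R$ to the factors $h_{i+1}\otimes h_i$; $W_i(H)=W(h_{i+1}\otimes h_i)$. $D(H)=\sum_{1\le i<j\le\ell}W_i(\sigma_{i+1}\sigma_{i+2}\cdots\sigma_{j-1}(H))$. A $0$-arrow $H\to f_0(H)\neq\mathbf 0$ is regular if $D(f_0(H))=D(H)+1$. The regular subgraph of $\mathcal H^\mu$ is obtained from the crystal graph by removing all $0$-arrows that are not regular (all arrows with $1\le i\le n-1$ are kept). -}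

module Defs where

open import Data.Bool.Base using (if_then_else_)
open import Data.Fin.Base as Fin using (Fin; zero; suc; toℕ; fromℕ; inject₁)
import Data.Fin.Properties as Fin
open import Data.List.Base as List
  using (List; []; _∷_; _++_; length; reverse; concatMap; allFin; upTo; applyUpTo; _[_]∷=_)
open import Data.List.Properties using (≡-dec; length-∷=)
open import Data.List.Relation.Binary.Permutation.Propositional.Properties using (↭-length)
open import Data.Maybe.Base as Maybe using (Maybe; just; nothing)
open import Data.Nat.Base using (ℕ; zero; suc; _+_; _∸_; _≤ᵇ_)
open import Data.Nat.ListAction using (sum)
import Data.Nat.Properties as ℕ
open import Data.Product.Base using (Σ-syntax; ∃-syntax; _×_; _,_; proj₁; proj₂)
open import Data.Vec.Base as Vec using (Vec; []; _∷_; lookup; _[_]≔_)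
open import Data.Vec.Properties using (map-[]≔; []≔-lookup; lookup-map)
open import Function.Base using (_∘_; id)
open import Relation.Binary.Construct.Closure.Equivalence using (EqClosure)
open import Relation.Binary.PropositionalEquality using (_≡_; cong; trans; module ≡-Reasoning)
open import Relation.Nullary.Decidable using (does; ¬?; _×-dec_)

import Data.List.Relation.Unary.Sorted.TotalOrder as SortedList
import Data.List.Sort.Base as SortBase
import Data.List.Sort.InsertionSort as InsertionSort

------------------------------------------------------------------------
-- Rows

-- The letters 1, …, n are represented by Fin n, so the letter c is the
-- element with toℕ equal to c - 1.

record Row (n : ℕ) : Set where
  constructor mkRow
  open SortedList (Fin.≤-totalOrder n) using (Sorted)
  field
    letters : List (Fin n)
    .sorted : Sorted letters

open Row public

size : ∀ {n} → Row n → ℕ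
size h = length (letters h)

sorting : ∀ n → SortBase.SortingAlgorithm (Fin.≤-totalOrder n)
sorting n = InsertionSort.insertionSort (Fin.≤-decTotalOrder n)

row : ∀ {n} → List (Fin n) → Row n
row {n} xs = mkRow (sort xs) (sort-↗ xs)
  where open SortBase.SortingAlgorithm (sorting n)

size-row : ∀ {n} (xs : List (Fin n)) → size (row xs) ≡ length xs
size-row {n} xs = ↭-length (sort-↭ xs)
  where open SortBase.SortingAlgorithm (sorting n)

-- Vectors list the tensor factors by increasing index, opposite to the
-- written order: h₁ ∷ h₂ ∷ … ∷ h_ℓ ∷ [] stands for h_ℓ ⊗ ⋯ ⊗ h₂ ⊗ h₁.
-- The factor h_{j+1} thus has index j, counting from 0.

Tensor : ℕ → ℕ → Set
Tensor n ℓ = Vec (Row n) ℓ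

record 𝓗 (n : ℕ) {ℓ : ℕ} (μ : Vec ℕ ℓ) : Set where
  constructor mk𝓗
  field
    factors : Tensor n ℓ
    .sizes  : Vec.map size factors ≡ μ

open 𝓗 public

------------------------------------------------------------------------
-- The operators fᵢ

Position : ∀ {n ℓ} → Tensor n ℓ → Set
Position {n} {ℓ} t = Σ[ j ∈ Fin ℓ ] Fin (size (lookup t j))

letterAt : ∀ {n ℓ} (t : Tensor n ℓ) → Position t → Fin n
letterAt t (j , k) = List.lookup (letters (lookup t j)) k

positionsIn : ∀ {n ℓ} (t : Tensor n ℓ) → Fin ℓ → List (Position t)
positionsIn t j = List.map (j ,_) (allFin (size (lookup t j)))

-- The colours 0, …, n - 1 are also represented by Fin n.

readRow : ∀ {n} {A : Set} → Fin n → List A → List A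
readRow zero    = reverse
readRow (suc _) = id

word : ∀ {n ℓ} → Fin n → (t : Tensor n ℓ) → List (Position t)
word {ℓ = ℓ} i t = concatMap (readRow i ∘ positionsIn t) (reverse (allFin ℓ))

-- Because of the shift between letters and Fin n, the letter written "("
-- (i + 1 if i ≥ 1, and 1 if i = 0) is the element i itself; the letter
-- written ")" (i if i ≥ 1, and n if i = 0) is its cyclic predecessor.

openLetter : ∀ {n} → Fin n → Fin n
openLetter i = i

closeLetter : ∀ {n} → Fin n → Fin n
closeLetter {suc n} zero    = fromℕ n
closeLetter {suc n} (suc i) = inject₁ i

data Bracket (A : Set) : Set where
  opening closing : A → Bracket A

bracket : ∀ {n ℓ} → Fin n → (t : Tensor n ℓ) → Position t → Maybe (Bracket (Position t))
bracket i t p =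
  if does (letterAt t p Fin.≟ closeLetter i) then just (closing p)
  else if does (letterAt t p Fin.≟ openLetter i) then just (opening p)
  else nothing

-- Adding a bracket on the left of a string ")⋯)(⋯(" in which no
-- adjacent pair "()" is left to delete.

prepend : ∀ {A} → Bracket A → List (Bracket A) → List (Bracket A)
prepend (opening _) (closing _ ∷ bs) = bs
prepend b           bs               = b ∷ bs

deletePairs : ∀ {A} → List (Bracket A) → List (Bracket A)
deletePairs = List.foldr prepend []

getClosing : ∀ {A} → Bracket A → Maybe A
getClosing (opening _) = nothing
getClosing (closing p) = just p

rightmostClosing : ∀ {n ℓ} → Fin n → (t : Tensor n ℓ) → Maybe (Position t)
rightmostClosing i t =
  List.last (List.mapMaybe getClosing (deletePairs (List.mapMaybe (bracket i t) (word i t))))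

changeLetter : ∀ {n ℓ} (t : Tensor n ℓ) → Position t → Fin n → Tensor n ℓ
changeLetter t (j , k) c = t [ j ]≔ row (letters (lookup t j) [ k ]∷= c)

sizes-changeLetter : ∀ {n ℓ} (t : Tensor n ℓ) (p : Position t) (c : Fin n) →
                     Vec.map size (changeLetter t p c) ≡ Vec.map size t
sizes-changeLetter t (j , k) c = begin
  Vec.map size (t [ j ]≔ row xs)                  ≡⟨ map-[]≔ size t j ⟩
  Vec.map size t [ j ]≔ size (row xs)             ≡⟨ cong (Vec.map size t [ j ]≔_) size-xs ⟩
  Vec.map size t [ j ]≔ lookup (Vec.map size t) j ≡⟨ []≔-lookup (Vec.map size t) j ⟩
  Vec.map size t                                  ∎
  where
  open ≡-Reasoning
  xs = letters (lookup t j) [ k ]∷= c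
  size-xs : size (row xs) ≡ lookup (Vec.map size t) j
  size-xs = begin
    size (row xs)                ≡⟨ size-row xs ⟩
    length xs                    ≡⟨ length-∷= (letters (lookup t j)) k c ⟩
    size (lookup t j)            ≡⟨ lookup-map j size t ⟨
    lookup (Vec.map size t) j    ∎

-- nothing stands for the element 𝟎.

f : ∀ {n ℓ} {μ : Vec ℕ ℓ} → Fin n → 𝓗 n μ → Maybe (𝓗 n μ)
f i (mk𝓗 t eq) = Maybe.map
  (λ p → mk𝓗 (changeLetter t p (openLetter i))
             (trans (sizes-changeLetter t p (openLetter i)) eq))
  (rightmostClosing i t)

------------------------------------------------------------------------
-- The combinatorial R-matrix and winding numbers

-- Lists ys of unpaired left dots run from the lowest box (largest letter)
-- to the highest (smallest letter), so the lowest left dot strictly higher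
-- than the box x is the first y with y < x.

takeHigher : ∀ {n} → Fin n → List (Fin n) → Maybe (Fin n × List (Fin n))
takeHigher x []       = nothing
takeHigher x (y ∷ ys) =
  if does (y Fin.<? x) then just (y , ys)
  else Maybe.map (λ (z , zs) → z , y ∷ zs) (takeHigher x ys)

-- The first argument lists the right dots, paired in the listed order.  The
-- result is the number of winding pairs, the paired left dots and the
-- unpaired left dots.

pairDots : ∀ {n} → List (Fin n) → List (Fin n) → ℕ × List (Fin n) × List (Fin n)
pairDots []       ys = 0 , [] , ys
pairDots (x ∷ xs) ys with takeHigher x ys
... | just (y , ys′) = let w , ps , us = pairDots xs ys′ in w , y ∷ ps , us
pairDots (x ∷ xs) []        | nothing = 0 , [] , []   -- not reached when there are enough left dots
pairDots (x ∷ xs) (y ∷ ys′) | nothing = let w , ps , us = pairDots xs ys′ in suc w , y ∷ ps , us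

-- The winding number together with b′ , a′, for size a ≤ size b.

moveDots : ∀ {n} → Row n → Row n → ℕ × Row n × Row n
moveDots a b =
  let w , paired , unpaired = pairDots (letters a) (reverse (letters b))
  in  w , row (letters a ++ unpaired) , row paired

words : ∀ n → ℕ → List (List (Fin n))
words n zero    = [] ∷ []
words n (suc m) = List.cartesianProductWith _∷_ (allFin n) (words n m)

rowsOfSize : ∀ n → ℕ → List (Row n)
rowsOfSize n m = List.map row (words n m)

-- The pair c , d with size c = size b, size d = size a which moveDots
-- sends to a , b.  For size a > size b there is exactly one.

preimage : ∀ {n} → Row n → Row n → Maybe (Row n × Row n)
preimage {n} a b = List.find
  (λ (c , d) → let _ , a₁ , b₁ = moveDots c d in
     ≡-dec Fin._≟_ (letters a₁) (letters a) ×-dec ≡-dec Fin._≟_ (letters b₁) (letters b))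
  (List.cartesianProduct (rowsOfSize n (size b)) (rowsOfSize n (size a)))

moveDots⁻¹ : ∀ {n} → Row n → Row n → ℕ × Row n × Row n
moveDots⁻¹ a b with preimage a b
... | just (c , d) = proj₁ (moveDots c d) , c , d
... | nothing      = 0 , a , b   -- not reached if size a > size b

windingAndR : ∀ {n} → Row n → Row n → ℕ × Row n × Row n
windingAndR a b = if size a ≤ᵇ size b then moveDots a b else moveDots⁻¹ a b

-- 𝓡 a b is the pair of factors of 𝓡(a ⊗ b), in written order.

𝓡 : ∀ {n} → Row n → Row n → Row n × Row n
𝓡 a b = proj₂ (windingAndR a b)

W : ∀ {n} → Row n → Row n → ℕ
W a b = proj₁ (windingAndR a b)

------------------------------------------------------------------------
-- Energy

-- Indices count from 0: σ i and Wᵢ i act on the factors with indices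
-- i + 1 and i.  Indices out of range are never used.

σ : ∀ {n ℓ} → ℕ → Tensor n ℓ → Tensor n ℓ
σ _       []          = []
σ zero    (h ∷ [])    = h ∷ []
σ zero    (h ∷ k ∷ t) = let k′ , h′ = 𝓡 k h in h′ ∷ k′ ∷ t
σ (suc i) (h ∷ t)     = h ∷ σ i t

Wᵢ : ∀ {n ℓ} → ℕ → Tensor n ℓ → ℕ
Wᵢ _       []          = 0
Wᵢ zero    (h ∷ [])    = 0
Wᵢ zero    (h ∷ k ∷ t) = W k h
Wᵢ (suc i) (h ∷ t)     = Wᵢ i t

-- σ_{i+1} σ_{i+2} ⋯ σ_{j-1}

σ[_,_] : ∀ {n ℓ} → ℕ → ℕ → Tensor n ℓ → Tensor n ℓ
σ[ i , j ] t = List.foldr σ t (applyUpTo (suc i +_) (j ∸ suc i))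

D : ∀ {n ℓ} {μ : Vec ℕ ℓ} → 𝓗 n μ → ℕ
D {ℓ = ℓ} H =
  sum (concatMap (λ j → List.map (λ i → Wᵢ i (σ[ i , j ] (factors H))) (upTo j)) (upTo ℓ))

------------------------------------------------------------------------
-- The regular subgraph

Arrow : ∀ {n ℓ} {μ : Vec ℕ ℓ} → Fin n → 𝓗 n μ → 𝓗 n μ → Set
Arrow i H H′ = f i H ≡ just H′

RegularSubgraph : ∀ n {ℓ} (μ : Vec ℕ ℓ) → 𝓗 n μ → 𝓗 n μ → Set
RegularSubgraph n μ H H′ =
  ∃[ i ] Arrow {n} i H H′ × (toℕ i ≡ 0 → D H′ ≡ D H + 1)

Connected : ∀ {A : Set} → (A → A → Set) → Set
Connected _⟶_ = ∀ x y → EqClosure _⟶_ x y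

nonzeroEntries : ∀ {ℓ} → Vec ℕ ℓ → ℕ
nonzeroEntries = Vec.count (λ m → ¬? (m ℕ.≟ 0))

{-# OPTIONS --safe #-}

-- Freeze a rightmost factor c ⋯ c. All arrows except those of the
-- colour changing c then act on the remaining factors, and a 0-arrow changes D by 1 - r, where r is the
-- number of j such that f_0 acts on the rightmost factor once h_j has been moved there by 𝓡. If c ≠ n
-- and the frozen factor is a largest one, moving h_j past it leaves a word c ⋯ c behind, so r = 0 and
-- all these 0-arrows are regular. Starting from a classical highest weight element, whose rightmost
-- factor is 1 ⋯ 1, turn all letters n of the other factors into 1 by 0-arrows; this is possible because
-- n occurs only in the leftmost nonempty factor, there being at most n of them. Now no n is left, so the
-- classical arrows can raise all letters by one. Repeating this, the frozen factor becomes n ⋯ n, where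
-- all classical arrows act on the rest, and induction on the number of factors connects the rests. As
-- the induction must also produce the 0-arrows of the rest, it is done with paths of arrows of colours
-- ≠ n - 1 whose ends are killed by e_{n-1}: these exist for the frozen factor n - 1 ⋯ n - 1, which can be
-- raised to n ⋯ n at both ends.
--
-- If the largest factor is not the rightmost one, it is moved there by 𝓡, which commutes with all arrows.
-- That this respects r follows from the Yang–Baxter equation for 𝓡, and the latter holds since both
-- sides are isomorphisms of a crystal that is connected by the same argument.

module Submission where

open import Defs
open import Data.Bool.Base as Bool using (if_then_else_; true; false)
open import Data.Fin.Base as Fin using (Fin; zero; suc; toℕ; fromℕ; inject₁; opposite)
import Data.Fin.Properties as Fin
open import Data.List.Base as List using (List; []; _∷_; _++_; length; reverse; _[_]∷=_; replicate; _∷ʳ_; allFin; mapMaybe; concatMap; drop; tabulate; applyUpTo; upTo)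
import Data.List.Properties as List
open import Data.List.Relation.Binary.Permutation.Propositional as Perm using (_↭_; prep; swap; ↭-sym; ↭-trans; ↭-refl)
import Data.List.Relation.Binary.Permutation.Propositional.Properties as Perm
open import Data.List.Relation.Binary.Pointwise using (Pointwise-≡⇒≡)
open import Data.List.Relation.Unary.Any using (here; there)
import Data.List.Relation.Unary.Sorted.TotalOrder as SortedList
import Data.List.Relation.Unary.Sorted.TotalOrder.Properties as Sorted
import Data.List.Sort.Base as SortBase
open import Data.List.Membership.Propositional using (_∈_)
open import Data.List.Membership.Propositional.Properties using (∈-∃++; ∈-lookup; ∈-map⁺; ∈-map⁻; ∈-cartesianProductWith⁺; ∈-cartesianProductWith⁻; ∈-cartesianProduct⁺; ∈-cartesianProduct⁻; ∈-allFin)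
open import Data.Nat.Base using (ℕ; zero; suc; _+_; _∸_; _≤_; _<_; z≤n; s≤s; s≤s⁻¹; _≤ᵇ_)
import Data.Nat.Properties as ℕ
open import Data.Product.Base using (Σ-syntax; ∃-syntax; _×_; _,_; proj₁; proj₂)
open import Function.Base using (_∘_; id; flip)
open import Relation.Binary.PropositionalEquality using (_≡_; _≢_; refl; sym; trans; cong; cong₂; subst; module ≡-Reasoning; subst₂; isEquivalence)
open import Relation.Nullary.Decidable using (yes; no; does; recompute; dec-true; dec-false; Dec; _×-dec_)
open import Relation.Nullary.Negation using (contradiction; ¬_)
open import Algebra.Properties.CommutativeMonoid.Sum ℕ.+-0-commutativeMonoid using (sum; sum-cong-≗; ∑-distrib-+; sum-init-last)
import Algebra.Properties.CommutativeSemigroup ℕ.+-commutativeSemigroup as +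
open import Data.List.Relation.Unary.All as All using (All; []; _∷_)
import Data.List.Relation.Unary.Linked.Properties as Linked
open import Data.List.Relation.Unary.AllPairs using (AllPairs; []; _∷_)
open import Data.Maybe.Base as Maybe using (Maybe; just; nothing)
open import Data.Vec.Base as Vec using (Vec; []; _∷_; lookup)
import Data.Fin.Induction as Fin
import Data.List.Relation.Unary.AllPairs.Properties as AllPairs
open import Data.Sum.Base using (_⊎_; inj₁; inj₂)
open import Data.Nat.Tactic.RingSolver using (solve-∀)
open import Relation.Unary using (Decidable)
import Data.Vec.Properties as Vec
import Data.Nat.ListAction as ListAction
import Data.Nat.ListAction.Properties as ListAction
open import Data.Unit.Base using (⊤; tt)
open import Data.Vec.Relation.Unary.All as VecAll using ([]; _∷_)
open import Relation.Binary.Construct.Closure.ReflexiveTransitive as Star using (Star; _◅_; _◅◅_)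
open import Relation.Binary.Construct.Closure.Equivalence as Eq using (EqClosure)
import Relation.Binary.Construct.Closure.Symmetric as Sym
open import Relation.Binary.Definitions using (Tri; tri<; tri≈; tri>)

-- Rows and letter counts

-- `moveDots` depends on a listing of the dots and `moveDots⁻¹` on a search. Of a pairing only the
-- numbers of segments crossing between neighbouring boxes are kept. They obey a recursion around
-- the cycle of boxes and, once circulations are excluded, are its only solution. Uniqueness,
-- inversion and compatibility with f_i thus become computations in the two boxes of one colour; for
-- colour 0 the crossing number between these boxes is the winding number.
--
-- The value 1 - r is a telescoping sum. Count factors from 0 and let f_0 act on factor p before, on
-- factor p′ after 𝓡 is applied to factors k + 1 and k. Then W_k changes by [p = k + 1] - [p′ = k].
-- Along the chain of σ that brings h_j to the right end this adds up to [p = j] - [p′ = 0], and the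
-- first terms sum to 1 over all j.
--
-- Using connectedness for the Yang-Baxter equation is not circular: there the arrows carry no
-- energy condition. The walk to n ⋯ n is therefore proved for any relation `E` that contains the
-- classical arrows and simulates the jumps.

δ : ∀ {n} → Fin n → Fin n → ℕ
δ c d = if does (c Fin.≟ d) then 1 else 0

δ-refl : ∀ {n} (c : Fin n) → δ c c ≡ 1
δ-refl c rewrite dec-true (c Fin.≟ c) refl = refl

δ-≢ : ∀ {n} {c d : Fin n} → c ≢ d → δ c d ≡ 0
δ-≢ {c = c} {d} c≢d rewrite dec-false (c Fin.≟ d) c≢d = refl

δ-suc : ∀ {n} (c d : Fin n) → δ (suc c) (suc d) ≡ δ c d
δ-suc c d = refl

count : ∀ {n} → Fin n → List (Fin n) → ℕ
count c []       = 0
count c (x ∷ xs) = δ c x + count c xs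

# : ∀ {n} → Fin n → Row n → ℕ
# c h = count c (letters h)

count-++ : ∀ {n} (c : Fin n) xs ys → count c (xs ++ ys) ≡ count c xs + count c ys
count-++ c []       ys = refl
count-++ c (x ∷ xs) ys = trans (cong (δ c x +_) (count-++ c xs ys)) (sym (ℕ.+-assoc (δ c x) _ _))

count-↭ : ∀ {n} (c : Fin n) {xs ys} → xs ↭ ys → count c xs ≡ count c ys
count-↭ c Perm.refl          = refl
count-↭ c (prep x p)         = cong (δ c x +_) (count-↭ c p)
count-↭ c (swap x y p) = trans (+.x∙yz≈y∙xz (δ c x) (δ c y) _)
                                     (cong (λ k → δ c y + (δ c x + k)) (count-↭ c p))
count-↭ c (Perm.trans p q)   = trans (count-↭ c p) (count-↭ c q)

count-reverse : ∀ {n} (c : Fin n) xs → count c (reverse xs) ≡ count c xs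
count-reverse c xs = count-↭ c (Perm.↭-reverse xs)

count>0⇒∈ : ∀ {n} {c : Fin n} xs → 0 < count c xs → c ∈ xs
count>0⇒∈ {c = c} (x ∷ xs) p with c Fin.≟ x
... | yes c≡x = here c≡x
... | no  _   = there (count>0⇒∈ xs p)

counts⇒↭ : ∀ {n} (xs ys : List (Fin n)) → (∀ c → count c xs ≡ count c ys) → xs ↭ ys
counts⇒↭ [] []       eq = ↭-refl
counts⇒↭ [] (y ∷ ys) eq = contradiction (trans (eq y) (cong (_+ count y ys) (δ-refl y))) λ ()
counts⇒↭ (x ∷ xs) ys eq
  with as , bs , refl ← ∈-∃++ (count>0⇒∈ {c = x} ys (subst (0 <_) (trans (cong (_+ count x xs) (sym (δ-refl x))) (eq x)) (s≤s z≤n)))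
  = ↭-trans (prep x (counts⇒↭ xs (as ++ bs) λ c → ℕ.+-cancelˡ-≡ (δ c x) _ _
              (trans (eq c) (count-↭ c (Perm.shift x as bs)))))
            (↭-sym (Perm.shift x as bs))

row-ext : ∀ {n} {h k : Row n} → (∀ c → # c h ≡ # c k) → h ≡ k
row-ext {n} {mkRow xs xs↗} {mkRow ys ys↗} eq = letters-injective (Pointwise-≡⇒≡
  (Sorted.↗↭↗⇒≋ (Fin.≤-totalOrder n)
     (recompute (sorted? Fin._≤?_ xs) xs↗) (recompute (sorted? Fin._≤?_ ys) ys↗)
     (Perm.↭⇒↭ₛ (counts⇒↭ xs ys eq))))
  where
  open SortedList (Fin.≤-totalOrder n) using (Sorted; sorted?)
  letters-injective : ∀ {xs ys} .{p : Sorted xs} .{q : Sorted ys} → xs ≡ ys → mkRow xs p ≡ mkRow ys q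
  letters-injective refl = refl

#-row : ∀ {n} (c : Fin n) xs → # c (row xs) ≡ count c xs
#-row {n} c xs = count-↭ c (sort-↭ xs)
  where open SortBase.SortingAlgorithm (sorting n)

count-replicate-≡ : ∀ {n} (c : Fin n) k → count c (replicate k c) ≡ k
count-replicate-≡ c zero    = refl
count-replicate-≡ c (suc k) = cong₂ _+_ (δ-refl c) (count-replicate-≡ c k)

count-replicate-≢ : ∀ {n} {c d : Fin n} → c ≢ d → ∀ k → count c (replicate k d) ≡ 0
count-replicate-≢ c≢d zero    = refl
count-replicate-≢ c≢d (suc k) = cong₂ _+_ (δ-≢ c≢d) (count-replicate-≢ c≢d k)

fromCounts : ∀ {n} → (Fin n → ℕ) → List (Fin n)
fromCounts {zero}  x = []
fromCounts {suc n} x = replicate (x zero) zero ++ List.map suc (fromCounts (x ∘ suc))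

count-map-suc : ∀ {n} (c : Fin n) xs → count (suc c) (List.map suc xs) ≡ count c xs
count-map-suc c []       = refl
count-map-suc c (x ∷ xs) = cong₂ _+_ (δ-suc c x) (count-map-suc c xs)

count-zero-map-suc : ∀ {n} (xs : List (Fin n)) → count zero (List.map suc xs) ≡ 0
count-zero-map-suc []       = refl
count-zero-map-suc (x ∷ xs) = count-zero-map-suc xs

count-fromCounts : ∀ {n} (x : Fin n → ℕ) c → count c (fromCounts x) ≡ x c
count-fromCounts x zero = begin
  count zero (replicate (x zero) zero ++ _)  ≡⟨ count-++ zero (replicate (x zero) zero) _ ⟩
  count zero (replicate (x zero) zero) + _   ≡⟨ cong₂ _+_ (count-replicate-≡ zero (x zero)) (count-zero-map-suc (fromCounts (x ∘ suc))) ⟩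
  x zero + 0                                 ≡⟨ ℕ.+-identityʳ _ ⟩
  x zero                                     ∎
  where open ≡-Reasoning
count-fromCounts x (suc c) = begin
  count (suc c) (replicate (x zero) zero ++ _)  ≡⟨ count-++ (suc c) (replicate (x zero) zero) _ ⟩
  count (suc c) (replicate (x zero) zero) + _   ≡⟨ cong₂ _+_ (count-replicate-≢ (λ ()) (x zero)) (count-map-suc c (fromCounts (x ∘ suc))) ⟩
  count c (fromCounts (x ∘ suc))                ≡⟨ count-fromCounts (x ∘ suc) c ⟩
  x (suc c)                                     ∎
  where open ≡-Reasoning

abstract
  -- Abstract, so that rows built from counts never unfold to sorted lists; later arguments see only
  -- their counts.
  rowOf : ∀ {n} → (Fin n → ℕ) → Row n
  rowOf x = row (fromCounts x)

  #-rowOf : ∀ {n} (x : Fin n → ℕ) c → # c (rowOf x) ≡ x c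
  #-rowOf x c = trans (#-row c (fromCounts x)) (count-fromCounts x c)

sum-zero : ∀ {n} (x : Fin n → ℕ) → (∀ c → x c ≡ 0) → sum x ≡ 0
sum-zero {zero}  x p = refl
sum-zero {suc n} x p = cong₂ _+_ (p zero) (sum-zero (x ∘ suc) (p ∘ suc))

sum-δ : ∀ {n} (d : Fin n) → sum (λ c → δ c d) ≡ 1
sum-δ {suc n} zero    = cong suc (sum-zero (λ c → δ {suc n} (suc c) zero) (λ c → refl))
sum-δ {suc n} (suc d) = trans (sum-cong-≗ (λ c → δ-suc c d)) (sum-δ d)

sum-count : ∀ {n} (xs : List (Fin n)) → sum (λ c → count c xs) ≡ length xs
sum-count {n} []   = sum-zero {n} _ λ _ → refl
sum-count (x ∷ xs) = trans (∑-distrib-+ (λ c → δ c x) (λ c → count c xs)) (cong₂ _+_ (sum-δ x) (sum-count xs))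

size≡sum : ∀ {n} (h : Row n) → size h ≡ sum (λ c → # c h)
size≡sum h = sym (sum-count (letters h))

-- The signature rule

-- The number of opening brackets that remain after all deletions. The head is the rightmost factor:
-- its closing letters come first and cancel openings of the tail, which stands to its left; then
-- its own openings are added.
ε : ∀ {n ℓ} → Fin n → Tensor n ℓ → ℕ
ε i []      = 0
ε i (h ∷ t) = (ε i t ∸ # (closeLetter i) h) + # (openLetter i) h

-- One closing letter of colour i has become an opening one. Stated additively, to avoid truncated
-- subtraction.
record Raises {n} (i : Fin n) (h h′ : Row n) : Set where
  constructor raises
  field at : ∀ c → # c h + δ c (openLetter i) ≡ # c h′ + δ c (closeLetter i)

-- The arrow of f_i, with the index of the factor it acts on. The rightmost remaining closing
-- bracket lies in the head exactly if the head has more closing letters than the tail has remaining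
-- openings.
data Step {n} (i : Fin n) : ∀ {ℓ} → ℕ → Tensor n ℓ → Tensor n ℓ → Set where
  here  : ∀ {ℓ} {h h′} {t : Tensor n ℓ} → ε i t < # (closeLetter i) h → Raises i h h′ →
          Step i 0 (h ∷ t) (h′ ∷ t)
  there : ∀ {ℓ p} {h} {t t′ : Tensor n ℓ} → # (closeLetter i) h ≤ ε i t → Step i p t t′ →
          Step i (suc p) (h ∷ t) (h ∷ t′)

ascending : ∀ {n} (h : Row n) → AllPairs Fin._≤_ (letters h)
ascending {n} (mkRow xs xs↗) = Linked.Linked⇒AllPairs Fin.≤-trans (recompute (sorted? Fin._≤?_ xs) xs↗)
  where open SortedList (Fin.≤-totalOrder n) using (sorted?)

-- Reduction of bracket words

module _ {A : Set} where

  addOpening : List A × ℕ → List A × ℕ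
  addOpening ([]     , k) = [] , suc k
  addOpening (_ ∷ ps , k) = ps , k

  reduce : List (Bracket A) → List A × ℕ
  reduce []               = [] , 0
  reduce (closing p ∷ bs) = let ps , k = reduce bs in p ∷ ps , k
  reduce (opening p ∷ bs) = addOpening (reduce bs)

  closings : List (Bracket A) → List A
  closings bs = proj₁ (reduce bs)

  openings : List (Bracket A) → ℕ
  openings bs = proj₂ (reduce bs)

  deletePairs-closings : ∀ (bs : List (Bracket A)) → Σ[ os ∈ List A ]
    deletePairs bs ≡ List.map closing (closings bs) ++ List.map opening os
  deletePairs-closings [] = [] , refl
  deletePairs-closings (closing p ∷ bs) with os , eq ← deletePairs-closings bs = os , cong (closing p ∷_) eq
  deletePairs-closings (opening p ∷ bs) with reduce bs | deletePairs-closings bs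
  ... | []     , k | []     , eq rewrite eq = p ∷ [] , refl
  ... | []     , k | o ∷ os , eq rewrite eq = p ∷ o ∷ os , refl
  ... | _ ∷ ps , k | os     , eq rewrite eq = os , refl

  mapMaybe-getClosing : ∀ (ps os : List A) →
    mapMaybe getClosing (List.map closing ps ++ List.map opening os) ≡ ps
  mapMaybe-getClosing []       []       = refl
  mapMaybe-getClosing []       (o ∷ os) = mapMaybe-getClosing [] os
  mapMaybe-getClosing (p ∷ ps) os       = cong (p ∷_) (mapMaybe-getClosing ps os)

  getClosing-deletePairs : ∀ bs → mapMaybe getClosing (deletePairs bs) ≡ closings bs
  getClosing-deletePairs bs with os , eq ← deletePairs-closings bs =
    trans (cong (mapMaybe getClosing) eq) (mapMaybe-getClosing (closings bs) os)

  -- The openings left over on the left cancel the first closings left over on the right, whence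
  -- `drop` and the truncated difference.
  reduce-++ : ∀ (bs cs : List (Bracket A)) → reduce (bs ++ cs) ≡
    (closings bs ++ drop (openings bs) (closings cs) ,
     (openings bs ∸ length (closings cs)) + openings cs)
  reduce-++ [] cs = cong (λ k → closings cs , k + openings cs) (sym (ℕ.0∸n≡0 (length (closings cs))))
  reduce-++ (closing p ∷ bs) cs rewrite reduce-++ bs cs = refl
  reduce-++ (opening p ∷ bs) cs rewrite reduce-++ bs cs with reduce bs
  ... | _ ∷ ps , k = refl
  ... | [] , k = matchOpening k (closings cs)
    where
    matchOpening : ∀ k ds → addOpening (drop k ds , (k ∸ length ds) + openings cs) ≡
                   (drop (suc k) ds , (suc k ∸ length ds) + openings cs)
    matchOpening zero    []       = refl
    matchOpening zero    (d ∷ ds) = cong (λ j → ds , j + openings cs) (sym (ℕ.0∸n≡0 (length ds)))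
    matchOpening (suc k) []       = refl
    matchOpening (suc k) (d ∷ ds) = matchOpening k ds

  reduce-blocks : ∀ ps os → reduce (List.map closing ps ++ List.map opening os) ≡ (ps , length os)
  reduce-blocks []       []       = refl
  reduce-blocks []       (o ∷ os) = cong addOpening (reduce-blocks [] os)
  reduce-blocks (p ∷ ps) os       = cong (λ (ps , k) → p ∷ ps , k) (reduce-blocks ps os)

mapBracket : ∀ {A B : Set} → (A → B) → Bracket A → Bracket B
mapBracket g (closing p) = closing (g p)
mapBracket g (opening p) = opening (g p)

reduce-map : ∀ {A B : Set} (g : A → B) bs →
  reduce (List.map (mapBracket g) bs) ≡ (List.map g (closings bs) , openings bs)
reduce-map g []               = refl
reduce-map g (closing p ∷ bs) rewrite reduce-map g bs = refl
reduce-map g (opening p ∷ bs) rewrite reduce-map g bs with reduce bs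
... | []     , k = refl
... | _ ∷ ps , k = refl

-- A row contributes all its brackets of one kind before those of the other kind.

module _ {n} {A : Set} {a b : Fin n} (a<b : a Fin.< b) {F G : A → Bracket A} (br : Fin n → A → Maybe (Bracket A))
         (br-a : ∀ p → br a p ≡ just (F p)) (br-b : ∀ p → br b p ≡ just (G p))
         (br-else : ∀ {x} p → x ≢ a → x ≢ b → br x p ≡ nothing) where

  select : ∀ {xs} → AllPairs Fin._≤_ xs → (g : Fin (length xs) → A) →
    Σ[ ps ∈ List A ] Σ[ os ∈ List A ]
      List.catMaybes (tabulate (λ k → br (List.lookup xs k) (g k))) ≡ List.map F ps ++ List.map G os
      × length ps ≡ count a xs × length os ≡ count b xs
      × All (λ p → ∃[ k ] p ≡ g k × List.lookup xs k ≡ a) ps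
      × All (λ p → ∃[ k ] p ≡ g k × List.lookup xs k ≡ b) os
  select {[]} [] g = [] , [] , refl , refl , refl , [] , []
  select {x ∷ xs} (x≤xs ∷ xs↗) g
    with ps , os , eq , |ps| , |os| , psOK , osOK ← select xs↗ (g ∘ suc)
    with x Fin.≟ a
  ... | yes refl rewrite br-a (g zero) =
      g zero ∷ ps , os , cong (F (g zero) ∷_) eq
    , cong₂ _+_ (sym (δ-refl x)) |ps| , cong₂ _+_ (sym (δ-≢ {c = b} (Fin.<⇒≢ a<b ∘ sym))) |os|
    , (zero , refl , refl) ∷ All.map (λ (k , p , q) → suc k , p , q) psOK
    , All.map (λ (k , p , q) → suc k , p , q) osOK
  ... | no x≢a with x Fin.≟ b
  ... | no x≢b rewrite br-else (g zero) x≢a x≢b =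
      ps , os , eq
    , cong₂ _+_ (sym (δ-≢ {c = a} (x≢a ∘ sym))) |ps| , cong₂ _+_ (sym (δ-≢ {c = b} (x≢b ∘ sym))) |os|
    , All.map (λ (k , p , q) → suc k , p , q) psOK
    , All.map (λ (k , p , q) → suc k , p , q) osOK
  ... | yes refl rewrite br-b (g zero) with ps | |ps| | psOK
  ...   | []    | 0≡ | [] =
      [] , g zero ∷ os , cong (G (g zero) ∷_) eq
    , cong₂ _+_ (sym (δ-≢ {c = a} (x≢a ∘ sym))) 0≡ , cong₂ _+_ (sym (δ-refl x)) |os|
    , [] , (zero , refl , refl) ∷ All.map (λ (k , p , q) → suc k , p , q) osOK
  ...   | _ ∷ _ | _ | (k , _ , xk≡a) ∷ _ =
      contradiction (subst (Fin._≤_ _) xk≡a (All.lookup x≤xs (∈-lookup k))) (ℕ.<⇒≱ a<b)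

letterBracket : ∀ {n} {A : Set} → Fin n → Fin n → A → Maybe (Bracket A)
letterBracket i c p =
  if does (c Fin.≟ closeLetter i) then just (closing p)
  else if does (c Fin.≟ openLetter i) then just (opening p)
  else nothing

letterBracket-map : ∀ {n} {A B : Set} (i : Fin n) (g : A → B) c p →
  letterBracket i c (g p) ≡ Maybe.map (mapBracket g) (letterBracket i c p)
letterBracket-map i g c p with c Fin.≟ closeLetter i
... | yes _ = refl
... | no  _ with c Fin.≟ openLetter i
... | yes _ = refl
... | no  _ = refl

module _ {n} {A : Set} (i : Fin n) (cl≢op : closeLetter i ≢ openLetter i) where

  letterBracket-close : (p : A) → letterBracket i (closeLetter i) p ≡ just (closing p)
  letterBracket-close p rewrite dec-true (closeLetter i Fin.≟ closeLetter i) refl = refl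

  letterBracket-open : (p : A) → letterBracket i (openLetter i) p ≡ just (opening p)
  letterBracket-open p rewrite dec-false (openLetter i Fin.≟ closeLetter i) (cl≢op ∘ sym)
                             | dec-true (openLetter i Fin.≟ openLetter i) refl = refl

  letterBracket-else : ∀ {x} (p : A) → x ≢ closeLetter i → x ≢ openLetter i → letterBracket i x p ≡ nothing
  letterBracket-else {x} p x≢cl x≢op rewrite dec-false (x Fin.≟ closeLetter i) x≢cl
                                           | dec-false (x Fin.≟ openLetter i) x≢op = refl

close≢open : ∀ {m} (i : Fin (suc (suc m))) → closeLetter i ≢ openLetter i
close≢open (suc i) eq = ℕ.1+n≢n (trans (sym (cong toℕ eq)) (Fin.toℕ-inject₁ i))

mapMaybe-reverse : ∀ {A B : Set} (g : A → Maybe B) xs → mapMaybe g (reverse xs) ≡ reverse (mapMaybe g xs)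
mapMaybe-reverse g []       = refl
mapMaybe-reverse g (x ∷ xs) = begin
  mapMaybe g (reverse (x ∷ xs))                  ≡⟨ cong (mapMaybe g) (List.unfold-reverse x xs) ⟩
  mapMaybe g (reverse xs ∷ʳ x)                   ≡⟨ List.mapMaybe-++ g (reverse xs) (x ∷ []) ⟩
  mapMaybe g (reverse xs) ++ mapMaybe g (x ∷ []) ≡⟨ cong (_++ mapMaybe g (x ∷ [])) (mapMaybe-reverse g xs) ⟩
  reverse (mapMaybe g xs) ++ mapMaybe g (x ∷ []) ≡⟨ last-step ⟩
  reverse (mapMaybe g (x ∷ xs))                  ∎
  where
  open ≡-Reasoning
  last-step : reverse (mapMaybe g xs) ++ mapMaybe g (x ∷ []) ≡ reverse (mapMaybe g (x ∷ xs))
  last-step with g x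
  ... | just y  = sym (List.unfold-reverse y (mapMaybe g xs))
  ... | nothing = List.++-identityʳ _

module _ {m : ℕ} where

  -- For colour 0 the opening letter is the smallest and the closing one the largest, so an
  -- ascending row lists openings first. Reading the row backwards restores closings before
  -- openings, the form of all other colours.
  rowBrackets : ∀ {A : Set} (i : Fin (2 + m)) (h : Row (2 + m)) (g : Fin (size h) → A) →
    Σ[ ps ∈ List A ] Σ[ os ∈ List A ]
      mapMaybe (λ k → letterBracket i (List.lookup (letters h) k) (g k)) (readRow i (allFin (size h)))
        ≡ List.map closing ps ++ List.map opening os
      × length ps ≡ # (closeLetter i) h × length os ≡ # (openLetter i) h
      × All (λ p → ∃[ k ] p ≡ g k × List.lookup (letters h) k ≡ closeLetter i) ps
  rowBrackets {A} (suc i) h g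
    with ps , os , eq , |ps| , |os| , psOK , _ ← select (ℕ.≤-reflexive (cong suc (Fin.toℕ-inject₁ i))) (letterBracket (suc i))
           (letterBracket-close (suc i) (close≢open (suc i))) (letterBracket-open (suc i) (close≢open (suc i)))
           (letterBracket-else (suc i) (close≢open (suc i))) (ascending h) g
    = ps , os , trans (cong List.catMaybes (List.map-tabulate id (λ k → letterBracket (suc i) (List.lookup (letters h) k) (g k)))) eq , |ps| , |os| , psOK
  rowBrackets {A} zero h g
    with os , ps , eq , |os| , |ps| , _ , psOK ← select (s≤s z≤n) (letterBracket {2 + m} zero)
           (letterBracket-open {2 + m} zero (close≢open {m} zero)) (letterBracket-close {2 + m} zero (close≢open {m} zero))
           (λ p ≢op ≢cl → letterBracket-else {2 + m} zero (close≢open {m} zero) p ≢cl ≢op) (ascending h) g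
    = reverse ps , reverse os
    , (begin
        mapMaybe br (reverse (allFin (size h)))                    ≡⟨ mapMaybe-reverse br (allFin (size h)) ⟩
        reverse (mapMaybe br (allFin (size h)))                    ≡⟨ cong (reverse ∘ List.catMaybes) (List.map-tabulate id br) ⟩
        reverse (List.catMaybes (tabulate br))                     ≡⟨ cong reverse eq ⟩
        reverse (List.map opening os ++ List.map closing ps)      ≡⟨ List.reverse-++ (List.map opening os) (List.map closing ps) ⟩
        reverse (List.map closing ps) ++ reverse (List.map opening os) ≡⟨ cong₂ _++_ (sym (List.reverse-map closing ps)) (sym (List.reverse-map opening os)) ⟩
        List.map closing (reverse ps) ++ List.map opening (reverse os) ∎)
    , trans (List.length-reverse ps) |ps| , trans (List.length-reverse os) |os| , Perm.All-resp-↭ (↭-sym (Perm.↭-reverse ps)) psOK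
    where
    open ≡-Reasoning
    br = λ k → letterBracket {2 + m} zero (List.lookup (letters h) k) (g k)

  shift : ∀ {ℓ} (h : Row (2 + m)) (t : Tensor (2 + m) ℓ) → Position t → Position (h ∷ t)
  shift h t (j , k) = suc j , k

  readRow-map : ∀ {A B : Set} (i : Fin (2 + m)) (g : A → B) xs → readRow i (List.map g xs) ≡ List.map g (readRow i xs)
  readRow-map zero    g xs = sym (List.reverse-map g xs)
  readRow-map (suc i) g xs = refl

  word-∷ : ∀ {ℓ} (i : Fin (2 + m)) (h : Row (2 + m)) (t : Tensor (2 + m) ℓ) →
    word i (h ∷ t) ≡ List.map (shift h t) (word i t) ++ List.map (zero ,_) (readRow i (allFin (size h)))
  word-∷ {ℓ} i h t = begin
    concatMap rd (reverse (allFin (suc ℓ)))                                    ≡⟨ cong (concatMap rd) (List.unfold-reverse zero (tabulate suc)) ⟩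
    concatMap rd (reverse (tabulate suc) ∷ʳ zero)                              ≡⟨ cong (λ js → concatMap rd (reverse js ∷ʳ zero)) (sym (List.map-tabulate id suc)) ⟩
    concatMap rd (reverse (List.map suc (allFin ℓ)) ∷ʳ zero)                   ≡⟨ cong (λ js → concatMap rd (js ∷ʳ zero)) (sym (List.reverse-map suc (allFin ℓ))) ⟩
    concatMap rd (List.map suc (reverse (allFin ℓ)) ∷ʳ zero)                   ≡⟨ List.concatMap-++ rd (List.map suc (reverse (allFin ℓ))) (zero ∷ []) ⟩
    concatMap rd (List.map suc (reverse (allFin ℓ))) ++ concatMap rd (zero ∷ []) ≡⟨ cong₂ _++_ left right ⟩
    List.map (shift h t) (word i t) ++ List.map (zero ,_) (readRow i (allFin (size h))) ∎
    where
    open ≡-Reasoning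
    rd : Fin (suc ℓ) → List (Position (h ∷ t))
    rd = readRow i ∘ positionsIn (h ∷ t)
    rd-suc : ∀ j → rd (suc j) ≡ List.map (shift h t) (readRow i (positionsIn t j))
    rd-suc j = trans (cong (readRow i) (List.map-∘ (allFin (size (lookup t j))))) (readRow-map i (shift h t) (positionsIn t j))
    left : concatMap rd (List.map suc (reverse (allFin ℓ))) ≡ List.map (shift h t) (word i t)
    left = begin
      concatMap rd (List.map suc (reverse (allFin ℓ)))                          ≡⟨ List.concatMap-map rd suc (reverse (allFin ℓ)) ⟩
      concatMap (rd ∘ suc) (reverse (allFin ℓ))                                 ≡⟨ List.concatMap-cong rd-suc (reverse (allFin ℓ)) ⟩
      concatMap (List.map (shift h t) ∘ readRow i ∘ positionsIn t) (reverse (allFin ℓ)) ≡⟨ sym (List.map-concatMap (shift h t) (readRow i ∘ positionsIn t) (reverse (allFin ℓ))) ⟩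
      List.map (shift h t) (word i t)                                                 ∎
    right : concatMap rd (zero ∷ []) ≡ List.map (zero ,_) (readRow i (allFin (size h)))
    right = trans (List.++-identityʳ _) (readRow-map i (zero ,_) (allFin (size h)))

  brackets : ∀ {ℓ} (i : Fin (2 + m)) (t : Tensor (2 + m) ℓ) → List (Bracket (Position t))
  brackets i t = mapMaybe (bracket i t) (word i t)

  bracket-shift : ∀ {ℓ} (i : Fin (2 + m)) (h : Row (2 + m)) (t : Tensor (2 + m) ℓ) p →
    bracket i (h ∷ t) (shift h t p) ≡ Maybe.map (mapBracket (shift h t)) (bracket i t p)
  bracket-shift i h t p = letterBracket-map i (shift h t) (letterAt t p) p

  rowPositions : ∀ {ℓ} (i : Fin (2 + m)) (h : Row (2 + m)) (t : Tensor (2 + m) ℓ) → Σ[ ps ∈ List (Position (h ∷ t)) ] Σ[ os ∈ List (Position (h ∷ t)) ]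
      brackets i (h ∷ t) ≡ List.map (mapBracket (shift h t)) (brackets i t) ++ (List.map closing ps ++ List.map opening os)
      × length ps ≡ # (closeLetter i) h × length os ≡ # (openLetter i) h
      × All (λ p → ∃[ k ] p ≡ (zero , k) × List.lookup (letters h) k ≡ closeLetter i) ps
  rowPositions i h t with ps , os , eq , props ← rowBrackets {A = Position (h ∷ t)} i h (zero ,_) =
    ps , os , (begin
      mapMaybe br (word i (h ∷ t))                                       ≡⟨ cong (mapMaybe br) (word-∷ i h t) ⟩
      mapMaybe br (List.map (shift h t) (word i t) ++ List.map (zero ,_) read) ≡⟨ List.mapMaybe-++ br (List.map (shift h t) (word i t)) _ ⟩
      mapMaybe br (List.map (shift h t) (word i t)) ++ mapMaybe br (List.map (zero ,_) read)
        ≡⟨ cong₂ _++_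
             (trans (List.mapMaybe-map br (shift h t) (word i t))
               (trans (List.mapMaybe-cong (bracket-shift i h t) (word i t))
                      (sym (List.map-mapMaybe (mapBracket (shift h t)) (bracket i t) (word i t)))))
             (trans (List.mapMaybe-map br (zero ,_) read) eq) ⟩
      List.map (mapBracket (shift h t)) (brackets i t) ++ (List.map closing ps ++ List.map opening os) ∎)
    , props
    where
    open ≡-Reasoning
    br = bracket i (h ∷ t)
    read = readRow i (allFin (size h))

  reduce-∷ : ∀ {ℓ} (i : Fin (2 + m)) (h : Row (2 + m)) (t : Tensor (2 + m) ℓ) → Σ[ ps ∈ List (Position (h ∷ t)) ]
      closings (brackets i (h ∷ t)) ≡ List.map (shift h t) (closings (brackets i t)) ++ drop (openings (brackets i t)) ps
      × openings (brackets i (h ∷ t)) ≡ (openings (brackets i t) ∸ # (closeLetter i) h) + # (openLetter i) h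
      × length ps ≡ # (closeLetter i) h
      × All (λ p → ∃[ k ] p ≡ (zero , k) × List.lookup (letters h) k ≡ closeLetter i) ps
  reduce-∷ i h t with ps , os , eq , |ps| , |os| , psOK ← rowPositions i h t = ps , cong proj₁ red , trans (cong proj₂ red) (cong₂ (λ a b → (openings (brackets i t) ∸ a) + b) |ps| |os|) , |ps| , psOK
    where
    open ≡-Reasoning
    bs = brackets i t
    red : reduce (brackets i (h ∷ t)) ≡ (List.map (shift h t) (closings bs) ++ drop (openings bs) ps , (openings bs ∸ length ps) + length os)
    red = begin
      reduce (brackets i (h ∷ t)) ≡⟨ cong reduce eq ⟩
      reduce (List.map (mapBracket (shift h t)) bs ++ (List.map closing ps ++ List.map opening os))
        ≡⟨ reduce-++ (List.map (mapBracket (shift h t)) bs) _ ⟩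
      (proj₁ r ++ drop (proj₂ r) (proj₁ s) , (proj₂ r ∸ length (proj₁ s)) + proj₂ s)
        ≡⟨ cong₂ (λ r s → proj₁ r ++ drop (proj₂ r) (proj₁ s) , (proj₂ r ∸ length (proj₁ s)) + proj₂ s) (reduce-map (shift h t) bs) (reduce-blocks ps os) ⟩
      (List.map (shift h t) (closings bs) ++ drop (openings bs) ps , (openings bs ∸ length ps) + length os) ∎
      where
      r = reduce (List.map (mapBracket (shift h t)) bs)
      s = reduce (List.map closing ps ++ List.map opening os)

  openings≡ε : ∀ {ℓ} (i : Fin (2 + m)) (t : Tensor (2 + m) ℓ) → openings (brackets i t) ≡ ε i t
  openings≡ε i []      = refl
  openings≡ε i (h ∷ t) with _ , _ , eq , _ ← reduce-∷ i h t =
    trans eq (cong (λ k → (k ∸ # (closeLetter i) h) + # (openLetter i) h) (openings≡ε i t))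

  rightmostClosing≡ : ∀ {ℓ} (i : Fin (2 + m)) (t : Tensor (2 + m) ℓ) → rightmostClosing i t ≡ List.last (closings (brackets i t))
  rightmostClosing≡ i t = cong List.last (getClosing-deletePairs (brackets i t))

  last-++-drop : ∀ {A : Set} {P : A → Set} (ps qs : List A) → ∀ k → k < length qs → All P qs →
                 ∃[ p ] List.last (ps ++ drop k qs) ≡ just p × P p
  last-++-drop (p ∷ []) qs k k< Pqs with drop k qs | last-++-drop [] qs k k< Pqs
  ... | _ ∷ _ | res = res
  last-++-drop (p ∷ ps@(_ ∷ _)) qs k k< Pqs = last-++-drop ps qs k k< Pqs
  last-++-drop [] (q ∷ qs) (suc k) (s≤s k<) (_ ∷ Pqs) = last-++-drop [] qs k k< Pqs
  last-++-drop [] (q ∷ []) zero k< (Pq ∷ _) = q , refl , Pq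
  last-++-drop [] (q ∷ qs@(_ ∷ _)) zero k< (_ ∷ Pqs) = last-++-drop [] qs zero (s≤s z≤n) Pqs

  count-∷= : ∀ (xs : List (Fin (2 + m))) k c d → count d (xs [ k ]∷= c) + δ d (List.lookup xs k) ≡ count d xs + δ d c
  count-∷= (x ∷ xs) zero    c d = trans (ℕ.+-comm _ (δ d x)) (trans (sym (ℕ.+-assoc (δ d x) (δ d c) _))
    (trans (cong (_+ count d xs) (ℕ.+-comm (δ d x) (δ d c))) (trans (ℕ.+-assoc (δ d c) (δ d x) _) (ℕ.+-comm (δ d c) _))))
  count-∷= (x ∷ xs) (suc k) c d = trans (ℕ.+-assoc (δ d x) _ _) (trans (cong (δ d x +_) (count-∷= xs k c d)) (sym (ℕ.+-assoc (δ d x) _ _)))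

  -- Rows are sorted again after the change and are determined by their counts, so only the factor
  -- and the letter at the found position matter.
  step⇒changeLetter : ∀ {ℓ p} {i : Fin (2 + m)} {t t′ : Tensor (2 + m) ℓ} → Step i p t t′ →
    Σ[ q ∈ Position t ] rightmostClosing i t ≡ just q × changeLetter t q (openLetter i) ≡ t′
  step⇒changeLetter {i = i} (here {h = h} {h′} {t} ε< r)
    with ps , eq , _ , |ps| , psOK ← reduce-∷ i h t
    with _ , last≡ , k , refl , xk≡ ← last-++-drop (List.map (shift h t) (closings (brackets i t))) ps (openings (brackets i t))
           (ℕ.≤-trans (ℕ.≤-reflexive (cong suc (openings≡ε i t))) (ℕ.≤-trans ε< (ℕ.≤-reflexive (sym |ps|)))) psOK
    = (zero , k) , trans (rightmostClosing≡ i (h ∷ t)) (trans (cong List.last eq) last≡)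
    , cong (_∷ t) (row-ext λ c → ℕ.+-cancelʳ-≡ (δ c (closeLetter i)) _ _ (begin
        # c (row (letters h [ k ]∷= openLetter i)) + δ c (closeLetter i) ≡⟨ cong₂ _+_ (#-row c (letters h [ k ]∷= openLetter i)) (cong (δ c) (sym xk≡)) ⟩
        count c (letters h [ k ]∷= openLetter i) + δ c (List.lookup (letters h) k) ≡⟨ count-∷= (letters h) k (openLetter i) c ⟩
        # c h + δ c (openLetter i) ≡⟨ Raises.at r c ⟩
        # c h′ + δ c (closeLetter i) ∎))
    where open ≡-Reasoning
  step⇒changeLetter {i = i} (there {h = h} {t} {t′} cl≤ s)
    with ps , eq , _ , |ps| , psOK ← reduce-∷ i h t
    with q , rc , ch ← step⇒changeLetter s
    = shift h t q , (begin
        rightmostClosing i (h ∷ t)                    ≡⟨ rightmostClosing≡ i (h ∷ t) ⟩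
        List.last (closings (brackets i (h ∷ t)))     ≡⟨ cong List.last eq ⟩
        List.last (List.map (shift h t) cs ++ drop (openings (brackets i t)) ps)
          ≡⟨ cong (λ ds → List.last (List.map (shift h t) cs ++ ds)) (List.drop-all _ ps
               (ℕ.≤-trans (ℕ.≤-reflexive |ps|) (ℕ.≤-trans cl≤ (ℕ.≤-reflexive (sym (openings≡ε i t)))))) ⟩
        List.last (List.map (shift h t) cs ++ [])           ≡⟨ cong List.last (List.++-identityʳ (List.map (shift h t) cs)) ⟩
        List.last (List.map (shift h t) cs)                 ≡⟨ List.last-map (shift h t) cs ⟩
        Maybe.map (shift h t) (List.last cs)                ≡⟨ cong (Maybe.map (shift h t)) (trans (sym (rightmostClosing≡ i t)) rc) ⟩
        just (shift h t q)                                ∎)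
    , cong (h ∷_) ch
    where
    open ≡-Reasoning
    cs = closings (brackets i t)

  map-size-step : ∀ {ℓ p} {i : Fin (2 + m)} {t t′ : Tensor (2 + m) ℓ} → Step i p t t′ → Vec.map size t′ ≡ Vec.map size t
  map-size-step {t = t} s with q , _ , refl ← step⇒changeLetter s = sizes-changeLetter t q _

  step⇒arrow : ∀ {ℓ} {μ : Vec ℕ ℓ} {p} {i : Fin (2 + m)} {H H′ : 𝓗 (2 + m) μ} → Step i p (factors H) (factors H′) → Arrow i H H′
  step⇒arrow {i = i} {H} {H′} s = arrow (step⇒changeLetter s)
    where
    arrow : Σ[ q ∈ Position (factors H) ] rightmostClosing i (factors H) ≡ just q × changeLetter (factors H) q (openLetter i) ≡ factors H′ → Arrow i H H′
    arrow (q , rc , refl) = cong (Maybe.map _) rc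

-- Pairings of dots as flows on the cycle of boxes

lastLetter : ∀ {n} → Fin (suc n)
lastLetter {n} = fromℕ n

module _ {n} {P : Fin (suc n) → Set} where

  -- From any box one reaches the first box going up, then the last box, and from there every box.
  cyclic-induction : (∀ d → P d → P (closeLetter d)) → ∀ {c} → P c → ∀ d → P d
  cyclic-induction step {c} Pc = Fin.>-weakInduction P (step zero (toZero (toℕ c) c refl Pc)) (λ d → step (suc d))
    where
    toZero : ∀ k d → toℕ d ≡ k → P d → P zero
    toZero _       zero    _  Pd = Pd
    toZero (suc k) (suc d) eq Pd = toZero k (inject₁ d) (trans (Fin.toℕ-inject₁ d) (ℕ.suc-injective eq)) (step (suc d) Pd)

  cyclic-induction⁻ : (∀ d → P (closeLetter d) → P d) → ∀ {c} → P c → ∀ d → P d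
  cyclic-induction⁻ step {c} Pc = Fin.<-weakInduction P (step zero (Fin.<-weakInduction-startingFrom P Pc (λ d → step (suc d)) (Fin.≤fromℕ c))) (λ d → step (suc d))

-- Crossing numbers of the pairing of right dots x with left dots y: T c counts
-- the pairs whose segment, drawn upwards from the right dot and continued
-- cyclically, enters box c from below.

Flow : ∀ {n} → (x y T : Fin n → ℕ) → Set
Flow x y T = ∀ c → T (closeLetter c) ≡ (T c ∸ y c) + x c

-- Excludes circulations: if T exceeded y in every box, T + 1 would satisfy the same recursion. In a
-- tight box all entering segments end.
Tight : ∀ {n} → (y T : Fin n → ℕ) → Set
Tight y T = ∃[ c ] T c ≤ y c

-- Above a tight box only the segments starting in it remain, which is the least value any flow can
-- have there; the recursion is monotone and carries the inequality around the cycle.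
flow-≤ : ∀ {n} {x y T T′ : Fin (suc n) → ℕ} → Flow x y T → Tight y T → Flow x y T′ → ∀ c → T c ≤ T′ c
flow-≤ {n} {x} {y} {T} {T′} fl (d , tight) fl′ = cyclic-induction propagate {closeLetter d} base
  where
  open ℕ.≤-Reasoning
  base : T (closeLetter d) ≤ T′ (closeLetter d)
  base = begin
    T (closeLetter d)    ≡⟨ fl d ⟩
    (T d ∸ y d) + x d    ≡⟨ cong (_+ x d) (ℕ.m≤n⇒m∸n≡0 tight) ⟩
    x d                  ≤⟨ ℕ.m≤n+m (x d) (T′ d ∸ y d) ⟩
    (T′ d ∸ y d) + x d   ≡⟨ fl′ d ⟨
    T′ (closeLetter d)   ∎
  propagate : ∀ c → T c ≤ T′ c → T (closeLetter c) ≤ T′ (closeLetter c)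
  propagate c T≤T′ = begin
    T (closeLetter c)    ≡⟨ fl c ⟩
    (T c ∸ y c) + x c    ≤⟨ ℕ.+-monoˡ-≤ (x c) (ℕ.∸-monoˡ-≤ (y c) T≤T′) ⟩
    (T′ c ∸ y c) + x c   ≡⟨ fl′ c ⟨
    T′ (closeLetter c)   ∎

flow-unique : ∀ {n} {x y T T′ : Fin (suc n) → ℕ} → Flow x y T → Tight y T → Flow x y T′ → Tight y T′ → ∀ c → T c ≡ T′ c
flow-unique fl ti fl′ ti′ c = ℕ.≤-antisym (flow-≤ fl ti fl′ c) (flow-≤ fl′ ti′ fl c)

below : ∀ {n} → Fin n → Fin n → ℕ
below a c with c Fin.<? a
... | yes _ = 1
... | no _  = 0

below-< : ∀ {n} {a c : Fin n} → c Fin.< a → below a c ≡ 1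
below-< {a = a} {c} c<a with c Fin.<? a
... | yes _   = refl
... | no c≮a = contradiction c<a c≮a

below-≮ : ∀ {n} {a c : Fin n} → ¬ (c Fin.< a) → below a c ≡ 0
below-≮ {a = a} {c} c≮a with c Fin.<? a
... | yes c<a = contradiction c<a c≮a
... | no _    = refl

wrap : ∀ {n} → Fin n → ℕ
wrap zero    = 1
wrap (suc _) = 0

-- The difference of a step function between neighbouring boxes; `wrap` corrects the passage from
-- the highest box to the lowest.
below-close : ∀ {n} (a c : Fin (suc n)) → below a (closeLetter c) + wrap c ≡ below a c + δ c a
below-close a zero rewrite below-≮ {a = a} {fromℕ _} (ℕ.≤⇒≯ (Fin.≤fromℕ a)) with a
... | zero  = refl
... | suc _ = refl
below-close a (suc d) with suc d Fin.≟ a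
... | yes refl rewrite below-< {a = a} {inject₁ d} (ℕ.≤-reflexive (cong suc (Fin.toℕ-inject₁ d)))
                     | below-≮ {a = a} {suc d} (ℕ.<-irrefl refl) = refl
... | no d≢a with suc d Fin.<? a
... | yes d<a rewrite below-< {a = a} {inject₁ d} (ℕ.≤-trans (ℕ.≤-reflexive (cong suc (Fin.toℕ-inject₁ d))) (ℕ.<⇒≤ d<a)) = refl
... | no d≮a rewrite below-≮ {a = a} {inject₁ d} (λ d′<a → d≮a (ℕ.≤∧≢⇒< (ℕ.≤-trans (ℕ.≤-reflexive (cong suc (sym (Fin.toℕ-inject₁ d)))) d′<a) (d≢a ∘ Fin.toℕ-injective))) = refl

-- on c = 1 if the segment drawn from the right dot x up to the left dot y enters box c
-- from below, and 0 otherwise.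

record Segment {n} (x y : Fin (suc n)) (w : ℕ) : Set where
  field
    on      : Fin (suc n) → ℕ
    on≡     : ∀ c → on c + below y c ≡ below x c + w
    on-y    : on y ≡ 1
    on-0∨1  : ∀ c → on c ≡ 0 ⊎ on c ≡ 1

  on-last : on lastLetter ≡ w
  on-last = begin
    on lastLetter                      ≡⟨ ℕ.+-identityʳ _ ⟨
    on lastLetter + 0                  ≡⟨ cong (on lastLetter +_) (below-≮ (ℕ.≤⇒≯ (Fin.≤fromℕ y))) ⟨
    on lastLetter + below y lastLetter ≡⟨ on≡ lastLetter ⟩
    below x lastLetter + w             ≡⟨ cong (_+ w) (below-≮ (ℕ.≤⇒≯ (Fin.≤fromℕ x))) ⟩
    w                                  ∎
    where open ≡-Reasoning

  -- A conservation law: the segment has its source at x and its sink at y. The winding number w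
  -- cancels.
  divergence : ∀ c → on (closeLetter c) + δ c y ≡ on c + δ c x
  divergence c = ℕ.+-cancelʳ-≡ (below y c) _ _ (begin
    on c′ + δ c y + below y c             ≡⟨ lemma₁ (on c′) (δ c y) (below y c) ⟩
    on c′ + (below y c + δ c y)           ≡⟨ cong (on c′ +_) (below-close y c) ⟨
    on c′ + (below y c′ + wrap c)         ≡⟨ ℕ.+-assoc (on c′) (below y c′) (wrap c) ⟨
    on c′ + below y c′ + wrap c           ≡⟨ cong (_+ wrap c) (on≡ c′) ⟩
    below x c′ + w + wrap c               ≡⟨ lemma₂ (below x c′) w (wrap c) ⟩
    below x c′ + wrap c + w               ≡⟨ cong (_+ w) (below-close x c) ⟩
    below x c + δ c x + w                 ≡⟨ lemma₂ (below x c) (δ c x) w ⟩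
    below x c + w + δ c x                 ≡⟨ cong (_+ δ c x) (on≡ c) ⟨
    on c + below y c + δ c x              ≡⟨ lemma₂ (on c) (below y c) (δ c x) ⟩
    on c + δ c x + below y c              ∎)
    where
    open ≡-Reasoning
    c′ = closeLetter c
    lemma₁ : ∀ a b c → a + b + c ≡ a + (c + b)
    lemma₁ = solve-∀
    lemma₂ : ∀ a b c → a + b + c ≡ a + c + b
    lemma₂ = solve-∀

straight : ∀ {n} {x y : Fin (suc n)} → y Fin.< x → Segment x y 0
straight {x = x} {y} y<x = record
  { on     = λ c → below x c ∸ below y c
  ; on≡    = λ c → trans (ℕ.m∸n+n≡m (y≤x c)) (sym (ℕ.+-identityʳ _))
  ; on-y   = cong₂ _∸_ (below-< y<x) (below-≮ {a = y} {y} (ℕ.<-irrefl refl))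
  ; on-0∨1 = 0∨1
  }
  where
  y≤x : ∀ c → below y c ≤ below x c
  y≤x c with c Fin.<? y
  ... | no _    = z≤n
  ... | yes c<y rewrite below-< {a = x} {c} (ℕ.<-trans c<y y<x) = s≤s z≤n
  0∨1 : ∀ c → below x c ∸ below y c ≡ 0 ⊎ below x c ∸ below y c ≡ 1
  0∨1 c with c Fin.<? x | c Fin.<? y
  ... | no _ | no _ = inj₁ refl
  ... | no _ | yes _ = inj₁ refl
  ... | yes _ | no _ = inj₂ refl
  ... | yes _ | yes _ = inj₁ refl

winding : ∀ {n} {x y : Fin (suc n)} → ¬ (y Fin.< x) → Segment x y 1
winding {x = x} {y} y≮x = record
  { on     = λ c → below x c + 1 ∸ below y c
  ; on≡    = λ c → ℕ.m∸n+n≡m (y≤x+1 c)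
  ; on-y   = cong₂ (λ a b → a + 1 ∸ b) (below-≮ y≮x) (below-≮ {a = y} {y} (ℕ.<-irrefl refl))
  ; on-0∨1 = 0∨1
  }
  where
  y≤x+1 : ∀ c → below y c ≤ below x c + 1
  y≤x+1 c with c Fin.<? y
  ... | no _  = z≤n
  ... | yes _ = ℕ.m≤n+m 1 (below x c)
  0∨1 : ∀ c → below x c + 1 ∸ below y c ≡ 0 ⊎ below x c + 1 ∸ below y c ≡ 1
  0∨1 c with c Fin.<? x | c Fin.<? y
  ... | no  _   | no  _   = inj₂ refl
  ... | no  _   | yes _   = inj₁ refl
  ... | yes _   | yes _   = inj₂ refl
  ... | yes c<x | no  c≮y = contradiction (ℕ.<-≤-trans c<x (ℕ.≮⇒≥ y≮x)) c≮y

Descending : ∀ {n} → List (Fin n) → Set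
Descending = AllPairs (flip Fin._≤_)

count-≢ : ∀ {n} {c : Fin n} {xs} → All (c ≢_) xs → count c xs ≡ 0
count-≢ []           = refl
count-≢ (c≢x ∷ c∉xs) = cong₂ _+_ (δ-≢ c≢x) (count-≢ c∉xs)

takeHigher-< : ∀ {n} {x u : Fin n} us → u Fin.< x → takeHigher x (u ∷ us) ≡ just (u , us)
takeHigher-< {x = x} {u} us u<x rewrite dec-true (u Fin.<? x) u<x = refl

takeHigher-≮ : ∀ {n} {x u : Fin n} us → ¬ (u Fin.< x) →
               takeHigher x (u ∷ us) ≡ Maybe.map (λ (z , zs) → z , u ∷ zs) (takeHigher x us)
takeHigher-≮ {x = x} {u} us u≮x rewrite dec-false (u Fin.<? x) u≮x = refl

takeHigher-just : ∀ {n} (x : Fin n) us {y us′} → Descending us → takeHigher x us ≡ just (y , us′) →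
  y Fin.< x × Descending us′ × (∀ {Q : Fin n → Set} → All Q us → All Q us′)
  × (∀ c → count c us ≡ δ c y + count c us′) × (∀ c → y Fin.< c → c Fin.< x → count c us ≡ 0)
takeHigher-just x (u ∷ us) (u≥us ∷ us↘) eq with u Fin.<? x
... | yes u<x with refl ← trans (sym (takeHigher-< us u<x)) eq =
  u<x , us↘ , All.tail , (λ c → refl) ,
  λ c u<c c<x → count-≢ ((Fin.<⇒≢ u<c ∘ sym) ∷ All.map (λ v≤u c≡v → ℕ.<⇒≱ u<c (subst (Fin._≤ u) (sym c≡v) v≤u)) u≥us)
... | no u≮x with takeHigher x us in eq′ | trans (sym (takeHigher-≮ us u≮x)) eq
... | just (y , us′) | refl
  with y<x , us′↘ , sub , counts , none ← takeHigher-just x us us↘ eq′ =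
  y<x , sub u≥us ∷ us′↘ , (λ { (q ∷ qs) → q ∷ sub qs })
  , (λ c → trans (cong (δ c u +_) (counts c)) (lemma (δ c u) (δ c y) (count c us′)))
  , λ c y<c c<x → cong₂ _+_ (δ-≢ λ c≡u → u≮x (subst (Fin._< x) c≡u c<x)) (none c y<c c<x)
  where
  lemma : ∀ a b c → a + (b + c) ≡ b + (a + c)
  lemma = solve-∀

takeHigher-nothing : ∀ {n} (x : Fin n) us → takeHigher x us ≡ nothing → All (λ u → ¬ (u Fin.< x)) us
takeHigher-nothing x []       eq = []
takeHigher-nothing x (u ∷ us) eq with u Fin.<? x
... | yes u<x = contradiction (trans (sym (takeHigher-< us u<x)) eq) λ ()
... | no u≮x with takeHigher x us in eq′ | trans (sym (takeHigher-≮ us u≮x)) eq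
... | nothing | _ = u≮x ∷ takeHigher-nothing x us eq′

module _ {n} (Y : Fin (suc n) → ℕ) where

  -- The invariant of the greedy pairing, x counting the right dots treated so far. A segment passes
  -- a box only if no left dot is free there, so of the Y c left dots the smaller of Y c and T c are
  -- used: this is the truncated difference in `unpaired`.
  record State (x : Fin (suc n) → ℕ) (us : List (Fin (suc n))) : Set where
    field
      T        : Fin (suc n) → ℕ
      flow     : Flow x Y T
      tight    : Tight Y T
      unpaired : ∀ c → count c us ≡ Y c ∸ T c

  -- The new segment ends in a box with an unpaired left dot, so the new
  -- crossing numbers are tight there.

  addPair : ∀ {x₀ us us′ x y w} (s : State x₀ us) (seg : Segment x y w) →
            (∀ c → count c us ≡ δ c y + count c us′) →
            (∀ c → Segment.on seg c ≡ 1 → c ≢ y → count c us ≡ 0) →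
            Σ[ s′ ∈ State (λ c → x₀ c + δ c x) us′ ] State.T s′ lastLetter ≡ State.T s lastLetter + w
  addPair {x₀} {us} {us′} {x} {y} s seg split none = record
    { T        = T′
    ; flow     = λ c → flow′ c (c Fin.≟ y) (on-0∨1 c)
    ; tight    = y , T′y≤Yy
    ; unpaired = λ c → unpaired′ c (c Fin.≟ y) (on-0∨1 c)
    } , cong (T lastLetter +_) on-last
    where
    open State s
    open Segment seg
    open ≡-Reasoning
    T′ : Fin (suc n) → ℕ
    T′ c = T c + on c

    Ty<Yy : T y < Y y
    Ty<Yy = ℕ.m∸n≢0⇒n<m λ eq → contradiction
      (trans (cong (_+ count y us′) (sym (δ-refl y))) (trans (sym (split y)) (trans (unpaired y) eq))) λ ()

    T′y≤Yy : T′ y ≤ Y y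
    T′y≤Yy = subst (_≤ Y y) (trans (ℕ.+-comm 1 (T y)) (cong (T y +_) (sym on-y))) Ty<Yy

    lemma : ∀ a b c → a + b + c ≡ a + (b + c)
    lemma = solve-∀

    flow′ : ∀ c → Dec (c ≡ y) → on c ≡ 0 ⊎ on c ≡ 1 →
            T′ (closeLetter c) ≡ (T′ c ∸ Y c) + (x₀ c + δ c x)
    flow′ c (yes refl) _ = begin
      T (closeLetter c) + on (closeLetter c)          ≡⟨ cong₂ _+_ (flow c) on≡δ ⟩
      (T c ∸ Y c) + x₀ c + δ c x                      ≡⟨ cong (λ k → k + x₀ c + δ c x) (trans (ℕ.m≤n⇒m∸n≡0 (ℕ.<⇒≤ Ty<Yy)) (sym (ℕ.m≤n⇒m∸n≡0 T′y≤Yy))) ⟩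
      (T′ c ∸ Y c) + x₀ c + δ c x                     ≡⟨ ℕ.+-assoc (T′ c ∸ Y c) (x₀ c) (δ c x) ⟩
      (T′ c ∸ Y c) + (x₀ c + δ c x)                   ∎
      where
      on≡δ : on (closeLetter c) ≡ δ c x
      on≡δ = ℕ.+-cancelʳ-≡ 1 _ _ (begin
        on (closeLetter c) + 1        ≡⟨ cong (on (closeLetter c) +_) (δ-refl c) ⟨
        on (closeLetter c) + δ c c    ≡⟨ divergence c ⟩
        on c + δ c x                  ≡⟨ cong (_+ δ c x) on-y ⟩
        1 + δ c x                     ≡⟨ ℕ.+-comm 1 (δ c x) ⟩
        δ c x + 1                     ∎)
    flow′ c (no c≢y) on-c = begin
      T (closeLetter c) + on (closeLetter c)          ≡⟨ cong₂ _+_ (flow c) on-close ⟩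
      (T c ∸ Y c) + x₀ c + (on c + δ c x)             ≡⟨ lemma₂ (T c ∸ Y c) (x₀ c) (on c) (δ c x) ⟩
      (T c ∸ Y c) + on c + (x₀ c + δ c x)             ≡⟨ cong (_+ (x₀ c + δ c x)) (passes on-c) ⟩
      (T′ c ∸ Y c) + (x₀ c + δ c x)                   ∎
      where
      lemma₂ : ∀ a b c d → a + b + (c + d) ≡ a + c + (b + d)
      lemma₂ = solve-∀
      on-close : on (closeLetter c) ≡ on c + δ c x
      on-close = trans (sym (ℕ.+-identityʳ _)) (trans (cong (on (closeLetter c) +_) (sym (δ-≢ c≢y))) (divergence c))
      passes : on c ≡ 0 ⊎ on c ≡ 1 → (T c ∸ Y c) + on c ≡ (T c + on c) ∸ Y c
      passes (inj₁ on≡0) rewrite on≡0 = trans (ℕ.+-identityʳ _) (cong (_∸ Y c) (sym (ℕ.+-identityʳ (T c))))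
      -- The segment passes box c, so no dot is free there; hence Y c ≤ T c and the difference is
      -- not truncated.
      passes (inj₂ on≡1) = trans (ℕ.+-comm (T c ∸ Y c) (on c)) (trans (sym (ℕ.+-∸-assoc (on c) Y≤T)) (cong (_∸ Y c) (ℕ.+-comm (on c) (T c))))
        where
        Y≤T : Y c ≤ T c
        Y≤T = ℕ.m∸n≡0⇒m≤n (trans (sym (unpaired c)) (none c on≡1 c≢y))

    unpaired′ : ∀ c → Dec (c ≡ y) → on c ≡ 0 ⊎ on c ≡ 1 → count c us′ ≡ Y c ∸ (T c + on c)
    unpaired′ c (yes refl) _ = ℕ.suc-injective (begin
      suc (count c us′)         ≡⟨ cong (_+ count c us′) (δ-refl c) ⟨
      δ c c + count c us′       ≡⟨ split c ⟨
      count c us                ≡⟨ unpaired c ⟩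
      Y c ∸ T c                 ≡⟨ ℕ.+-∸-assoc 1 Ty<Yy ⟩
      suc (Y c ∸ suc (T c))     ≡⟨ cong (λ k → suc (Y c ∸ k)) (trans (ℕ.+-comm 1 (T c)) (cong (T c +_) (sym on-y))) ⟩
      suc (Y c ∸ (T c + on c))  ∎)
    unpaired′ c (no c≢y) on-c = begin
      count c us′               ≡⟨ cong (_+ count c us′) (δ-≢ c≢y) ⟨
      δ c y + count c us′       ≡⟨ split c ⟨
      count c us                ≡⟨ same on-c ⟩
      Y c ∸ (T c + on c)        ∎
      where
      same : on c ≡ 0 ⊎ on c ≡ 1 → count c us ≡ Y c ∸ (T c + on c)
      same (inj₁ on≡0) = trans (unpaired c) (cong (Y c ∸_) (trans (sym (ℕ.+-identityʳ (T c))) (cong (T c +_) (sym on≡0))))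
      same (inj₂ on≡1) = trans (none c on≡1 c≢y) (sym (ℕ.m≤n⇒m∸n≡0 (ℕ.≤-trans
        (ℕ.m∸n≡0⇒m≤n (trans (sym (unpaired c)) (none c on≡1 c≢y))) (ℕ.m≤m+n (T c) (on c)))))

  record Result (x₀ : Fin (suc n) → ℕ) (xs us : List (Fin (suc n))) (t₀ : ℕ)
                (r : ℕ × List (Fin (suc n)) × List (Fin (suc n))) : Set where
    field
      state   : State (λ c → x₀ c + count c xs) (proj₂ (proj₂ r))
      winds   : State.T state lastLetter ≡ t₀ + proj₁ r
      paired  : ∀ c → count c (proj₁ (proj₂ r)) + count c (proj₂ (proj₂ r)) ≡ count c us
      length≡ : length (proj₁ (proj₂ r)) ≡ length xs

  mapState : ∀ {x x′ us} (s : State x us) → (∀ c → x c ≡ x′ c) → State x′ us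
  mapState s eq = record { T = T ; flow = λ c → trans (flow c) (cong (T c ∸ Y c +_) (eq c)) ; tight = tight ; unpaired = unpaired }
    where open State s

  length-split : ∀ {us us′ : List (Fin (suc n))} {y} → (∀ c → count c us ≡ δ c y + count c us′) → length us ≡ suc (length us′)
  length-split {us} {us′} {y} split = Perm.↭-length (counts⇒↭ us (y ∷ us′) split)

  pairDots-result : ∀ {x₀} xs us → Descending us → length xs ≤ length us → (s : State x₀ us) →
                    Result x₀ xs us (State.T s lastLetter) (pairDots xs us)
  extend : ∀ {x₀ x xs us us′ y w} (s : State x₀ us) (seg : Segment x y w) →
           Descending us′ → suc (length xs) ≤ length us →
           (split : ∀ c → count c us ≡ δ c y + count c us′) →
           (∀ c → Segment.on seg c ≡ 1 → c ≢ y → count c us ≡ 0) →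
           let w′ , ps , vs = pairDots xs us′ in
           Result x₀ (x ∷ xs) us (State.T s lastLetter) (w + w′ , y ∷ ps , vs)
  pairDots-result [] us us↘ len s = record
    { state   = mapState s (λ c → sym (ℕ.+-identityʳ _))
    ; winds   = sym (ℕ.+-identityʳ _)
    ; paired  = λ c → refl
    ; length≡ = refl
    }
  pairDots-result (x ∷ xs) us us↘ len s with takeHigher x us in eq
  pairDots-result (x ∷ xs) us us↘ len s | just (y , us′)
    with y<x , us′↘ , _ , split , none ← takeHigher-just x us us↘ eq =
    extend s (straight y<x) us′↘ len split between
    where
    between : ∀ c → below x c ∸ below y c ≡ 1 → c ≢ y → count c us ≡ 0
    between c on≡1 c≢y with c Fin.<? x | c Fin.<? y
    ... | yes c<x | no c≮y = none c (ℕ.≤∧≢⇒< (ℕ.≮⇒≥ c≮y) (c≢y ∘ sym ∘ Fin.toℕ-injective)) c<x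
    between c () c≢y | yes _ | yes _
    between c () c≢y | no  _ | yes _
    between c () c≢y | no  _ | no  _
  pairDots-result (x ∷ xs) (y ∷ us′) (y≥us ∷ us′↘) len s | nothing
    with y≮x ∷ us≮x ← takeHigher-nothing x (y ∷ us′) eq =
    -- The winding segment runs from x to the top and from the bottom up to y. No free dot is above
    -- x, and y is the lowest free dot, so every other box it enters has no free dot.
    extend s (winding y≮x) us′↘ len (λ c → refl) outside
    where
    outside : ∀ c → below x c + 1 ∸ below y c ≡ 1 → c ≢ y → count c (y ∷ us′) ≡ 0
    outside c on≡1 c≢y with c Fin.<? x | c Fin.<? y
    ... | yes c<x | yes _  = count-≢ (c≢y ∷ All.map (λ u≮x c≡u → u≮x (subst (Fin._< x) c≡u c<x)) us≮x)
    ... | yes c<x | no c≮y = contradiction (ℕ.<-≤-trans c<x (ℕ.≮⇒≥ y≮x)) c≮y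
    ... | no _    | no c≮y = count-≢ (c≢y ∷ All.map (λ u≤y c≡u → c≢y (Fin.≤-antisym (subst (Fin._≤ y) (sym c≡u) u≤y) (ℕ.≮⇒≥ c≮y))) y≥us)
    outside c () c≢y | no _ | yes _
  extend {x₀} {x} {xs} {us} {us′} {y} {w} s seg us′↘ len split none
    with s′ , T′ ← addPair s seg split none
    with pairDots xs us′ | pairDots-result xs us′ us′↘ (s≤s⁻¹ (subst (suc (length xs) ≤_) (length-split {us} {us′} split) len)) s′
  ... | w′ , ps , vs | res = record
    { state   = mapState state (λ c → ℕ.+-assoc (x₀ c) (δ c x) (count c xs))
    ; winds   = trans winds (trans (cong (_+ w′) T′) (ℕ.+-assoc (State.T s lastLetter) w w′))
    ; paired  = λ c → trans (ℕ.+-assoc (δ c y) _ _) (trans (cong (δ c y +_) (paired c)) (sym (split c)))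
    ; length≡ = cong suc length≡
    }
    where open Result res

descending : ∀ {n} (h : Row n) → Descending (reverse (letters h))
descending h = reverse↘ (ascending h)
  where
  reverse↘ : ∀ {xs} → AllPairs Fin._≤_ xs → Descending (reverse xs)
  reverse↘ [] = []
  reverse↘ {x ∷ xs} (x≤xs ∷ xs↗) = subst Descending (sym (List.unfold-reverse x xs))
    (AllPairs.++⁺ (reverse↘ xs↗) ([] ∷ [])
      (All.map (_∷ []) (Perm.All-resp-↭ (↭-sym (Perm.↭-reverse xs)) x≤xs)))

-- # b c ∸ T c left dots of box c remain unpaired, and the windings are the segments that
-- enter the lowest box from below.

record RMatrix {n} (a b : Row (suc n)) (r : ℕ × Row (suc n) × Row (suc n)) : Set where
  b′ = proj₁ (proj₂ r)
  a′ = proj₂ (proj₂ r)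
  field
    T        : Fin (suc n) → ℕ
    flow     : Flow (λ c → # c a) (λ c → # c b) T
    tight    : Tight (λ c → # c b) T
    winds    : T lastLetter ≡ proj₁ r
    left     : ∀ c → # c b′ ≡ # c a + (# c b ∸ T c)
    right    : ∀ c → # c a′ + (# c b ∸ T c) ≡ # c b
    size-a′  : size a′ ≡ size a
    size-b′  : size b′ ≡ size b

moveDots-RMatrix : ∀ {n} (a b : Row (suc n)) → size a ≤ size b → RMatrix a b (moveDots a b)
moveDots-RMatrix {n} a b a≤b = record
  { T       = T
  ; flow    = flow
  ; tight   = tight
  ; winds   = winds
  ; left    = λ c → trans (#-row c (letters a ++ vs)) (trans (count-++ c (letters a) vs) (cong (# c a +_) (unpaired c)))
  ; right   = right
  ; size-a′ = trans (size-row ps) length≡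
  ; size-b′ = (begin
      size (row (letters a ++ vs))       ≡⟨ size-row (letters a ++ vs) ⟩
      length (letters a ++ vs)           ≡⟨ List.length-++ (letters a) ⟩
      size a + length vs                 ≡⟨ cong (_+ length vs) length≡ ⟨
      length ps + length vs              ≡⟨ List.length-++ ps ⟨
      length (ps ++ vs)                  ≡⟨ Perm.↭-length (counts⇒↭ (ps ++ vs) (reverse (letters b)) λ c → trans (count-++ c ps vs) (paired c)) ⟩
      length (reverse (letters b))       ≡⟨ List.length-reverse (letters b) ⟩
      size b                             ∎)
  }
  where
  open ≡-Reasoning
  Y : Fin (suc n) → ℕ
  Y c = # c b
  empty : State Y (λ _ → 0) (reverse (letters b))
  empty = record { T = λ _ → 0 ; flow = λ c → cong (_+ 0) (sym (ℕ.0∸n≡0 (Y c))) ; tight = zero , z≤n ; unpaired = λ c → count-reverse c (letters b) }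
  res = pairDots-result Y (letters a) (reverse (letters b)) (descending b) (subst (size a ≤_) (sym (List.length-reverse (letters b))) a≤b) empty
  open Result res
  open State state
  ps = proj₁ (proj₂ (pairDots (letters a) (reverse (letters b))))
  vs = proj₂ (proj₂ (pairDots (letters a) (reverse (letters b))))
  right : ∀ c → # c (row ps) + (# c b ∸ T c) ≡ # c b
  right c = trans (cong₂ _+_ (#-row c ps) (sym (unpaired c))) (trans (paired c) (count-reverse c (letters b)))

-- With the difference as a witness, matching on the equation lets `rewrite` evaluate the truncated
-- subtractions.
≤-or-> : ∀ m n → (∃[ k ] n ≡ m + k) ⊎ (∃[ k ] m ≡ n + suc k)
≤-or-> m n with ℕ.≤-<-connex m n
... | inj₁ m≤n = inj₁ (n ∸ m , sym (ℕ.m+[n∸m]≡n m≤n))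
... | inj₂ n<m with k , eq ← ℕ.m≤n⇒∃[o]m+o≡n n<m = inj₂ (k , trans (sym eq) (sym (ℕ.+-suc n k)))

m∸[m+n]≡0 : ∀ m n → m ∸ (m + n) ≡ 0
m∸[m+n]≡0 m n = ℕ.m≤n⇒m∸n≡0 (ℕ.m≤m+n m n)

m+n∸o≤[m∸o]+n : ∀ m n o → m + n ∸ o ≤ (m ∸ o) + n
m+n∸o≤[m∸o]+n m       n zero    = ℕ.≤-refl
m+n∸o≤[m∸o]+n zero    n (suc o) = ℕ.m∸n≤m n (suc o)
m+n∸o≤[m∸o]+n (suc m) n (suc o) = m+n∸o≤[m∸o]+n m n o

[m+n]∸[m+o]≡n∸o : ∀ m n o → (m + n) ∸ (m + o) ≡ n ∸ o
[m+n]∸[m+o]≡n∸o zero    n o = refl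
[m+n]∸[m+o]≡n∸o (suc m) n o = [m+n]∸[m+o]≡n∸o m n o

-- The letters o and c of a colour meet xₒ, x꜀ right dots and yₒ, y꜀ left dots;
-- t pairs enter box o from below, and q openings stand to the left.

module Local (q xₒ x꜀ yₒ y꜀ t : ℕ) where

  t′ = (t ∸ yₒ) + xₒ
  uₒ = yₒ ∸ t
  u꜀ = y꜀ ∸ t′

  xₒ≤t′ : xₒ ≤ t′
  xₒ≤t′ = ℕ.m≤n+m xₒ (t ∸ yₒ)

  ε-R : (((q ∸ (x꜀ + u꜀)) + (xₒ + uₒ)) ∸ (y꜀ ∸ u꜀)) + (yₒ ∸ uₒ) ≡ (((q ∸ x꜀) + xₒ) ∸ y꜀) + yₒ
  ε-R rewrite sym (ℕ.∸-+-assoc q x꜀ u꜀) with q ∸ x꜀ | ≤-or-> t yₒ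
  ... | s | inj₁ (k , refl) rewrite m∸[m+n]≡0 t k | ℕ.m+n∸m≡n t k | ℕ.m+n∸n≡m t k with ≤-or-> xₒ y꜀
  ...   | inj₁ (j , refl) rewrite ℕ.m+n∸m≡n xₒ j | ℕ.m+n∸n≡m xₒ j = begin
        ((s ∸ j) + (xₒ + k) ∸ xₒ) + t   ≡⟨ cong (λ z → z ∸ xₒ + t) (lemma (s ∸ j) xₒ k) ⟩
        (xₒ + ((s ∸ j) + k) ∸ xₒ) + t   ≡⟨ cong (_+ t) (ℕ.m+n∸m≡n xₒ _) ⟩
        (s ∸ j) + k + t                 ≡⟨ lemma′ (s ∸ j) k t ⟩
        (s ∸ j) + (t + k)               ≡⟨ cong (_+ (t + k)) ([m+n]∸[m+o]≡n∸o xₒ s j) ⟨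
        (xₒ + s ∸ (xₒ + j)) + (t + k)   ≡⟨ cong (λ z → z ∸ (xₒ + j) + (t + k)) (ℕ.+-comm xₒ s) ⟩
        (s + xₒ ∸ (xₒ + j)) + (t + k)   ∎
        where
        open ≡-Reasoning
        lemma : ∀ a b c → a + (b + c) ≡ b + (a + c)
        lemma = solve-∀
        lemma′ : ∀ a b c → a + b + c ≡ a + (c + b)
        lemma′ = solve-∀
  ...   | inj₂ (j , refl) rewrite m∸[m+n]≡0 y꜀ (suc j) = begin
        (s + (y꜀ + suc j + k) ∸ y꜀) + t   ≡⟨ cong (λ z → z ∸ y꜀ + t) (lemma s y꜀ (suc j) k) ⟩
        (y꜀ + (s + suc j + k) ∸ y꜀) + t   ≡⟨ cong (_+ t) (ℕ.m+n∸m≡n y꜀ _) ⟩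
        s + suc j + k + t                 ≡⟨ lemma′ (s + suc j) k t ⟩
        s + suc j + (t + k)               ≡⟨ cong (_+ (t + k)) (ℕ.m+n∸m≡n y꜀ _) ⟨
        (y꜀ + (s + suc j) ∸ y꜀) + (t + k) ≡⟨ cong (λ z → z ∸ y꜀ + (t + k)) (lemma″ s y꜀ (suc j)) ⟨
        (s + (y꜀ + suc j) ∸ y꜀) + (t + k) ∎
        where
        open ≡-Reasoning
        lemma : ∀ a b c d → a + (b + c + d) ≡ b + (a + c + d)
        lemma = solve-∀
        lemma′ : ∀ a b c → a + b + c ≡ a + (c + b)
        lemma′ = solve-∀
        lemma″ : ∀ a b c → a + (b + c) ≡ b + (a + c)
        lemma″ = solve-∀
  ε-R | s | inj₂ (k , refl) rewrite m∸[m+n]≡0 yₒ (suc k) | ℕ.m+n∸m≡n yₒ (suc k) | ℕ.+-identityʳ xₒ with ≤-or-> (suc k + xₒ) y꜀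
  ...   | inj₁ (j , refl) rewrite ℕ.m+n∸m≡n (k + xₒ) j | ℕ.m+n∸n≡m (suc k + xₒ) j = cong (_+ yₒ) (begin
        (s ∸ j) + xₒ ∸ (suc k + xₒ)       ≡⟨ cong₂ _∸_ (ℕ.+-comm (s ∸ j) xₒ) (ℕ.+-comm (suc k) xₒ) ⟩
        xₒ + (s ∸ j) ∸ (xₒ + suc k)       ≡⟨ [m+n]∸[m+o]≡n∸o xₒ (s ∸ j) (suc k) ⟩
        s ∸ j ∸ suc k                     ≡⟨ ℕ.∸-+-assoc s j (suc k) ⟩
        s ∸ (j + suc k)                   ≡⟨ cong (s ∸_) (ℕ.+-comm j (suc k)) ⟩
        s ∸ (suc k + j)                   ≡⟨ [m+n]∸[m+o]≡n∸o xₒ s (suc k + j) ⟨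
        xₒ + s ∸ (xₒ + (suc k + j))       ≡⟨ cong₂ _∸_ (ℕ.+-comm xₒ s) (lemma xₒ (suc k) j) ⟩
        s + xₒ ∸ (suc k + xₒ + j)         ∎)
        where
        open ≡-Reasoning
        lemma : ∀ a b c → a + (b + c) ≡ b + a + c
        lemma = solve-∀
  ...   | inj₂ (j , eq) rewrite trans (cong (y꜀ ∸_) eq) (m∸[m+n]≡0 y꜀ (suc j)) = refl

  -- Here f_i moves a left dot from box c to box o. If all segments entering o end there, a free dot
  -- of c becomes a free dot of o, so f_i acts on b′. Otherwise the new dot of o catches a segment
  -- that used to pass on to c; a paired dot has moved, so f_i acts on a′, and one segment fewer
  -- enters c.
  module RightActs (acts : (q ∸ x꜀) + xₒ < y꜀) where

    xₒ<y꜀ : xₒ < y꜀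
    xₒ<y꜀ = ℕ.≤-<-trans (ℕ.m≤n+m xₒ (q ∸ x꜀)) acts

    module _ (t≤yₒ : t ≤ yₒ) where

      t′≡xₒ : t′ ≡ xₒ
      t′≡xₒ = cong (_+ xₒ) (ℕ.m≤n⇒m∸n≡0 t≤yₒ)

      y′≤ : y꜀ ∸ u꜀ ≤ (q ∸ (x꜀ + u꜀)) + (xₒ + uₒ)
      y′≤ = ℕ.≤-trans (ℕ.≤-reflexive (trans (ℕ.m∸[m∸n]≡n (subst (_≤ y꜀) (sym t′≡xₒ) (ℕ.<⇒≤ xₒ<y꜀))) t′≡xₒ))
              (ℕ.≤-trans (ℕ.m≤m+n xₒ uₒ) (ℕ.m≤n+m (xₒ + uₒ) (q ∸ (x꜀ + u꜀))))

      q<x′ : q < x꜀ + u꜀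
      q<x′ = begin-strict
        q                      ≤⟨ ℕ.m≤n+m∸n q x꜀ ⟩
        x꜀ + (q ∸ x꜀)          <⟨ ℕ.+-monoʳ-< x꜀ (ℕ.m+n≤o⇒m≤o∸n (suc (q ∸ x꜀)) acts) ⟩
        x꜀ + (y꜀ ∸ xₒ)         ≡⟨ cong (λ z → x꜀ + (y꜀ ∸ z)) t′≡xₒ ⟨
        x꜀ + u꜀                ∎
        where open ℕ.≤-Reasoning

    module _ (yₒ<t : yₒ < t) where

      uₒ≡0 : uₒ ≡ 0
      uₒ≡0 = ℕ.m≤n⇒m∸n≡0 (ℕ.<⇒≤ yₒ<t)

      xₒ<t′ : xₒ < t′
      xₒ<t′ = ℕ.+-monoˡ-≤ xₒ (ℕ.m<n⇒0<n∸m yₒ<t)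

      ε<y′ : (q ∸ (x꜀ + u꜀)) + (xₒ + uₒ) < y꜀ ∸ u꜀
      ε<y′ rewrite uₒ≡0 | ℕ.+-identityʳ xₒ | sym (ℕ.∸-+-assoc q x꜀ u꜀) with ≤-or-> t′ y꜀ | ≤-or-> u꜀ (q ∸ x꜀)
      ... | _              | inj₁ (k , eq) =
        subst (λ z → z + xₒ < y꜀ ∸ u꜀) (sym (trans (cong (_∸ u꜀) eq) (ℕ.m+n∸m≡n u꜀ k)))
          (ℕ.m+n≤o⇒m≤o∸n (suc k + xₒ) (subst (_≤ y꜀) (lemma u꜀ k xₒ) (subst (λ z → suc (z + xₒ) ≤ y꜀) eq acts)))
        where
        lemma : ∀ a b c → suc (a + b + c) ≡ suc b + c + a
        lemma = solve-∀
      ... | inj₁ (j , eq)  | inj₂ (k , eq′) rewrite trans (cong ((q ∸ x꜀) ∸_) eq′) (m∸[m+n]≡0 (q ∸ x꜀) (suc k)) =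
        ℕ.<-≤-trans xₒ<t′ (ℕ.≤-reflexive (sym (ℕ.m∸[m∸n]≡n (subst (t′ ≤_) (sym eq) (ℕ.m≤m+n t′ j)))))
      ... | inj₂ (j , eq)  | inj₂ (k , eq′) = contradiction (trans (sym (trans (cong (y꜀ ∸_) eq) (m∸[m+n]≡0 y꜀ (suc j)))) eq′) λ p → ℕ.<⇒≢ (ℕ.≤-trans (s≤s z≤n) (ℕ.m≤n+m (suc k) (q ∸ x꜀))) p

  -- Here f_i moves a right dot from box c to box o. All left dots of c are already taken by
  -- segments starting in o, so the pairing uses the same left dots with one more segment entering
  -- c, and f_i acts on b′.
  module LeftActs (stays : y꜀ ≤ (q ∸ x꜀) + xₒ) (acts : q < x꜀) where

    y꜀≤xₒ : y꜀ ≤ xₒ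
    y꜀≤xₒ = subst (λ z → y꜀ ≤ z + xₒ) (ℕ.m≤n⇒m∸n≡0 (ℕ.<⇒≤ acts)) stays

    y꜀≤t′ : y꜀ ≤ t′
    y꜀≤t′ = ℕ.≤-trans y꜀≤xₒ xₒ≤t′

    u꜀≡0 : u꜀ ≡ 0
    u꜀≡0 = ℕ.m≤n⇒m∸n≡0 y꜀≤t′

    y′≤ : y꜀ ∸ u꜀ ≤ (q ∸ (x꜀ + u꜀)) + (xₒ + uₒ)
    y′≤ = ℕ.≤-trans (ℕ.m∸n≤m y꜀ u꜀) (ℕ.≤-trans y꜀≤xₒ (ℕ.≤-trans (ℕ.m≤m+n xₒ uₒ) (ℕ.m≤n+m (xₒ + uₒ) (q ∸ (x꜀ + u꜀)))))

    q<x′ : q < x꜀ + u꜀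
    q<x′ = ℕ.≤-trans acts (ℕ.m≤m+n x꜀ u꜀)

  module NeitherActs (stays : y꜀ ≤ (q ∸ x꜀) + xₒ) (stays′ : x꜀ ≤ q) where

    x′≤q : x꜀ + u꜀ ≤ q
    x′≤q = begin
      x꜀ + (y꜀ ∸ t′)   ≤⟨ ℕ.+-monoʳ-≤ x꜀ (ℕ.∸-monoʳ-≤ y꜀ xₒ≤t′) ⟩
      x꜀ + (y꜀ ∸ xₒ)   ≤⟨ ℕ.+-monoʳ-≤ x꜀ (ℕ.m≤n+o⇒m∸n≤o y꜀ xₒ (subst (y꜀ ≤_) (ℕ.+-comm _ xₒ) stays)) ⟩
      x꜀ + (q ∸ x꜀)    ≡⟨ ℕ.m+[n∸m]≡n stays′ ⟩
      q                ∎
      where open ℕ.≤-Reasoning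

    y′≤ : y꜀ ∸ u꜀ ≤ (q ∸ (x꜀ + u꜀)) + (xₒ + uₒ)
    y′≤ = begin
      y꜀ ∸ u꜀                            ≤⟨ ℕ.∸-monoˡ-≤ u꜀ stays ⟩
      (q ∸ x꜀) + xₒ ∸ u꜀                 ≤⟨ m+n∸o≤[m∸o]+n (q ∸ x꜀) xₒ u꜀ ⟩
      (q ∸ x꜀ ∸ u꜀) + xₒ                 ≡⟨ cong (_+ xₒ) (ℕ.∸-+-assoc q x꜀ u꜀) ⟩
      (q ∸ (x꜀ + u꜀)) + xₒ               ≤⟨ ℕ.+-monoʳ-≤ _ (ℕ.m≤m+n xₒ uₒ) ⟩
      (q ∸ (x꜀ + u꜀)) + (xₒ + uₒ)        ∎
      where open ℕ.≤-Reasoning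

-- The action of f_i on a pair of rows and on its image under 𝓡

closeLetter-injective : ∀ {n} {c d : Fin (suc n)} → closeLetter c ≡ closeLetter d → c ≡ d
closeLetter-injective {c = zero}  {zero}  _  = refl
closeLetter-injective {c = zero}  {suc d} eq = contradiction eq Fin.fromℕ≢inject₁
closeLetter-injective {c = suc c} {zero}  eq = contradiction (sym eq) Fin.fromℕ≢inject₁
closeLetter-injective {c = suc c} {suc d} eq = cong suc (Fin.inject₁-injective eq)

module _ {m : ℕ} {i : Fin (2 + m)} where

  raises-open : {h h′ : Row (2 + m)} → Raises i h h′ → # (openLetter i) h′ ≡ suc (# (openLetter i) h)
  raises-open {h} {h′} r = begin
    # i h′                          ≡⟨ ℕ.+-identityʳ _ ⟨
    # i h′ + 0                      ≡⟨ cong (# i h′ +_) (δ-≢ (close≢open i ∘ sym)) ⟨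
    # i h′ + δ i (closeLetter i)    ≡⟨ Raises.at r i ⟨
    # i h + δ i i                   ≡⟨ cong (# i h +_) (δ-refl i) ⟩
    # i h + 1                       ≡⟨ ℕ.+-comm _ 1 ⟩
    suc (# i h)                     ∎
    where open ≡-Reasoning

  raises-close : {h h′ : Row (2 + m)} → Raises i h h′ → # (closeLetter i) h ≡ suc (# (closeLetter i) h′)
  raises-close {h} {h′} r = begin
    # c h                           ≡⟨ ℕ.+-identityʳ _ ⟨
    # c h + 0                       ≡⟨ cong (# c h +_) (δ-≢ (close≢open i)) ⟨
    # c h + δ c i                   ≡⟨ Raises.at r c ⟩
    # c h′ + δ c c                  ≡⟨ cong (# c h′ +_) (δ-refl c) ⟩
    # c h′ + 1                      ≡⟨ ℕ.+-comm _ 1 ⟩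
    suc (# c h′)                    ∎
    where
    open ≡-Reasoning
    c = closeLetter i

  raises-else : {h h′ : Row (2 + m)} → Raises i h h′ → ∀ c → c ≢ closeLetter i → c ≢ openLetter i → # c h′ ≡ # c h
  raises-else {h} {h′} r c c≢cl c≢op = begin
    # c h′                     ≡⟨ ℕ.+-identityʳ _ ⟨
    # c h′ + 0                 ≡⟨ cong (# c h′ +_) (δ-≢ c≢cl) ⟨
    # c h′ + δ c (closeLetter i) ≡⟨ Raises.at r c ⟨
    # c h + δ c i              ≡⟨ cong (# c h +_) (δ-≢ c≢op) ⟩
    # c h + 0                  ≡⟨ ℕ.+-identityʳ _ ⟩
    # c h                      ∎
    where open ≡-Reasoning

  size-raises : {h h′ : Row (2 + m)} → Raises i h h′ → size h′ ≡ size h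
  size-raises {h} {h′} r = ℕ.+-cancelʳ-≡ 1 _ _ (sym (begin
    size h + 1                                   ≡⟨ cong₂ _+_ (size≡sum h) (sym (sum-δ (openLetter i))) ⟩
    sum (λ c → # c h) + sum (λ c → δ c (openLetter i))   ≡⟨ ∑-distrib-+ (λ c → # c h) (λ c → δ c (openLetter i)) ⟨
    sum (λ c → # c h + δ c (openLetter i))       ≡⟨ sum-cong-≗ (Raises.at r) ⟩
    sum (λ c → # c h′ + δ c (closeLetter i))     ≡⟨ ∑-distrib-+ (λ c → # c h′) (λ c → δ c (closeLetter i)) ⟩
    sum (λ c → # c h′) + sum (λ c → δ c (closeLetter i)) ≡⟨ cong₂ _+_ (sym (size≡sum h′)) (sum-δ (closeLetter i)) ⟩
    size h′ + 1                                  ∎))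
    where open ≡-Reasoning

  raise : Row (2 + m) → Row (2 + m)
  raise h = rowOf (λ c → # c h + δ c (openLetter i) ∸ δ c (closeLetter i))

  raise-raises : ∀ {h} → 0 < # (closeLetter i) h → Raises i h (raise h)
  raise-raises {h} 0<cl = raises λ c → sym (trans (cong (_+ δ c (closeLetter i)) (#-rowOf _ c)) (ℕ.m∸n+n≡m (δ≤ c)))
    where
    δ≤ : ∀ c → δ c (closeLetter i) ≤ # c h + δ c (openLetter i)
    δ≤ c with c Fin.≟ closeLetter i
    ... | yes refl = ℕ.≤-trans 0<cl (ℕ.m≤m+n _ _)
    ... | no _     = z≤n

  -- Only the boxes of the two letters and the crossings between them change.

  update-RMatrix : ∀ {a b a′ b′ w a₂ b₂ a₂′ b₂′} (R : RMatrix a b (w , b′ , a′)) (v : ℕ) →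
    let open RMatrix R using (T) ; o = openLetter i ; c = closeLetter i in
    let Same = λ (h k : Row (2 + m)) → ∀ d → d ≢ c → d ≢ o → # d k ≡ # d h in
    Same a a₂ → Same b b₂ → Same a′ a₂′ → Same b′ b₂′ →
    v ≡ (T o ∸ # o b₂) + # o a₂ →
    T (closeLetter c) ≡ (v ∸ # c b₂) + # c a₂ →
    # o b₂′ ≡ # o a₂ + (# o b₂ ∸ T o) → # c b₂′ ≡ # c a₂ + (# c b₂ ∸ v) →
    # o a₂′ + (# o b₂ ∸ T o) ≡ # o b₂ → # c a₂′ + (# c b₂ ∸ v) ≡ # c b₂ →
    (T o ≤ # o b → T o ≤ # o b₂ ⊎ v ≤ # c b₂) → (T c ≤ # c b → T o ≤ # o b₂ ⊎ v ≤ # c b₂) →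
    size a₂′ ≡ size a₂ → size b₂′ ≡ size b₂ →
    Σ[ w₂ ∈ ℕ ] RMatrix a₂ b₂ (w₂ , b₂′ , a₂′) × (toℕ i ≡ 0 → w₂ ≡ v)
  update-RMatrix {a} {b} {a′} {b′} {w} {a₂} {b₂} {a₂′} {b₂′} R v sa sb sa′ sb′ fo fc lo lc ro rc tight-o tight-c za zb =
    T₂ lastLetter , record
    { T       = T₂
    ; flow    = flow₂
    ; tight   = tight₂ (proj₁ tight) (proj₂ tight)
    ; winds   = refl
    ; left    = left₂
    ; right   = right₂
    ; size-a′ = za
    ; size-b′ = zb
    } , λ i≡0 → subst (λ d → T₂ (closeLetter d) ≡ v) (Fin.toℕ-injective i≡0) T₂-c
    where
    open RMatrix R
    o = openLetter i
    c = closeLetter i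
    T₂ : Fin (2 + m) → ℕ
    T₂ d with d Fin.≟ c
    ... | yes _ = v
    ... | no _  = T d
    T₂-c : T₂ c ≡ v
    T₂-c with c Fin.≟ c
    ... | yes _  = refl
    ... | no c≢c = contradiction refl c≢c
    T₂-≢ : ∀ {d} → d ≢ c → T₂ d ≡ T d
    T₂-≢ {d} d≢c with d Fin.≟ c
    ... | yes eq = contradiction eq d≢c
    ... | no _   = refl
    T₂-o : T₂ o ≡ T o
    T₂-o = T₂-≢ (close≢open i ∘ sym)
    flow₂ : ∀ d → T₂ (closeLetter d) ≡ (T₂ d ∸ # d b₂) + # d a₂
    flow₂ d with d Fin.≟ o
    ... | yes refl = trans T₂-c (trans fo (cong (λ z → (z ∸ # o b₂) + # o a₂) (sym T₂-o)))
    ... | no d≢o with d Fin.≟ c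
    ... | yes refl = trans (T₂-≢ (d≢o ∘ closeLetter-injective)) fc
    ... | no d≢c   = trans (T₂-≢ (d≢o ∘ closeLetter-injective)) (trans (flow d)
                       (cong₂ (λ y x → (T d ∸ y) + x) (sym (sb d d≢c d≢o)) (sym (sa d d≢c d≢o))))
    left₂ : ∀ d → # d b₂′ ≡ # d a₂ + (# d b₂ ∸ T₂ d)
    left₂ d with d Fin.≟ c
    ... | yes refl = lc
    ... | no d≢c with d Fin.≟ o
    ... | yes refl = lo
    ... | no d≢o = trans (sb′ d d≢c d≢o) (trans (left d) (cong₂ (λ y x → x + (y ∸ T d)) (sym (sb d d≢c d≢o)) (sym (sa d d≢c d≢o))))
    right₂ : ∀ d → # d a₂′ + (# d b₂ ∸ T₂ d) ≡ # d b₂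
    right₂ d with d Fin.≟ c
    ... | yes refl = rc
    ... | no d≢c with d Fin.≟ o
    ... | yes refl = ro
    ... | no d≢o = trans (cong₂ (λ x y → x + (y ∸ T d)) (sa′ d d≢c d≢o) (sb d d≢c d≢o)) (trans (right d) (sym (sb d d≢c d≢o)))
    from : T o ≤ # o b₂ ⊎ v ≤ # c b₂ → Tight (λ d → # d b₂) T₂
    from (inj₁ p) = o , subst (_≤ # o b₂) (sym T₂-o) p
    from (inj₂ p) = c , subst (_≤ # c b₂) (sym T₂-c) p
    tight₂ : ∀ d → T d ≤ # d b → Tight (λ d → # d b₂) T₂
    tight₂ d p with d Fin.≟ o
    ... | yes refl = from (tight-o p)
    ... | no d≢o with d Fin.≟ c
    ... | yes refl = from (tight-c p)
    ... | no d≢c   = d , subst₂ _≤_ (sym (T₂-≢ d≢c)) (sym (sb d d≢c d≢o)) p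

  same : (h : Row (2 + m)) → ∀ d → d ≢ closeLetter i → d ≢ openLetter i → # d h ≡ # d h
  same _ _ _ _ = refl

[_≡_] : ℕ → ℕ → ℕ
[ zero  ≡ zero  ] = 1
[ zero  ≡ suc k ] = 0
[ suc j ≡ zero  ] = 0
[ suc j ≡ suc k ] = [ j ≡ k ]

module _ {m : ℕ} {i : Fin (2 + m)} {a b a′ b′ : Row (2 + m)} {w : ℕ} (R : RMatrix a b (w , b′ , a′)) where

  open RMatrix R hiding (a′; b′)
  private
    o = openLetter i
    c = closeLetter i
    xₒ = # o a
    x꜀ = # c a
    yₒ = # o b
    y꜀ = # c b
    t  = T o
    t′ = (t ∸ yₒ) + xₒ
    uₒ = yₒ ∸ t
    u꜀ = y꜀ ∸ t′
    T꜀ : T c ≡ t′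
    T꜀ = flow o
    Xₒ : # o b′ ≡ xₒ + uₒ
    Xₒ = left o
    X꜀ : # c b′ ≡ x꜀ + u꜀
    X꜀ = trans (left c) (cong (λ z → x꜀ + (y꜀ ∸ z)) T꜀)
    rightₒ : # o a′ + uₒ ≡ yₒ
    rightₒ = right o
    right꜀ : # c a′ + u꜀ ≡ y꜀
    right꜀ = trans (cong (λ z → # c a′ + (y꜀ ∸ z)) (sym T꜀)) (right c)
    Yₒ : # o a′ ≡ yₒ ∸ uₒ
    Yₒ = trans (sym (ℕ.m+n∸n≡m (# o a′) uₒ)) (cong (_∸ uₒ) rightₒ)
    Y꜀ : # c a′ ≡ y꜀ ∸ u꜀
    Y꜀ = trans (sym (ℕ.m+n∸n≡m (# c a′) u꜀)) (cong (_∸ u꜀) right꜀)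

  ε-RMatrix : ∀ {ℓ} {s u : Tensor (2 + m) ℓ} → ε i s ≡ ε i u → ε i (a′ ∷ b′ ∷ s) ≡ ε i (b ∷ a ∷ u)
  ε-RMatrix {u = u} eq rewrite X꜀ | Xₒ | Y꜀ | Yₒ | eq = Local.ε-R (ε i u) xₒ x꜀ yₒ y꜀ t

  private
    stays : ∀ {ℓ} (s : Tensor (2 + m) ℓ) → y꜀ ∸ u꜀ ≤ (ε i s ∸ (x꜀ + u꜀)) + (xₒ + uₒ) → # c a′ ≤ ε i (b′ ∷ s)
    stays s = subst₂ _≤_ (sym Y꜀) (sym (cong₂ (λ x z → (ε i s ∸ x) + z) X꜀ Xₒ))

    -- For colour 0 the closing letter is n, the lowest box, which is entered from below by the
    -- winding segments only.
    w≡Tc : toℕ i ≡ 0 → w ≡ T c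
    w≡Tc i≡0 = trans (sym winds) (cong (T ∘ closeLetter) (sym (Fin.toℕ-injective {i = i} {zero} i≡0)))

  -- Within the pair, (p , p′) can be (0 , 1), (0 , 0) or (1 , 1), and the winding number changes by
  -- 0, -1 or +1; the indicators encode this additively. The last component says that f_i acts
  -- inside the pair before 𝓡 exactly if it does so afterwards, which makes the equation reversible.
  step-RMatrix : ∀ {ℓ p} {s : Tensor (2 + m) ℓ} {b₂ a₂ s₂} → Step i p (b ∷ a ∷ s) (b₂ ∷ a₂ ∷ s₂) →
    Σ[ w₂ ∈ ℕ ] Σ[ b₂′ ∈ Row (2 + m) ] Σ[ a₂′ ∈ Row (2 + m) ] Σ[ p′ ∈ ℕ ]
      RMatrix a₂ b₂ (w₂ , b₂′ , a₂′) × Step i p′ (a′ ∷ b′ ∷ s) (a₂′ ∷ b₂′ ∷ s₂)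
      × (toℕ i ≡ 0 → w₂ + [ p′ ≡ 0 ] ≡ w + [ p ≡ 1 ]) × [ p ≡ 0 ] + [ p ≡ 1 ] ≡ [ p′ ≡ 0 ] + [ p′ ≡ 1 ]
  step-RMatrix {s = s} (here {h′ = b₂} acts r) with ℕ.≤-<-connex t yₒ
  ... | inj₁ t≤yₒ = rightLeft (update-RMatrix {a₂ = a} {b₂} {a′} {b₂′} R (T c)
      (same a) (raises-else r) (same a′) (raises-else rb′)
      (trans T꜀ (cong (_+ xₒ) (trans (ℕ.m≤n⇒m∸n≡0 t≤yₒ) (sym (ℕ.m≤n⇒m∸n≡0 t≤oₒ)))))
      (trans (flow c) (cong (_+ x꜀) (trans (ℕ.m≤n⇒m∸n≡0 (ℕ.≤-trans Tc≤k (ℕ.≤-trans (ℕ.n≤1+n k) (ℕ.≤-reflexive (sym y꜀≡)))))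
                                           (sym (ℕ.m≤n⇒m∸n≡0 Tc≤k)))))
      (trans (raises-open rb′) (trans (cong suc Xₒ) (trans (sym (ℕ.+-suc xₒ uₒ)) (cong (xₒ +_) (sym oₒ∸t)))))
      (ℕ.suc-injective (trans (sym (raises-close rb′)) (trans (left c) (trans (cong (x꜀ +_) y∸T) (ℕ.+-suc x꜀ _)))))
      (trans (cong (# o a′ +_) oₒ∸t) (trans (ℕ.+-suc (# o a′) uₒ) (trans (cong suc rightₒ) (sym oₒ≡))))
      (ℕ.suc-injective (trans (sym (ℕ.+-suc (# c a′) _)) (trans (cong (# c a′ +_) (sym y∸T)) (trans (right c) y꜀≡))))
      (λ _ → inj₁ t≤oₒ) (λ _ → inj₁ t≤oₒ)
      size-a′ (trans (size-raises rb′) (trans size-b′ (sym (size-raises r)))))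
    where
    open Local.RightActs (ε i s) xₒ x꜀ yₒ y꜀ t acts
    k = # c b₂
    b₂′ = raise {i = i} b′
    q<X꜀ : ε i s < # c b′
    q<X꜀ = subst (ε i s <_) (sym X꜀) (q<x′ t≤yₒ)
    rb′ : Raises i b′ b₂′
    rb′ = raise-raises (ℕ.≤-trans (s≤s z≤n) q<X꜀)
    oₒ≡ : # o b₂ ≡ suc yₒ
    oₒ≡ = raises-open r
    y꜀≡ : y꜀ ≡ suc k
    y꜀≡ = raises-close r
    t≤oₒ : t ≤ # o b₂
    t≤oₒ = subst (t ≤_) (sym oₒ≡) (ℕ.m≤n⇒m≤1+n t≤yₒ)
    oₒ∸t : # o b₂ ∸ t ≡ suc uₒ
    oₒ∸t = trans (cong (_∸ t) oₒ≡) (ℕ.+-∸-assoc 1 t≤yₒ)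
    Tc≤k : T c ≤ k
    Tc≤k = subst (_≤ k) (sym (trans T꜀ (t′≡xₒ t≤yₒ))) (s≤s⁻¹ (subst (xₒ <_) y꜀≡ xₒ<y꜀))
    y∸T : y꜀ ∸ T c ≡ suc (k ∸ T c)
    y∸T = trans (cong (_∸ T c) y꜀≡) (ℕ.+-∸-assoc 1 Tc≤k)
    rightLeft : Σ[ w₂ ∈ ℕ ] RMatrix a b₂ (w₂ , b₂′ , a′) × (toℕ i ≡ 0 → w₂ ≡ T c) →
      Σ[ w₂ ∈ ℕ ] Σ[ b₂′ ∈ Row (2 + m) ] Σ[ a₂′ ∈ Row (2 + m) ] Σ[ p′ ∈ ℕ ]
        RMatrix a b₂ (w₂ , b₂′ , a₂′) × Step i p′ (a′ ∷ b′ ∷ s) (a₂′ ∷ b₂′ ∷ s)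
        × (toℕ i ≡ 0 → w₂ + [ p′ ≡ 0 ] ≡ w + [ 0 ≡ 1 ]) × [ 0 ≡ 0 ] + [ 0 ≡ 1 ] ≡ [ p′ ≡ 0 ] + [ p′ ≡ 1 ]
    rightLeft (w₂ , R₂ , w₂≡) = w₂ , b₂′ , a′ , 1 , R₂ , there (stays s y′≤′) (here q<X꜀ rb′)
      , (λ i≡0 → cong (_+ 0) (trans (w₂≡ i≡0) (sym (w≡Tc i≡0)))) , refl
      where y′≤′ = y′≤ t≤yₒ
  ... | inj₂ yₒ<t = rightRight (update-RMatrix {a₂ = a} {b₂} {a₂′} {b′} R v
      (same a) (raises-else r) (raises-else ra′) (same b′)
      (cong (λ z → (t ∸ z) + xₒ) (sym oₒ≡))
      (trans (flow c) (cong (_+ x꜀) (cong₂ _∸_ Tc≡ y꜀≡)))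
      (trans Xₒ (cong (xₒ +_) (trans (uₒ≡0 yₒ<t) (sym oₒ∸t))))
      (trans (left c) (cong (x꜀ +_) (cong₂ _∸_ y꜀≡ Tc≡)))
      (trans (cong₂ _+_ (raises-open ra′) oₒ∸t) (trans (cong (λ z → suc (# o a′ + z)) (sym (uₒ≡0 yₒ<t))) (trans (cong suc rightₒ) (sym oₒ≡))))
      (ℕ.suc-injective (trans (cong₂ _+_ (sym (raises-close ra′)) (sym (cong₂ _∸_ y꜀≡ Tc≡))) (trans (right c) y꜀≡)))
      (λ t≤yₒ → contradiction t≤yₒ (ℕ.<⇒≱ yₒ<t)) (λ p → inj₂ (s≤s⁻¹ (subst₂ _≤_ Tc≡ y꜀≡ p)))
      (trans (size-raises ra′) size-a′) (trans size-b′ (sym (size-raises r))))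
    where
    open Local.RightActs (ε i s) xₒ x꜀ yₒ y꜀ t acts
    k = # c b₂
    v = (t ∸ suc yₒ) + xₒ
    a₂′ = raise {i = i} a′
    ε<Y꜀ : ε i (b′ ∷ s) < # c a′
    ε<Y꜀ = subst₂ _<_ (sym (cong₂ (λ x z → (ε i s ∸ x) + z) X꜀ Xₒ)) (sym Y꜀) (ε<y′ yₒ<t)
    ra′ : Raises i a′ a₂′
    ra′ = raise-raises (ℕ.≤-trans (s≤s z≤n) ε<Y꜀)
    oₒ≡ : # o b₂ ≡ suc yₒ
    oₒ≡ = raises-open r
    y꜀≡ : y꜀ ≡ suc k
    y꜀≡ = raises-close r
    Tc≡ : T c ≡ suc v
    Tc≡ = trans T꜀ (cong (_+ xₒ) (ℕ.+-∸-assoc 1 yₒ<t))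
    oₒ∸t : # o b₂ ∸ t ≡ 0
    oₒ∸t = ℕ.m≤n⇒m∸n≡0 (subst (_≤ t) (sym oₒ≡) yₒ<t)
    rightRight : Σ[ w₂ ∈ ℕ ] RMatrix a b₂ (w₂ , b′ , a₂′) × (toℕ i ≡ 0 → w₂ ≡ v) →
      Σ[ w₂ ∈ ℕ ] Σ[ b₂′ ∈ Row (2 + m) ] Σ[ a₂′ ∈ Row (2 + m) ] Σ[ p′ ∈ ℕ ]
        RMatrix a b₂ (w₂ , b₂′ , a₂′) × Step i p′ (a′ ∷ b′ ∷ s) (a₂′ ∷ b₂′ ∷ s)
        × (toℕ i ≡ 0 → w₂ + [ p′ ≡ 0 ] ≡ w + [ 0 ≡ 1 ]) × [ 0 ≡ 0 ] + [ 0 ≡ 1 ] ≡ [ p′ ≡ 0 ] + [ p′ ≡ 1 ]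
    rightRight (w₂ , R₂ , w₂≡) = w₂ , b′ , a₂′ , 0 , R₂ , here ε<Y꜀ ra′
      , (λ i≡0 → trans (ℕ.+-comm w₂ 1) (trans (cong suc (w₂≡ i≡0)) (trans (sym Tc≡) (trans (sym (w≡Tc i≡0)) (sym (ℕ.+-identityʳ w)))))) , refl
  step-RMatrix {s = s} (there y꜀≤ (here {h′ = a₂} acts r)) = leftLeft (update-RMatrix {a₂ = a₂} {b} {a′} {b₂′} R (suc t′)
      (raises-else r) (same b) (same a′) (raises-else rb′)
      (trans (sym (ℕ.+-suc (t ∸ yₒ) xₒ)) (cong ((t ∸ yₒ) +_) (sym (raises-open r))))
      (trans (flow c) (trans (cong₂ (λ z x → (z ∸ y꜀) + x) T꜀ x꜀≡) (trans (ℕ.+-suc (t′ ∸ y꜀) _) (cong (_+ # c a₂) (sym (ℕ.+-∸-assoc 1 y꜀≤t′))))))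
      (trans (raises-open rb′) (trans (cong suc Xₒ) (cong (_+ uₒ) (sym (raises-open r)))))
      (ℕ.suc-injective (trans (sym (raises-close rb′)) (trans X꜀ (cong₂ _+_ x꜀≡ (trans u꜀≡0 (sym y∸st′))))))
      rightₒ
      (trans (cong (# c a′ +_) (trans y∸st′ (sym u꜀≡0))) right꜀)
      inj₁ (λ p → inj₁ (ℕ.m∸n≡0⇒m≤n (ℕ.n≤0⇒n≡0 (ℕ.+-cancelʳ-≤ xₒ (t ∸ yₒ) 0 (ℕ.≤-trans (ℕ.≤-reflexive (sym T꜀)) (ℕ.≤-trans p y꜀≤xₒ))))))
      (trans size-a′ (sym (size-raises r))) (trans (size-raises rb′) size-b′))
    where
    open Local.LeftActs (ε i s) xₒ x꜀ yₒ y꜀ t y꜀≤ acts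
    b₂′ = raise {i = i} b′
    q<X꜀ : ε i s < # c b′
    q<X꜀ = subst (ε i s <_) (sym X꜀) q<x′
    rb′ : Raises i b′ b₂′
    rb′ = raise-raises (ℕ.≤-trans (s≤s z≤n) q<X꜀)
    x꜀≡ : x꜀ ≡ suc (# c a₂)
    x꜀≡ = raises-close r
    y∸st′ : y꜀ ∸ suc t′ ≡ 0
    y∸st′ = ℕ.m≤n⇒m∸n≡0 (ℕ.m≤n⇒m≤1+n y꜀≤t′)
    leftLeft : Σ[ w₂ ∈ ℕ ] RMatrix a₂ b (w₂ , b₂′ , a′) × (toℕ i ≡ 0 → w₂ ≡ suc t′) →
      Σ[ w₂ ∈ ℕ ] Σ[ b₂′ ∈ Row (2 + m) ] Σ[ a₂′ ∈ Row (2 + m) ] Σ[ p′ ∈ ℕ ]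
        RMatrix a₂ b (w₂ , b₂′ , a₂′) × Step i p′ (a′ ∷ b′ ∷ s) (a₂′ ∷ b₂′ ∷ s)
        × (toℕ i ≡ 0 → w₂ + [ p′ ≡ 0 ] ≡ w + [ 1 ≡ 1 ]) × [ 1 ≡ 0 ] + [ 1 ≡ 1 ] ≡ [ p′ ≡ 0 ] + [ p′ ≡ 1 ]
    leftLeft (w₂ , R₂ , w₂≡) = w₂ , b₂′ , a′ , 1 , R₂ , there (stays s y′≤) (here q<X꜀ rb′)
      , (λ i≡0 → trans (ℕ.+-identityʳ w₂) (trans (w₂≡ i≡0) (trans (cong suc (trans (sym T꜀) (sym (w≡Tc i≡0)))) (ℕ.+-comm 1 w)))) , refl
  step-RMatrix {s = s} (there y꜀≤ (there {p = p} x꜀≤ st)) =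
    w , b′ , a′ , suc (suc p) , R , there (stays s y′≤) (there (subst (_≤ ε i s) (sym X꜀) x′≤q) st) , (λ _ → refl) , refl
    where open Local.NeitherActs (ε i s) xₒ x꜀ yₒ y꜀ t y꜀≤ x꜀≤

  neither-RMatrix : ∀ {ℓ} {s : Tensor (2 + m) ℓ} → y꜀ ≤ ε i (a ∷ s) → x꜀ ≤ ε i s →
                    # c a′ ≤ ε i (b′ ∷ s) × # c b′ ≤ ε i s
  neither-RMatrix {s = s} y꜀≤ x꜀≤ = stays s y′≤ , subst (_≤ ε i s) (sym X꜀) x′≤q
    where open Local.NeitherActs (ε i s) xₒ x꜀ yₒ y꜀ t y꜀≤ x꜀≤

-- Uniqueness and inversion of the move

private variable
  n : ℕ

RMatrix-functional : ∀ {a b : Row (suc n)} {r r′} → RMatrix a b r → RMatrix a b r′ → r ≡ r′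
RMatrix-functional {a = a} {b} {w , x , y} {w′ , x′ , y′} R R′ =
  cong₂ _,_ (trans (sym R.winds) (trans (T≡ lastLetter) R′.winds)) (cong₂ _,_
    (row-ext λ c → trans (R.left c) (trans (cong (λ z → # c a + (# c b ∸ z)) (T≡ c)) (sym (R′.left c))))
    (row-ext λ c → ℕ.+-cancelʳ-≡ (# c b ∸ R.T c) _ _
      (trans (R.right c) (sym (trans (cong (λ z → # c y′ + (# c b ∸ z)) (T≡ c)) (R′.right c))))))
  where
  module R = RMatrix R
  module R′ = RMatrix R′
  T≡ : ∀ c → R.T c ≡ R′.T c
  T≡ = flow-unique R.flow R.tight R′.flow R′.tight

-- Read downwards, the crossing numbers are determined by the result of the move.

Flow⁻ : (X Y T : Fin (suc n) → ℕ) → Set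
Flow⁻ X Y T = ∀ c → T c ≡ (T (closeLetter c) ∸ X c) + Y c

Tight⁻ : (X T : Fin (suc n) → ℕ) → Set
Tight⁻ X T = ∃[ c ] T (closeLetter c) ≤ X c

flow⁻-≤ : {X Y T T′ : Fin (suc n) → ℕ} → Flow⁻ X Y T → Tight⁻ X T → Flow⁻ X Y T′ → ∀ c → T c ≤ T′ c
flow⁻-≤ {X = X} {Y} {T} {T′} fl (d , tight) fl′ = cyclic-induction⁻ propagate {d} base
  where
  open ℕ.≤-Reasoning
  base : T d ≤ T′ d
  base = begin
    T d                              ≡⟨ fl d ⟩
    (T (closeLetter d) ∸ X d) + Y d  ≡⟨ cong (_+ Y d) (ℕ.m≤n⇒m∸n≡0 tight) ⟩
    Y d                              ≤⟨ ℕ.m≤n+m (Y d) _ ⟩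
    (T′ (closeLetter d) ∸ X d) + Y d ≡⟨ fl′ d ⟨
    T′ d                             ∎
  propagate : ∀ c → T (closeLetter c) ≤ T′ (closeLetter c) → T c ≤ T′ c
  propagate c T≤T′ = subst₂ _≤_ (sym (fl c)) (sym (fl′ c)) (ℕ.+-monoˡ-≤ (Y c) (ℕ.∸-monoˡ-≤ (X c) T≤T′))

-- One box, with t segments entering from below, s leaving upwards, x and y dots before and X and Y
-- dots after the move. The X ∸ s surplus dots on the right are those that were moved; of the s
-- segments, s ∸ X come from below through the box, and Y more end in it.
module LocalInverse {t x y s X Y : ℕ} (s≡ : s ≡ (t ∸ y) + x) (X≡ : X ≡ x + (y ∸ t)) (Y≡ : Y + (y ∸ t) ≡ y) where

  X∸s : X ∸ s ≡ y ∸ t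
  X∸s rewrite s≡ | X≡ with ≤-or-> t y
  ... | inj₁ (k , refl) rewrite m∸[m+n]≡0 t k | ℕ.m+n∸m≡n t k = ℕ.m+n∸m≡n x k
  ... | inj₂ (k , refl) rewrite m∸[m+n]≡0 y (suc k) | ℕ.m+n∸m≡n y (suc k) | ℕ.+-identityʳ x = ℕ.m≤n⇒m∸n≡0 (ℕ.m≤n+m x (suc k))

  t≡ : t ≡ (s ∸ X) + Y
  t≡ rewrite s≡ | X≡ with ≤-or-> t y
  ... | inj₁ (k , refl) rewrite m∸[m+n]≡0 t k | ℕ.m+n∸m≡n t k | m∸[m+n]≡0 x k = sym (ℕ.+-cancelʳ-≡ k Y t Y≡)
  ... | inj₂ (k , refl) rewrite m∸[m+n]≡0 y (suc k) | ℕ.m+n∸m≡n y (suc k) | ℕ.+-identityʳ x | ℕ.m+n∸n≡m (suc k) x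
        = trans (ℕ.+-comm y (suc k)) (cong (suc k +_) (sym (trans (sym (ℕ.+-identityʳ Y)) Y≡)))

  tight : t ≤ y → s ≤ X
  tight t≤y rewrite s≡ | X≡ | ℕ.m≤n⇒m∸n≡0 t≤y = ℕ.m≤m+n x _

-- Undoes the move: the v dots of the right column at which no segment starts go back to the left.
module LocalForward {t s X Y : ℕ} (t≡ : t ≡ (s ∸ X) + Y) where

  v = X ∸ s
  x = X ∸ v
  y = Y + v

  y∸t : y ∸ t ≡ v
  y∸t rewrite t≡ with ≤-or-> s X
  ... | inj₁ (k , refl) rewrite m∸[m+n]≡0 s k = ℕ.m+n∸m≡n Y (s + k ∸ s)
  ... | inj₂ (k , refl) rewrite m∸[m+n]≡0 X (suc k) | ℕ.+-identityʳ Y = ℕ.m≤n⇒m∸n≡0 (ℕ.m≤n+m Y (X + suc k ∸ X))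

  left : X ≡ x + (y ∸ t)
  left = trans (sym (ℕ.m∸n+n≡m (ℕ.m∸n≤m X s))) (cong (x +_) (sym y∸t))

  right : Y + (y ∸ t) ≡ y
  right = cong (Y +_) y∸t

  flow : s ≡ (t ∸ y) + x
  flow rewrite t≡ with ≤-or-> s X
  ... | inj₁ (k , refl) rewrite m∸[m+n]≡0 s k | ℕ.m+n∸m≡n s k | m∸[m+n]≡0 Y k = sym (ℕ.m+n∸n≡m s k)
  ... | inj₂ (k , refl) rewrite m∸[m+n]≡0 X (suc k) | ℕ.m+n∸m≡n X (suc k) | ℕ.+-identityʳ Y | ℕ.m+n∸n≡m (suc k) Y = ℕ.+-comm X (suc k)

  tight : s ≤ X → t ≤ y
  tight s≤X rewrite t≡ | ℕ.m≤n⇒m∸n≡0 s≤X = ℕ.m≤m+n Y _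

RMatrix-injective : ∀ {a b a₂ b₂ x y : Row (suc n)} {w w₂} → RMatrix a b (w , x , y) → RMatrix a₂ b₂ (w₂ , x , y) →
                    w ≡ w₂ × a ≡ a₂ × b ≡ b₂
RMatrix-injective {a = a} {b} {a₂} {b₂} {x} {y} R R₂ =
  trans (sym R.winds) (trans (T≡ lastLetter) R₂.winds)
  , row-ext (λ c → ℕ.+-cancelʳ-≡ (# c b ∸ R.T c) _ _ (trans (sym (R.left c)) (trans (R₂.left c) (cong (# c a₂ +_) (sym (u≡ c))))))
  , row-ext (λ c → trans (sym (R.right c)) (trans (cong (# c y +_) (u≡ c)) (R₂.right c)))
  where
  module R = RMatrix R
  module R₂ = RMatrix R₂
  module L c = LocalInverse {Y = # c y} (R.flow c) (R.left c) (R.right c)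
  module L₂ c = LocalInverse {Y = # c y} (R₂.flow c) (R₂.left c) (R₂.right c)
  tight : Tight⁻ (λ c → # c x) R.T
  tight = proj₁ R.tight , L.tight _ (proj₂ R.tight)
  tight₂ : Tight⁻ (λ c → # c x) R₂.T
  tight₂ = proj₁ R₂.tight , L₂.tight _ (proj₂ R₂.tight)
  T≡ : ∀ c → R.T c ≡ R₂.T c
  T≡ c = ℕ.≤-antisym (flow⁻-≤ {Y = λ c → # c y} L.t≡ tight L₂.t≡ c) (flow⁻-≤ {Y = λ c → # c y} L₂.t≡ tight₂ L.t≡ c)
  u≡ : ∀ c → # c b ∸ R.T c ≡ # c b₂ ∸ R₂.T c
  u≡ c = trans (sym (L.X∸s c)) (trans (cong (# c x ∸_) (T≡ (closeLetter c))) (L₂.X∸s c))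

opposite-inject₁ : ∀ {n} (c : Fin n) → opposite (inject₁ c) ≡ suc (opposite c)
opposite-inject₁ zero    = refl
opposite-inject₁ (suc c) = cong inject₁ (opposite-inject₁ c)

opposite-fromℕ : ∀ n → opposite (fromℕ n) ≡ zero
opposite-fromℕ zero    = refl
opposite-fromℕ (suc n) = cong inject₁ (opposite-fromℕ n)

close-opposite-close : (c : Fin (suc n)) → closeLetter (opposite (closeLetter c)) ≡ opposite c
close-opposite-close {n} zero = cong closeLetter (opposite-fromℕ n)
close-opposite-close (suc c)  = cong closeLetter (opposite-inject₁ c)

count-opposite : (c : Fin n) (xs : List (Fin n)) → count c (List.map opposite xs) ≡ count (opposite c) xs
count-opposite c []       = refl
count-opposite c (x ∷ xs) = cong₂ _+_ (δ-opposite (c Fin.≟ opposite x)) (count-opposite c xs)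
  where
  δ-opposite : Dec (c ≡ opposite x) → δ c (opposite x) ≡ δ (opposite c) x
  δ-opposite (yes refl) = trans (δ-refl (opposite x)) (sym (trans (cong (λ z → δ z x) (Fin.opposite-involutive x)) (δ-refl x)))
  δ-opposite (no c≢)    = trans (δ-≢ c≢) (sym (δ-≢ {c = opposite c} {x} λ { refl → c≢ (sym (Fin.opposite-involutive c)) }))

abstract
  mirror : Row n → Row n
  mirror h = row (List.map opposite (letters h))

  #-mirror : ∀ c (h : Row n) → # c (mirror h) ≡ # (opposite c) h
  #-mirror c h = trans (#-row c (List.map opposite (letters h))) (count-opposite c (letters h))

  size-mirror : (h : Row n) → size (mirror h) ≡ size h
  size-mirror h = trans (size-row (List.map opposite (letters h))) (List.length-map opposite (letters h))

-- Turned upside down, the downward recursion for x and y is the upward one with the mirror image of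
-- y on the right and that of x on the left. So the pairing algorithm itself, run on mirror images,
-- supplies the downward flow.
flow-mirror : ∀ {x y : Row (suc n)} {r} → RMatrix (mirror y) (mirror x) r →
              Σ[ T ∈ (Fin (suc n) → ℕ) ] Flow⁻ (λ c → # c x) (λ c → # c y) T × Tight⁻ (λ c → # c x) T
flow-mirror {n} {x} {y} R = T , flow , opposite (proj₁ R.tight) , tight (proj₁ R.tight) (proj₂ R.tight)
  where
  module R = RMatrix R
  T : Fin (suc n) → ℕ
  -- The edge below c becomes the edge above `opposite c`, which `R.T` indexes by the box entered
  -- through it.
  T c = R.T (closeLetter (opposite c))
  T-close : ∀ c → T (closeLetter c) ≡ R.T (opposite c)
  T-close c = cong R.T (close-opposite-close c)
  flow : Flow⁻ (λ c → # c x) (λ c → # c y) T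
  flow c = trans (R.flow (opposite c)) (cong₂ _+_ (cong₂ _∸_ (sym (T-close c)) (twice x)) (twice y))
    where
    twice : ∀ h → # (opposite c) (mirror h) ≡ # c h
    twice h = trans (#-mirror (opposite c) h) (cong (λ d → # d h) (Fin.opposite-involutive c))
  tight : ∀ c → R.T c ≤ # c (mirror x) → T (closeLetter (opposite c)) ≤ # (opposite c) x
  tight c = subst₂ _≤_ (sym (trans (T-close (opposite c)) (cong R.T (Fin.opposite-involutive c)))) (#-mirror c x)

flow⁻-exists : (x y : Row (suc n)) → size y ≤ size x →
               Σ[ T ∈ (Fin (suc n) → ℕ) ] Flow⁻ (λ c → # c x) (λ c → # c y) T × Tight⁻ (λ c → # c x) T
flow⁻-exists x y y≤x =
  flow-mirror (moveDots-RMatrix (mirror y) (mirror x) (subst₂ _≤_ (sym (size-mirror y)) (sym (size-mirror x)) y≤x))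

sum-closeLetter : (T : Fin (suc n) → ℕ) → sum (T ∘ closeLetter) ≡ sum T
sum-closeLetter T = trans (ℕ.+-comm (T lastLetter) _) (sym (sum-init-last T))

RMatrix-surjective : (x y : Row (suc n)) → size y ≤ size x →
  Σ[ w ∈ ℕ ] Σ[ a ∈ Row (suc n) ] Σ[ b ∈ Row (suc n) ] RMatrix a b (w , x , y)
RMatrix-surjective {n} x y y≤x with T , flow⁻ , c₀ , tight⁻ ← flow⁻-exists x y y≤x =
  T lastLetter , a , b , record
    { T       = T
    ; flow    = λ c → trans (L.flow c) (sym (cong₂ (λ y x → (T c ∸ y) + x) (#b c) (#a c)))
    ; tight   = c₀ , subst (T c₀ ≤_) (sym (#b c₀)) (L.tight c₀ tight⁻)
    ; winds   = refl
    ; left    = λ c → trans (L.left c) (sym (cong₂ (λ x y → x + (y ∸ T c)) (#a c) (#b c)))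
    ; right   = λ c → trans (cong (λ z → # c y + (z ∸ T c)) (#b c)) (trans (L.right c) (sym (#b c)))
    ; size-a′ = size-y≡size-a
    ; size-b′ = ℕ.+-cancelˡ-≡ (size a) _ _ (trans (trans (ℕ.+-comm (size a) (size x)) (cong (size x +_) (sym size-y≡size-a))) (sym total))
    }
  where
  module L c = LocalForward {T c} {T (closeLetter c)} {# c x} {# c y} (flow⁻ c)
  a = rowOf L.x
  b = rowOf L.y
  #a : ∀ c → # c a ≡ L.x c
  #a = #-rowOf L.x
  #b : ∀ c → # c b ≡ L.y c
  #b = #-rowOf L.y
  open ≡-Reasoning
  conserved : ∀ c → # c a + # c b ≡ # c x + # c y
  conserved c = trans (cong₂ _+_ (#a c) (#b c)) (trans (lemma (L.x c) (# c y) (L.v c)) (cong (_+ # c y) (ℕ.m∸n+n≡m (ℕ.m∸n≤m (# c x) (T (closeLetter c))))))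
    where
    lemma : ∀ a b c → a + (b + c) ≡ a + c + b
    lemma = solve-∀
  size+ : ∀ h k → size h + size k ≡ sum (λ c → # c h + # c k)
  size+ h k = trans (cong₂ _+_ (size≡sum h) (size≡sum k)) (sym (∑-distrib-+ (λ c → # c h) (λ c → # c k)))
  total : size a + size b ≡ size x + size y
  total = trans (size+ a b) (trans (sum-cong-≗ conserved) (sym (size+ x y)))
  crossing : ∀ c → T (closeLetter c) + # c y ≡ T c + # c a
  crossing c = trans (conserve (T (closeLetter c)) (# c x) (# c y)) (cong₂ _+_ (sym (flow⁻ c)) (sym (#a c)))
    where
    conserve : ∀ s X Y → s + Y ≡ (s ∸ X) + Y + (X ∸ (X ∸ s))
    conserve s X Y with ≤-or-> s X
    ... | inj₁ (k , refl) rewrite m∸[m+n]≡0 s k | ℕ.m+n∸m≡n s k | ℕ.m+n∸n≡m s k = ℕ.+-comm s Y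
    ... | inj₂ (k , refl) rewrite m∸[m+n]≡0 X (suc k) | ℕ.m+n∸m≡n X (suc k) = lemma X (suc k) Y
      where
      lemma : ∀ a b c → a + b + c ≡ b + c + a
      lemma = solve-∀
  -- Segments leaving a box plus those ending in it equal those entering plus those starting in it.
  -- Summed over the cycle, both crossing sums agree and cancel.
  size-y≡size-a : size y ≡ size a
  size-y≡size-a = ℕ.+-cancelˡ-≡ (sum T) _ _ (begin
    sum T + size y                                    ≡⟨ cong₂ _+_ (sym (sum-closeLetter T)) (size≡sum y) ⟩
    sum (T ∘ closeLetter) + sum (λ c → # c y)         ≡⟨ ∑-distrib-+ (T ∘ closeLetter) (λ c → # c y) ⟨
    sum (λ c → T (closeLetter c) + # c y)             ≡⟨ sum-cong-≗ crossing ⟩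
    sum (λ c → T c + # c a)                           ≡⟨ ∑-distrib-+ T (λ c → # c a) ⟩
    sum T + sum (λ c → # c a)                         ≡⟨ cong (sum T +_) (size≡sum a) ⟨
    sum T + size a                                    ∎)

-- The search for a preimage

find-just : ∀ {A : Set} {P : A → Set} (P? : Decidable P) {x} xs → x ∈ xs → P x →
            ∃[ y ] List.find P? xs ≡ just y × P y × y ∈ xs
find-just P? (z ∷ xs) x∈ Px with P? z
... | yes Pz = z , refl , Pz , here refl
find-just P? (z ∷ xs) (here refl) Px | no ¬Pz = contradiction Px ¬Pz
find-just P? (z ∷ xs) (there x∈)  Px | no ¬Pz with y , eq , Py , y∈ ← find-just P? xs x∈ Px = y , eq , Py , there y∈

∈-words : (xs : List (Fin n)) → xs ∈ words n (length xs)
∈-words []       = here refl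
∈-words (x ∷ xs) = ∈-cartesianProductWith⁺ _∷_ (∈-allFin x) (∈-words xs)

words-length : ∀ m {xs : List (Fin n)} → xs ∈ words n m → length xs ≡ m
words-length zero    (here refl) = refl
words-length (suc m) xs∈ with _ , _ , _ , ys∈ , refl ← ∈-cartesianProductWith⁻ _∷_ (allFin _) (words _ m) xs∈ = cong suc (words-length m ys∈)

∈-rowsOfSize : (h : Row n) → h ∈ rowsOfSize n (size h)
∈-rowsOfSize h = subst (_∈ rowsOfSize _ (size h)) (row-ext (λ c → #-row c (letters h))) (∈-map⁺ row (∈-words (letters h)))

rowsOfSize-size : ∀ {m} {h : Row n} → h ∈ rowsOfSize n m → size h ≡ m
rowsOfSize-size {m = m} h∈ with xs , xs∈ , refl ← ∈-map⁻ row h∈ = trans (size-row xs) (words-length m xs∈)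

letters-injective : {h k : Row n} → letters h ≡ letters k → h ≡ k
letters-injective eq = row-ext λ c → cong (count c) eq

moveDots⁻¹-just : (a b : Row n) → ∀ {c d} → preimage a b ≡ just (c , d) → moveDots⁻¹ a b ≡ (proj₁ (moveDots c d) , c , d)
moveDots⁻¹-just a b eq with preimage a b | eq
... | _ | refl = refl

MovesTo : (a b c d : Row n) → Set
MovesTo a b c d = letters (proj₁ (proj₂ (moveDots c d))) ≡ letters a × letters (proj₂ (proj₂ (moveDots c d))) ≡ letters b

movesTo : {a b c d : Row n} → proj₂ (moveDots c d) ≡ (a , b) → MovesTo a b c d
movesTo eq = cong (letters ∘ proj₁) eq , cong (letters ∘ proj₂) eq

movesTo⁻ : {a b c d : Row n} → MovesTo a b c d → proj₂ (moveDots c d) ≡ (a , b)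
movesTo⁻ (a≡ , b≡) = cong₂ _,_ (letters-injective a≡) (letters-injective b≡)

-- One candidate guarantees that the search succeeds; the pair it returns is only known to have the
-- same image and sizes. The decision procedure is spelled out as in `preimage`, so that the result
-- speaks of that very search.
moveDots⁻¹-finds : {a b c d : Row n} → size c ≡ size b → size d ≡ size a → proj₂ (moveDots c d) ≡ (a , b) →
  Σ[ c′ ∈ Row n ] Σ[ d′ ∈ Row n ] moveDots⁻¹ a b ≡ (proj₁ (moveDots c′ d′) , c′ , d′)
    × proj₂ (moveDots c′ d′) ≡ (a , b) × size c′ ≡ size b × size d′ ≡ size a
moveDots⁻¹-finds {n} {a} {b} {c} {d} c≡b d≡a eq = fromFound (find-just {P = λ (c , d) → MovesTo a b c d}
  (λ (c , d) → let _ , a₁ , b₁ = moveDots c d in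
     List.≡-dec Fin._≟_ (letters a₁) (letters a) ×-dec List.≡-dec Fin._≟_ (letters b₁) (letters b))
  candidates
  (∈-cartesianProduct⁺ (subst (λ k → c ∈ rowsOfSize n k) c≡b (∈-rowsOfSize c)) (subst (λ k → d ∈ rowsOfSize n k) d≡a (∈-rowsOfSize d)))
  (movesTo {a = a} {b} {c} {d} eq))
  where
  candidates : List (Row n × Row n)
  candidates = List.cartesianProduct (rowsOfSize n (size b)) (rowsOfSize n (size a))
  fromFound : (∃[ r ] preimage a b ≡ just r × MovesTo a b (proj₁ r) (proj₂ r) × r ∈ candidates) →
    Σ[ c′ ∈ Row n ] Σ[ d′ ∈ Row n ] moveDots⁻¹ a b ≡ (proj₁ (moveDots c′ d′) , c′ , d′)
      × proj₂ (moveDots c′ d′) ≡ (a , b) × size c′ ≡ size b × size d′ ≡ size a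
  fromFound ((c′ , d′) , found , moves , r∈)
    with c∈ , d∈ ← ∈-cartesianProduct⁻ (rowsOfSize n (size b)) (rowsOfSize n (size a)) r∈
    = c′ , d′ , moveDots⁻¹-just a b found , movesTo⁻ {a = a} {b} {c′} {d′} moves , rowsOfSize-size c∈ , rowsOfSize-size d∈

moveDots⁻¹-RMatrix : (a b : Row (suc n)) → size b < size a → let w , c , d = moveDots⁻¹ a b in RMatrix c d (w , a , b)
moveDots⁻¹-RMatrix a b b<a = fromSurjective (RMatrix-surjective a b b≤a)
  where
  b≤a = ℕ.<⇒≤ b<a
  fromSurjective : Σ[ w ∈ ℕ ] Σ[ c ∈ Row _ ] Σ[ d ∈ Row _ ] RMatrix c d (w , a , b) →
                   let w , c , d = moveDots⁻¹ a b in RMatrix c d (w , a , b)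
  fromSurjective (w , c , d , R) = fromFinds (moveDots⁻¹-finds {a = a} {b} {c} {d} (sym (RMatrix.size-a′ R)) (sym (RMatrix.size-b′ R))
      (cong proj₂ (RMatrix-functional (moveDots-RMatrix c d (subst₂ _≤_ (RMatrix.size-a′ R) (RMatrix.size-b′ R) b≤a)) R)))
    where
    fromFinds : Σ[ c′ ∈ Row _ ] Σ[ d′ ∈ Row _ ] moveDots⁻¹ a b ≡ (proj₁ (moveDots c′ d′) , c′ , d′)
                  × proj₂ (moveDots c′ d′) ≡ (a , b) × size c′ ≡ size b × size d′ ≡ size a →
                let w , c , d = moveDots⁻¹ a b in RMatrix c d (w , a , b)
    fromFinds (c′ , d′ , moved , result , c′≡ , d′≡) =
      subst (λ (w , c , d) → RMatrix c d (w , a , b)) (sym moved)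
        (subst (λ r → RMatrix c′ d′ (proj₁ (moveDots c′ d′) , r)) result
          (moveDots-RMatrix c′ d′ (subst₂ _≤_ (sym c′≡) (sym d′≡) b≤a)))

-- The graph of `windingAndR`, free of pairing order and search; `backward` is the move read from
-- its result to its source.
data RSpec {n} (a b : Row (suc n)) : ℕ × Row (suc n) × Row (suc n) → Set where
  forward  : ∀ {w b′ a′} → size a ≤ size b → RMatrix a b (w , b′ , a′) → RSpec a b (w , b′ , a′)
  backward : ∀ {w b′ a′} → size b < size a → RMatrix b′ a′ (w , a , b) → RSpec a b (w , b′ , a′)

windingAndR-spec : (a b : Row (suc n)) → RSpec a b (windingAndR a b)
windingAndR-spec a b with size a ≤ᵇ size b in eq
... | true  = forward a≤b (moveDots-RMatrix a b a≤b)
  where a≤b = ℕ.≤ᵇ⇒≤ (size a) (size b) (subst Bool.T (sym eq) _)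
... | false = backward b<a (moveDots⁻¹-RMatrix a b b<a)
  where b<a = ℕ.≰⇒> λ a≤b → subst Bool.T eq (ℕ.≤⇒≤ᵇ a≤b)

RSpec-functional : ∀ {a b : Row (suc n)} {r r′} → RSpec a b r → RSpec a b r′ → r ≡ r′
RSpec-functional (forward _ R)    (forward _ R′)    = RMatrix-functional R R′
RSpec-functional (backward _ R)   (backward _ R′)   = let p , q , r = RMatrix-injective R R′ in cong₂ _,_ p (cong₂ _,_ q r)
RSpec-functional (forward a≤b _)  (backward b<a _)  = contradiction a≤b (ℕ.<⇒≱ b<a)
RSpec-functional (backward b<a _) (forward a≤b _)   = contradiction a≤b (ℕ.<⇒≱ b<a)

-- The energy along 0-arrows

raises-deterministic : ∀ {i : Fin n} {h h₁ h₂ : Row n} → Raises i h h₁ → Raises i h h₂ → h₁ ≡ h₂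
raises-deterministic {i = i} (raises r₁) (raises r₂) = row-ext λ c → ℕ.+-cancelʳ-≡ (δ c (closeLetter i)) _ _ (trans (sym (r₁ c)) (r₂ c))

raises-injective : ∀ {i : Fin n} {h h₁ h₂ : Row n} → Raises i h₁ h → Raises i h₂ h → h₁ ≡ h₂
raises-injective {i = i} (raises r₁) (raises r₂) = row-ext λ c → ℕ.+-cancelʳ-≡ (δ c (openLetter i)) _ _ (trans (r₁ c) (sym (r₂ c)))

step-deterministic : ∀ {ℓ p q} {i : Fin n} {t u v : Tensor n ℓ} → Step i p t u → Step i q t v → p ≡ q × u ≡ v
step-deterministic (here _ r)   (here _ r′)   = refl , cong (_∷ _) (raises-deterministic r r′)
step-deterministic (here ε< _)  (there cl≤ _) = contradiction cl≤ (ℕ.<⇒≱ ε<)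
step-deterministic (there cl≤ _) (here ε< _)  = contradiction cl≤ (ℕ.<⇒≱ ε<)
step-deterministic (there _ s)  (there _ s′)  = let p≡q , u≡v = step-deterministic s s′ in cong suc p≡q , cong (_ ∷_) u≡v

module _ {m : ℕ} where

  ε-step : ∀ {ℓ p} {i : Fin (2 + m)} {t t′ : Tensor (2 + m) ℓ} → Step i p t t′ → ε i t′ ≡ suc (ε i t)
  ε-step {i = i} (here {h = h} {h′} {t} ε< r) = begin
    (ε i t ∸ # (closeLetter i) h′) + # i h′       ≡⟨ cong (_+ # i h′) (ℕ.m≤n⇒m∸n≡0 (s≤s⁻¹ (subst (ε i t <_) (raises-close r) ε<))) ⟩
    # i h′                                        ≡⟨ raises-open r ⟩
    suc (# i h)                                   ≡⟨ cong (λ z → suc (z + # i h)) (ℕ.m≤n⇒m∸n≡0 (ℕ.<⇒≤ ε<)) ⟨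
    suc ((ε i t ∸ # (closeLetter i) h) + # i h)   ∎
    where open ≡-Reasoning
  ε-step {i = i} (there {h = h} cl≤ s) = cong (_+ # i h) (trans (cong (_∸ # (closeLetter i) h) (ε-step s)) (ℕ.+-∸-assoc 1 cl≤))

  step-injective : ∀ {ℓ p q} {i : Fin (2 + m)} {t u v : Tensor (2 + m) ℓ} → Step i p t v → Step i q u v → t ≡ u
  step-injective (here _ r)    (here _ r′)    = cong (_∷ _) (raises-injective r r′)
  step-injective (there _ s)   (there _ s′)   = cong (_ ∷_) (step-injective s s′)
  step-injective (here ε< r)   (there cl≤ s)  = contradiction (ℕ.≤-trans (ℕ.≤-reflexive (raises-close r)) (s≤s cl≤)) (ℕ.<⇒≱ (subst (_< _) (ε-step s) ε<))
  step-injective (there cl≤ s) (here ε< r)    = contradiction (ℕ.≤-trans (ℕ.≤-reflexive (raises-close r)) (s≤s cl≤)) (ℕ.<⇒≱ (subst (_< _) (ε-step s) ε<))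

  sizes-step : ∀ {ℓ p} {i : Fin (2 + m)} {h k h₂ k₂ : Row (2 + m)} {t t₂ : Tensor (2 + m) ℓ} →
               Step i p (h ∷ k ∷ t) (h₂ ∷ k₂ ∷ t₂) → size h₂ ≡ size h × size k₂ ≡ size k
  sizes-step s = Vec.∷-injectiveˡ (map-size-step s) , Vec.∷-injectiveˡ (Vec.∷-injectiveʳ (map-size-step s))

  pairTensor : ∀ {ℓ} → ℕ × Row (2 + m) × Row (2 + m) → Tensor (2 + m) ℓ → Tensor (2 + m) (2 + ℓ)
  pairTensor (_ , k , h) t = h ∷ k ∷ t

  PairStep : ∀ {ℓ} → Fin (2 + m) → ℕ → (k₂ h₂ : Row (2 + m)) (r : ℕ × Row (2 + m) × Row (2 + m)) (t t₂ : Tensor (2 + m) ℓ) → Set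
  PairStep i p k₂ h₂ r t t₂ = Σ[ r₂ ∈ ℕ × Row (2 + m) × Row (2 + m) ] Σ[ p′ ∈ ℕ ]
    RSpec k₂ h₂ r₂ × Step i p′ (pairTensor r t) (pairTensor r₂ t₂) × (toℕ i ≡ 0 → proj₁ r₂ + [ p′ ≡ 0 ] ≡ proj₁ r + [ p ≡ 1 ])

  -- In the `backward` case `step-RMatrix` applies to arrows on the preimage only. So it is decided
  -- first where f_i acts there; the arrow this induces on h and k is the given one, as f_i is a
  -- partial function.
  pair-step : ∀ {ℓ p} {i : Fin (2 + m)} {h k h₂ k₂ : Row (2 + m)} {t t₂ : Tensor (2 + m) ℓ} {r} → RSpec k h r →
    Step i p (h ∷ k ∷ t) (h₂ ∷ k₂ ∷ t₂) → PairStep i p k₂ h₂ r t t₂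
  pair-step (forward k≤h R) s with w₂ , b₂′ , a₂′ , p′ , R₂ , s′ , W≡ , _ ← step-RMatrix R s =
    (w₂ , b₂′ , a₂′) , p′ , forward (subst₂ _≤_ (sym (proj₂ (sizes-step s))) (sym (proj₁ (sizes-step s))) k≤h) R₂ , s′ , W≡
  pair-step {p = p} {i} {h} {k} {h₂} {k₂} {t} {t₂} (backward {w} {b′} {a′} h<k R) s = decide (ℕ.≤-<-connex (# (closeLetter i) a′) (ε i (b′ ∷ t)))
    where
    h₂<k₂ : size h₂ < size k₂
    h₂<k₂ = subst₂ _<_ (sym (proj₁ (sizes-step s))) (sym (proj₂ (sizes-step s))) h<k

    inPair : ∀ {p′ a₂′ b₂′} → Step i p′ (a′ ∷ b′ ∷ t) (a₂′ ∷ b₂′ ∷ t) → PairStep i p k₂ h₂ (w , b′ , a′) t t₂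
    inPair {p′} {a₂′} {b₂′} s′ with w₂ , k₃ , h₃ , p₃ , R₂ , s₃ , W≡ , pos ← step-RMatrix R s′
      with refl , refl ← step-deterministic s s₃ =
      (w₂ , b₂′ , a₂′) , p′ , backward h₂<k₂ R₂ , s′ , λ i≡0 → ℕ.+-cancelʳ-≡ ([ p ≡ 0 ] + [ p ≡ 1 ]) _ _ (begin
        w₂ + [ p′ ≡ 0 ] + ([ p ≡ 0 ] + [ p ≡ 1 ])   ≡⟨ lemma w₂ [ p′ ≡ 0 ] [ p ≡ 0 ] [ p ≡ 1 ] ⟩
        w₂ + [ p ≡ 0 ] + ([ p′ ≡ 0 ] + [ p ≡ 1 ])   ≡⟨ cong (_+ ([ p′ ≡ 0 ] + [ p ≡ 1 ])) (W≡ i≡0) ⟩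
        w + [ p′ ≡ 1 ] + ([ p′ ≡ 0 ] + [ p ≡ 1 ])   ≡⟨ lemma′ w [ p′ ≡ 1 ] [ p′ ≡ 0 ] [ p ≡ 1 ] ⟩
        w + [ p ≡ 1 ] + ([ p′ ≡ 0 ] + [ p′ ≡ 1 ])   ≡⟨ cong (w + [ p ≡ 1 ] +_) pos ⟩
        w + [ p ≡ 1 ] + ([ p ≡ 0 ] + [ p ≡ 1 ])     ∎)
      where
      open ≡-Reasoning
      lemma : ∀ a b c d → a + b + (c + d) ≡ a + c + (b + d)
      lemma = solve-∀
      lemma′ : ∀ a b c d → a + b + (c + d) ≡ a + d + (c + b)
      lemma′ = solve-∀

    beyond : # (closeLetter i) a′ ≤ ε i (b′ ∷ t) → # (closeLetter i) b′ ≤ ε i t →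
             Step i p (h ∷ k ∷ t) (h₂ ∷ k₂ ∷ t₂) → PairStep i p k₂ h₂ (w , b′ , a′) t t₂
    beyond a′≤ b′≤ (here acts _)               = contradiction (proj₁ (neither-RMatrix R {s = t} a′≤ b′≤)) (ℕ.<⇒≱ acts)
    beyond a′≤ b′≤ (there _ (here acts _))     = contradiction (proj₂ (neither-RMatrix R {s = t} a′≤ b′≤)) (ℕ.<⇒≱ acts)
    beyond a′≤ b′≤ (there _ (there {p = p} _ s)) = (w , b′ , a′) , suc (suc p) , backward h₂<k₂ R , there a′≤ (there b′≤ s) , λ _ → refl

    decide : # (closeLetter i) a′ ≤ ε i (b′ ∷ t) ⊎ ε i (b′ ∷ t) < # (closeLetter i) a′ → PairStep i p k₂ h₂ (w , b′ , a′) t t₂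
    decide (inj₂ acts) = inPair (here acts (raise-raises (ℕ.≤-trans (s≤s z≤n) acts)))
    decide (inj₁ a′≤) with ℕ.≤-<-connex (# (closeLetter i) b′) (ε i t)
    ... | inj₂ acts = inPair (there a′≤ (here acts (raise-raises (ℕ.≤-trans (s≤s z≤n) acts))))
    ... | inj₁ b′≤  = beyond a′≤ b′≤ s

  ε-RSpec : ∀ {ℓ} {i : Fin (2 + m)} {h k : Row (2 + m)} (t : Tensor (2 + m) ℓ) {r} → RSpec k h r → ε i (pairTensor r t) ≡ ε i (h ∷ k ∷ t)
  ε-RSpec t (forward _ R)  = ε-RMatrix R {s = t} {t} refl
  ε-RSpec t (backward _ R) = sym (ε-RMatrix R {s = t} {t} refl)

  ε-σ : ∀ {ℓ} {i : Fin (2 + m)} k (t : Tensor (2 + m) ℓ) → ε i (σ k t) ≡ ε i t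
  ε-σ zero    []          = refl
  ε-σ (suc _) []          = refl
  ε-σ zero    (h ∷ [])    = refl
  ε-σ zero    (h ∷ k ∷ t) = ε-RSpec t (windingAndR-spec k h)
  ε-σ {i = i} (suc k) (h ∷ t) = cong (λ z → (z ∸ # (closeLetter i) h) + # i h) (ε-σ k t)

  -- The bound on k concerns only the winding equation: for k = ℓ - 1, σ is the identity and the
  -- winding is 0 by default, so the equation fails for p = k.
  σ-step : ∀ {ℓ p} {i : Fin (2 + m)} k {t t′ : Tensor (2 + m) ℓ} → Step i p t t′ →
    Σ[ p′ ∈ ℕ ] Step i p′ (σ k t) (σ k t′) × (toℕ i ≡ 0 → suc k < ℓ → Wᵢ k t′ + [ p′ ≡ k ] ≡ Wᵢ k t + [ p ≡ suc k ])
  σ-step {i = i} zero {h ∷ []} {h′ ∷ []} s = _ , s , λ { _ (s≤s ()) }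
  σ-step {p = p} {i} zero {h ∷ k ∷ t} {h₂ ∷ k₂ ∷ t₂} s = identify (pair-step (windingAndR-spec k h) s)
    where
    identify : PairStep i p k₂ h₂ (windingAndR k h) t t₂ →
      Σ[ p′ ∈ ℕ ] Step i p′ (pairTensor (windingAndR k h) t) (pairTensor (windingAndR k₂ h₂) t₂)
        × (toℕ i ≡ 0 → 1 < _ → proj₁ (windingAndR k₂ h₂) + [ p′ ≡ 0 ] ≡ proj₁ (windingAndR k h) + [ p ≡ 1 ])
    identify (r₂ , p′ , spec , s′ , W≡) = p′ , subst (λ r → Step i p′ (pairTensor (windingAndR k h) t) (pairTensor r t₂)) r₂≡ s′
      , λ i≡0 _ → subst (λ r → proj₁ r + [ p′ ≡ 0 ] ≡ proj₁ (windingAndR k h) + [ p ≡ 1 ]) r₂≡ (W≡ i≡0)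
      where
      r₂≡ : r₂ ≡ windingAndR k₂ h₂
      r₂≡ = RSpec-functional spec (windingAndR-spec k₂ h₂)
  σ-step (suc k) (here {t = t} ε< r) = 0 , here (subst (_< _) (sym (ε-σ k t)) ε<) r , λ _ _ → refl
  σ-step (suc k) (there {t = t} cl≤ s) with p′ , s′ , W≡ ← σ-step k s =
    suc p′ , there (subst (_ ≤_) (sym (ε-σ k t)) cl≤) s′ , λ i≡0 k< → W≡ i≡0 (s≤s⁻¹ k<)

RSpec-sizes : ∀ {a b : Row (suc n)} {w b′ a′} → RSpec a b (w , b′ , a′) → size b′ ≡ size b × size a′ ≡ size a
RSpec-sizes (forward _ R)  = RMatrix.size-b′ R , RMatrix.size-a′ R
RSpec-sizes (backward _ R) = sym (RMatrix.size-a′ R) , sym (RMatrix.size-b′ R)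

sum≡0 : (x : Fin n → ℕ) → sum x ≡ 0 → ∀ c → x c ≡ 0
sum≡0 x eq zero    = ℕ.m+n≡0⇒m≡0 (x zero) eq
sum≡0 x eq (suc c) = sum≡0 (x ∘ suc) (ℕ.m+n≡0⇒n≡0 (x zero) eq) c

-- With equally many dots on both sides no left dot stays unpaired, so nothing moves and 𝓡 is the
-- identity.
RMatrix-sameSize : ∀ {a b : Row (suc n)} {w b′ a′} → size a ≡ size b → RMatrix a b (w , b′ , a′) → b′ ≡ a × a′ ≡ b
RMatrix-sameSize {a = a} {b} {b′ = b′} {a′} a≡b R =
  row-ext (λ c → trans (left c) (trans (cong (# c a +_) (u≡0 c)) (ℕ.+-identityʳ _)))
  , row-ext (λ c → trans (sym (ℕ.+-identityʳ _)) (trans (cong (# c a′ +_) (sym (u≡0 c))) (right c)))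
  where
  open RMatrix R hiding (b′; a′)
  open ≡-Reasoning
  u≡0 : ∀ c → # c b ∸ T c ≡ 0
  u≡0 = sum≡0 _ (ℕ.+-cancelˡ-≡ (size a) _ 0 (begin
    size a + sum (λ c → # c b ∸ T c)              ≡⟨ cong (_+ sum (λ c → # c b ∸ T c)) (size≡sum a) ⟩
    sum (λ c → # c a) + sum (λ c → # c b ∸ T c)   ≡⟨ ∑-distrib-+ (λ c → # c a) (λ c → # c b ∸ T c) ⟨
    sum (λ c → # c a + (# c b ∸ T c))             ≡⟨ sum-cong-≗ left ⟨
    sum (λ c → # c b′)                            ≡⟨ size≡sum b′ ⟨
    size b′                                       ≡⟨ size-b′ ⟩
    size b                                        ≡⟨ a≡b ⟨
    size a                                        ≡⟨ ℕ.+-identityʳ _ ⟨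
    size a + 0                                    ∎))

RSpec-involutive : ∀ {a b : Row (suc n)} {w b′ a′} → RSpec a b (w , b′ , a′) → ∃[ w′ ] RSpec b′ a′ (w′ , a , b)
RSpec-involutive {a = a} {b} {w} (forward a≤b R) with ℕ.m≤n⇒m<n∨m≡n a≤b
... | inj₁ a<b = w , backward (subst₂ _<_ (sym (RMatrix.size-a′ R)) (sym (RMatrix.size-b′ R)) a<b) R
... | inj₂ a≡b = w , subst₂ (λ x y → RSpec x y (w , a , b)) (sym b′≡a) (sym a′≡b)
    (forward a≤b (subst₂ (λ x y → RMatrix a b (w , x , y)) b′≡a a′≡b R))
  where
  b′≡a = proj₁ (RMatrix-sameSize a≡b R)
  a′≡b = proj₂ (RMatrix-sameSize a≡b R)
RSpec-involutive {w = w} (backward b<a R) = w , forward (ℕ.<⇒≤ (subst₂ _<_ (RMatrix.size-a′ R) (RMatrix.size-b′ R) b<a)) R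

swapAt : ∀ {ℓ} → ℕ → Vec ℕ ℓ → Vec ℕ ℓ
swapAt _       []          = []
swapAt zero    (x ∷ [])    = x ∷ []
swapAt zero    (x ∷ y ∷ μ) = y ∷ x ∷ μ
swapAt (suc k) (x ∷ μ)     = x ∷ swapAt k μ

module _ {m : ℕ} where

  σ-involutive : ∀ {ℓ} k (t : Tensor (2 + m) ℓ) → σ k (σ k t) ≡ t
  σ-involutive zero    []          = refl
  σ-involutive (suc _) []          = refl
  σ-involutive zero    (h ∷ [])    = refl
  σ-involutive zero    (h ∷ k ∷ t) = identify (RSpec-involutive (windingAndR-spec k h))
    where
    h′ = proj₂ (𝓡 k h)
    k′ = proj₁ (𝓡 k h)
    identify : ∃[ w′ ] RSpec k′ h′ (w′ , k , h) → pairTensor (windingAndR k′ h′) t ≡ h ∷ k ∷ t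
    identify (_ , spec) = cong (λ r → pairTensor r t) (RSpec-functional (windingAndR-spec k′ h′) spec)
  σ-involutive (suc k) (h ∷ t)     = cong (h ∷_) (σ-involutive k t)

  map-size-σ : ∀ {ℓ} k (t : Tensor (2 + m) ℓ) → Vec.map size (σ k t) ≡ swapAt k (Vec.map size t)
  map-size-σ zero    []          = refl
  map-size-σ (suc _) []          = refl
  map-size-σ zero    (h ∷ [])    = refl
  map-size-σ zero    (h ∷ k ∷ t) = let b≡ , a≡ = RSpec-sizes (windingAndR-spec k h) in cong₂ (λ x y → x ∷ y ∷ Vec.map size t) a≡ b≡
  map-size-σ (suc k) (h ∷ t)     = cong (size h ∷_) (map-size-σ k t)

  -- The factor of index i + d arrives at index i.

  moveDown : ∀ {ℓ} → ℕ → ℕ → Tensor (2 + m) ℓ → Tensor (2 + m) ℓ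
  moveDown i zero    t = t
  moveDown i (suc d) t = σ i (moveDown (suc i) d t)

  -- The share of one j in the energy, for j = i + d: the windings met while the factor of index j
  -- travels down to index i.
  windings : ∀ {ℓ} → ℕ → ℕ → Tensor (2 + m) ℓ → ℕ
  windings i zero    t = 0
  windings i (suc d) t = Wᵢ i (moveDown (suc i) d t) + windings (suc i) d t

  energy : ∀ {ℓ} → Tensor (2 + m) ℓ → ℕ
  energy {ℓ} t = ListAction.sum (applyUpTo (λ j → windings 0 j t) ℓ)

  foldr-σ : ∀ {ℓ} (t : Tensor (2 + m) ℓ) d i f → (∀ x → f x ≡ i + x) → List.foldr σ t (applyUpTo f d) ≡ moveDown i d t
  foldr-σ t zero    i f f≡ = refl
  foldr-σ t (suc d) i f f≡ = cong₂ σ (trans (f≡ 0) (ℕ.+-identityʳ i)) (foldr-σ t d (suc i) (f ∘ suc) λ x → trans (f≡ (suc x)) (ℕ.+-suc i x))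

  sum-windings : ∀ {ℓ} (t : Tensor (2 + m) ℓ) d i g → (∀ x → g x ≡ Wᵢ (i + x) (moveDown (suc (i + x)) (d ∸ suc x) t)) →
                 ListAction.sum (applyUpTo g d) ≡ windings i d t
  sum-windings t zero    i g g≡ = refl
  sum-windings t (suc d) i g g≡ = cong₂ _+_
    (trans (g≡ 0) (cong (λ k → Wᵢ k (moveDown (suc k) d t)) (ℕ.+-identityʳ i)))
    (sum-windings t d (suc i) (g ∘ suc) λ x → trans (g≡ (suc x)) (cong (λ k → Wᵢ k (moveDown (suc k) (d ∸ suc x) t)) (ℕ.+-suc i x)))

  sum-concatMap : ∀ (g : ℕ → List ℕ) xs → ListAction.sum (concatMap g xs) ≡ ListAction.sum (List.map (ListAction.sum ∘ g) xs)
  sum-concatMap g []       = refl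
  sum-concatMap g (x ∷ xs) = trans (ListAction.sum-++ (g x) (concatMap g xs)) (cong (ListAction.sum (g x) +_) (sum-concatMap g xs))

  D≡energy : ∀ {ℓ} {μ : Vec ℕ ℓ} (H : 𝓗 (2 + m) μ) → D H ≡ energy (factors H)
  D≡energy {ℓ} H = begin
    ListAction.sum (concatMap row-j (upTo ℓ))                       ≡⟨ sum-concatMap row-j (upTo ℓ) ⟩
    ListAction.sum (List.map (ListAction.sum ∘ row-j) (upTo ℓ))     ≡⟨ cong ListAction.sum (List.map-cong row-j≡ (upTo ℓ)) ⟩
    ListAction.sum (List.map (λ j → windings 0 j t) (upTo ℓ))       ≡⟨ cong ListAction.sum (List.map-applyUpTo (λ j → j) (λ j → windings 0 j t) ℓ) ⟩
    energy t                                                        ∎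
    where
    open ≡-Reasoning
    t = factors H
    row-j : ℕ → List ℕ
    row-j j = List.map (λ i → Wᵢ i (σ[ i , j ] t)) (upTo j)
    row-j≡ : ∀ j → ListAction.sum (row-j j) ≡ windings 0 j t
    row-j≡ j = trans (cong ListAction.sum (List.map-applyUpTo (λ i → i) (λ i → Wᵢ i (σ[ i , j ] t)) j))
      (sum-windings t j 0 _ λ i → cong (Wᵢ i) (foldr-σ t (j ∸ suc i) (suc i) (suc i +_) λ _ → refl))

  -- The contributions of `σ-step` telescope, since the position after one σ is the position before
  -- the next.
  windings-step : ∀ {ℓ p} {t t′ : Tensor (2 + m) ℓ} d i → i + d < ℓ → Step zero p t t′ →
    Σ[ p′ ∈ ℕ ] Step zero p′ (moveDown i d t) (moveDown i d t′) × windings i d t′ + [ p′ ≡ i ] ≡ windings i d t + [ p ≡ i + d ]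
  windings-step {p = p} zero i i<ℓ s = p , s , cong [ p ≡_] (sym (ℕ.+-identityʳ i))
  windings-step {ℓ} {p} {t} {t′} (suc d) i i+d<ℓ s
    with p″ , s″ , Q≡ ← windings-step d (suc i) (subst (_< ℓ) (ℕ.+-suc i d) i+d<ℓ) s
    with p′ , s′ , W≡ ← σ-step i s″ =
    p′ , s′ , (begin
      w₁ + Q′ + [ p′ ≡ i ]             ≡⟨ lemma w₁ Q′ [ p′ ≡ i ] ⟩
      w₁ + [ p′ ≡ i ] + Q′             ≡⟨ cong (_+ Q′) (W≡ refl (ℕ.≤-trans (s≤s (ℕ.m<m+n i (s≤s z≤n))) i+d<ℓ)) ⟩
      w₀ + [ p″ ≡ suc i ] + Q′          ≡⟨ lemma′ w₀ [ p″ ≡ suc i ] Q′ ⟩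
      w₀ + (Q′ + [ p″ ≡ suc i ])        ≡⟨ cong (w₀ +_) Q≡ ⟩
      w₀ + (Q + [ p ≡ suc i + d ])      ≡⟨ ℕ.+-assoc w₀ Q _ ⟨
      w₀ + Q + [ p ≡ suc (i + d) ]      ≡⟨ cong (λ k → w₀ + Q + [ p ≡ k ]) (ℕ.+-suc i d) ⟨
      w₀ + Q + [ p ≡ i + suc d ]        ∎)
    where
    open ≡-Reasoning
    w₁ = Wᵢ i (moveDown (suc i) d t′)
    w₀  = Wᵢ i (moveDown (suc i) d t)
    Q′ = windings (suc i) d t′
    Q  = windings (suc i) d t
    lemma : ∀ a b c → a + b + c ≡ a + c + b
    lemma = solve-∀
    lemma′ : ∀ a b c → a + b + c ≡ a + (c + b)
    lemma′ = solve-∀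

  HeadFree : ∀ {ℓ} → Tensor (2 + m) ℓ → Set
  HeadFree []      = ⊤
  HeadFree (h ∷ _) = # lastLetter h ≡ 0

  -- A condition on the source alone that forces r = 0: no factor contains n once it has been
  -- brought to the right end, so f_0 cannot act on it there.
  Safe : ∀ {ℓ} → Tensor (2 + m) ℓ → Set
  Safe {ℓ} t = ∀ j → j < ℓ → HeadFree (moveDown 0 j t)

  headFree-step : ∀ {ℓ p} {t t′ : Tensor (2 + m) ℓ} → HeadFree t → Step zero p t t′ → [ p ≡ 0 ] ≡ 0
  headFree-step free (here ε< _) = contradiction (subst (_ <_) free ε<) λ ()
  headFree-step free (there _ _) = refl

  step-position : ∀ {ℓ p} {i : Fin (2 + m)} {t t′ : Tensor (2 + m) ℓ} → Step i p t t′ → p < ℓ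
  step-position (here _ _)  = s≤s z≤n
  step-position (there _ s) = s≤s (step-position s)

  sum-applyUpTo-+ : ∀ d (a b c : ℕ → ℕ) → (∀ j → j < d → a j ≡ b j + c j) →
    ListAction.sum (applyUpTo a d) ≡ ListAction.sum (applyUpTo b d) + ListAction.sum (applyUpTo c d)
  sum-applyUpTo-+ zero    a b c eq = refl
  sum-applyUpTo-+ (suc d) a b c eq = trans (cong₂ _+_ (eq 0 (s≤s z≤n)) (sum-applyUpTo-+ d _ _ _ λ j j<d → eq (suc j) (s≤s j<d))) (lemma (b 0) (c 0) _ _)
    where
    lemma : ∀ a b c d → a + b + (c + d) ≡ a + c + (b + d)
    lemma = solve-∀

  sum-indicator : ∀ p d → p < d → ListAction.sum (applyUpTo [ p ≡_] d) ≡ 1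
  sum-indicator zero    (suc d) _   = cong suc (zeros d)
    where
    zeros : ∀ d → ListAction.sum (applyUpTo (λ _ → 0) d) ≡ 0
    zeros zero    = refl
    zeros (suc d) = zeros d
  sum-indicator (suc p) (suc d) p<d = sum-indicator p d (s≤s⁻¹ p<d)

  -- Without the terms at the right end, the share of j grows by 1 if j = p and by 0 otherwise.
  energy-step : ∀ {ℓ p} {t t′ : Tensor (2 + m) ℓ} → Safe t → Step zero p t t′ → energy t′ ≡ energy t + 1
  energy-step {ℓ} {p} {t} {t′} safe s = trans
    (sum-applyUpTo-+ ℓ (λ j → windings 0 j t′) (λ j → windings 0 j t) [ p ≡_] column)
    (cong (energy t +_) (sum-indicator p ℓ (step-position s)))
    where
    column : ∀ j → j < ℓ → windings 0 j t′ ≡ windings 0 j t + [ p ≡ j ]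
    column j j<ℓ with p′ , s′ , eq ← windings-step j 0 j<ℓ s =
      trans (sym (ℕ.+-identityʳ _)) (trans (cong (windings 0 j t′ +_) (sym (headFree-step (safe j j<ℓ) s′))) eq)

-- Arrows that relabel all letters of a kind

_↝[_]_ : ∀ {ℓ} → Tensor n ℓ → Fin n → Tensor n ℓ → Set
t ↝[ i ] t′ = ∃[ p ] Step i p t t′

_↝_ : ∀ {ℓ} → Tensor n ℓ → Tensor n ℓ → Set
t ↝ t′ = ∃[ i ] (toℕ i ≢ 0) × (t ↝[ i ] t′)

Absent : ∀ {ℓ} → Fin n → Tensor n ℓ → Set
Absent c = VecAll.All (λ h → # c h ≡ 0)

ε-absent : ∀ {ℓ} {i : Fin n} {t : Tensor n ℓ} → Absent i t → ε i t ≡ 0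
ε-absent [] = refl
ε-absent {i = i} {h ∷ t} (p ∷ ps) = cong₂ _+_ (trans (cong (_∸ # (closeLetter i) h) (ε-absent ps)) (ℕ.0∸n≡0 (# (closeLetter i) h))) p

-- ε grows with the openings and shrinks with the closings of each row. Two colours occur because
-- raising all letters by one also changes the colour.
ε-map-≤ : ∀ {i j : Fin n} (φ : Row n → Row n) → (∀ h → # j (φ h) ≤ # i h) →
          (∀ h → # (closeLetter i) h ≤ # (closeLetter j) (φ h)) →
          ∀ {ℓ} (t : Tensor n ℓ) → ε j (Vec.map φ t) ≤ ε i t
ε-map-≤ φ op≤ cl≤ []      = z≤n
ε-map-≤ φ op≤ cl≤ (h ∷ t) = ℕ.+-mono-≤ (ℕ.∸-mono (ε-map-≤ φ op≤ cl≤ t) (cl≤ h)) (op≤ h)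

abstract
  pure : Fin n → ℕ → Row n
  pure c K = row (List.replicate K c)

  #-pure-≡ : ∀ (c : Fin n) K → # c (pure c K) ≡ K
  #-pure-≡ c K = trans (#-row c (List.replicate K c)) (count-replicate-≡ c K)

  #-pure-≢ : ∀ {c d : Fin n} → d ≢ c → ∀ K → # d (pure c K) ≡ 0
  #-pure-≢ {c = c} {d} d≢c K = trans (#-row d (List.replicate K c)) (count-replicate-≢ d≢c K)

  size-pure : ∀ (c : Fin n) K → size (pure c K) ≡ K
  size-pure c K = trans (size-row (List.replicate K c)) (List.length-replicate K)

count-only : ∀ {c : Fin n} xs → (∀ d → d ≢ c → count d xs ≡ 0) → count c xs ≡ length xs
count-only []       only = refl
count-only {c = c} (x ∷ xs) only with x Fin.≟ c
... | yes refl = cong₂ _+_ (δ-refl x) (count-only xs λ d d≢c → ℕ.m+n≡0⇒n≡0 (δ d x) (only d d≢c))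
... | no x≢c   = contradiction (trans (sym (δ-refl x)) (ℕ.m+n≡0⇒m≡0 (δ x x) (only x x≢c))) λ ()

only⇒pure : ∀ (c : Fin n) {h} → (∀ d → d ≢ c → # d h ≡ 0) → h ≡ pure c (size h)
only⇒pure c {h} only = row-ext counts
  where
  counts : ∀ d → # d h ≡ # d (pure c (size h))
  counts d with d Fin.≟ c
  ... | yes refl = trans (count-only (letters h) only) (sym (#-pure-≡ c (size h)))
  ... | no d≢c   = trans (only d d≢c) (sym (#-pure-≢ d≢c (size h)))

count≤length : ∀ (c : Fin n) xs → count c xs ≤ length xs
count≤length c []       = z≤n
count≤length c (x ∷ xs) with c Fin.≟ x
... | yes _ = s≤s (count≤length c xs)
... | no _  = ℕ.m≤n⇒m≤1+n (count≤length c xs)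

empty-# : ∀ (c : Fin n) {h} → size h ≡ 0 → # c h ≡ 0
empty-# c {h} eq = ℕ.n≤0⇒n≡0 (subst (# c h ≤_) eq (count≤length c (letters h)))

module _ {m : ℕ} where

  relabelCount : Fin (2 + m) → Row (2 + m) → Fin (2 + m) → ℕ
  relabelCount i h d with d Fin.≟ openLetter i | d Fin.≟ closeLetter i
  ... | yes _ | _     = # (openLetter i) h + # (closeLetter i) h
  ... | no _  | yes _ = 0
  ... | no _  | no _  = # d h

  relabel : Fin (2 + m) → Row (2 + m) → Row (2 + m)
  relabel i h = rowOf (relabelCount i h)

  #-relabel-open : ∀ i h → # (openLetter i) (relabel i h) ≡ # (openLetter i) h + # (closeLetter i) h
  #-relabel-open i h = trans (#-rowOf (relabelCount i h) i) counted
    where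
    counted : relabelCount i h i ≡ # (openLetter i) h + # (closeLetter i) h
    counted with i Fin.≟ i
    ... | yes _ = refl
    ... | no i≢i = contradiction refl i≢i

  #-relabel-close : ∀ i h → # (closeLetter i) (relabel i h) ≡ 0
  #-relabel-close i h = trans (#-rowOf (relabelCount i h) (closeLetter i)) counted
    where
    counted : relabelCount i h (closeLetter i) ≡ 0
    counted with closeLetter i Fin.≟ i | closeLetter i Fin.≟ closeLetter i
    ... | yes eq | _      = contradiction eq (close≢open i)
    ... | no _   | yes _  = refl
    ... | no _   | no c≢c = contradiction refl c≢c

  #-relabel-else : ∀ i h {d} → d ≢ closeLetter i → d ≢ openLetter i → # d (relabel i h) ≡ # d h
  #-relabel-else i h {d} d≢cl d≢op = trans (#-rowOf (relabelCount i h) d) counted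
    where
    counted : relabelCount i h d ≡ # d h
    counted with d Fin.≟ i | d Fin.≟ closeLetter i
    ... | yes eq | _      = contradiction eq d≢op
    ... | no _   | yes eq = contradiction eq d≢cl
    ... | no _   | no _   = refl

  data Cases (i d : Fin (2 + m)) : Set where
    isOpen  : d ≡ openLetter i → Cases i d
    isClose : d ≡ closeLetter i → Cases i d
    isElse  : d ≢ closeLetter i → d ≢ openLetter i → Cases i d

  cases : ∀ i d → Cases i d
  cases i d with d Fin.≟ openLetter i | d Fin.≟ closeLetter i
  ... | yes eq  | _       = isOpen eq
  ... | no _    | yes eq  = isClose eq
  ... | no d≢op | no d≢cl = isElse d≢cl d≢op

  relabel-unique : ∀ i {h k} → # (openLetter i) k ≡ # (openLetter i) h + # (closeLetter i) h → # (closeLetter i) k ≡ 0 →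
                   (∀ d → d ≢ closeLetter i → d ≢ openLetter i → # d k ≡ # d h) → relabel i h ≡ k
  relabel-unique i {h} {k} op cl else = row-ext λ d → counts d (cases i d)
    where
    counts : ∀ d → Cases i d → # d (relabel i h) ≡ # d k
    counts d (isOpen refl)      = trans (#-relabel-open i h) (sym op)
    counts d (isClose refl)     = trans (#-relabel-close i h) (sym cl)
    counts d (isElse d≢cl d≢op) = trans (#-relabel-else i h d≢cl d≢op) (sym (else d d≢cl d≢op))

  relabel-trivial : ∀ i {h} → # (closeLetter i) h ≡ 0 → relabel i h ≡ h
  relabel-trivial i {h} cl≡0 = relabel-unique i (trans (sym (ℕ.+-identityʳ _)) (cong (# i h +_) (sym cl≡0))) cl≡0 (λ _ _ _ → refl)

  relabel-raises : ∀ i {h h′} → Raises i h h′ → relabel i h′ ≡ relabel i h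
  relabel-raises i {h} {h′} r = relabel-unique i
    (trans (#-relabel-open i h) (trans (cong (# i h +_) (raises-close r)) (trans (ℕ.+-suc (# i h) _) (cong (_+ # (closeLetter i) h′) (sym (raises-open r))))))
    (#-relabel-close i h)
    (λ d d≢cl d≢op → trans (#-relabel-else i h d≢cl d≢op) (sym (raises-else r d d≢cl d≢op)))

  relabel-pure : ∀ i K → relabel i (pure (closeLetter i) K) ≡ pure (openLetter i) K
  relabel-pure i K = relabel-unique i
    (trans (#-pure-≡ i K) (sym (cong₂ _+_ (#-pure-≢ (close≢open i ∘ sym) K) (#-pure-≡ (closeLetter i) K))))
    (#-pure-≢ (close≢open i) K)
    (λ d d≢cl d≢op → trans (#-pure-≢ d≢op K) (sym (#-pure-≢ d≢cl K)))

  -- With no opening left over in the tail, no closing letter of the head is ever cancelled, so f_i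
  -- acts on the head until none is left.
  relabel-head : ∀ {ℓ} i {t : Tensor (2 + m) ℓ} → ε i t ≡ 0 → ∀ h → Star _↝[ i ]_ (h ∷ t) (relabel i h ∷ t)
  relabel-head i {t} ε≡0 h = go (# (closeLetter i) h) h refl
    where
    go : ∀ k h → # (closeLetter i) h ≡ k → Star _↝[ i ]_ (h ∷ t) (relabel i h ∷ t)
    go zero    h eq = subst (λ h′ → Star _↝[ i ]_ (h ∷ t) (h′ ∷ t)) (sym (relabel-trivial i eq)) Star.ε
    go (suc k) h eq = (0 , here (subst₂ _<_ (sym ε≡0) (sym eq) (s≤s z≤n)) r)
      ◅ subst (λ h′ → Star _↝[ i ]_ (raise {i = i} h ∷ t) (h′ ∷ t)) (relabel-raises i r)
          (go k (raise {i = i} h) (ℕ.suc-injective (trans (sym (raises-close r)) eq)))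
      where
      r : Raises i h (raise h)
      r = raise-raises (subst (0 <_) (sym eq) (s≤s z≤n))

  ↝-there : ∀ {ℓ i h} {t t′ : Tensor (2 + m) ℓ} → # (closeLetter i) h ≡ 0 → t ↝[ i ] t′ → (h ∷ t) ↝[ i ] (h ∷ t′)
  ↝-there cl≡0 (p , s) = suc p , there (subst (_≤ _) (sym cl≡0) z≤n) s

  -- No closing letter of colour i is preceded by an unmatched opening one, so that f_i acts on
  -- all closing letters in turn.

  Free : ∀ {ℓ} → Fin (2 + m) → Tensor (2 + m) ℓ → Set
  Free i []      = ⊤
  Free i (h ∷ t) = (# (closeLetter i) h ≡ 0 ⊎ ε i t ≡ 0) × Free i t

  absent⇒free : ∀ {ℓ} {i} {t : Tensor (2 + m) ℓ} → Absent i t → Free i t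
  absent⇒free []       = tt
  absent⇒free (p ∷ ps) = inj₂ (ε-absent ps) , absent⇒free ps

  -- Factors are treated from right to left: a relabelled head has no closing letter, so f_i passes
  -- on to the tail.
  relabel-all : ∀ {ℓ} i (t : Tensor (2 + m) ℓ) → Free i t → Star _↝[ i ]_ t (Vec.map (relabel i) t)
  relabel-all i []      _             = Star.ε
  relabel-all i (h ∷ t) (free , rest) = first free ◅◅ Star.gmap (relabel i h ∷_) (↝-there {h = relabel i h} (#-relabel-close i h)) (relabel-all i t rest)
    where
    first : # (closeLetter i) h ≡ 0 ⊎ ε i t ≡ 0 → Star _↝[ i ]_ (h ∷ t) (relabel i h ∷ t)
    first (inj₁ cl≡0) = subst (λ h′ → Star _↝[ i ]_ (h ∷ t) (h′ ∷ t)) (sym (relabel-trivial i cl≡0)) Star.ε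
    first (inj₂ ε≡0)  = relabel-head i ε≡0 h

  -- The letters ≥ k are increased by one; this is meaningful only in the absence of the letter n.

  shiftCount : Fin (2 + m) → Row (2 + m) → Fin (2 + m) → ℕ
  shiftCount k h d with Fin.<-cmp d k
  ... | tri< _ _ _ = # d h
  ... | tri≈ _ _ _ = 0
  ... | tri> _ _ _ = # (closeLetter d) h

  shiftFrom : Fin (2 + m) → Row (2 + m) → Row (2 + m)
  shiftFrom k h = rowOf (shiftCount k h)

  #-shift-< : ∀ k h {d} → d Fin.< k → # d (shiftFrom k h) ≡ # d h
  #-shift-< k h {d} d<k = trans (#-rowOf (shiftCount k h) d) counted
    where
    counted : shiftCount k h d ≡ # d h
    counted with Fin.<-cmp d k
    ... | tri< _ _ _   = refl
    ... | tri≈ d≮k _ _ = contradiction d<k d≮k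
    ... | tri> d≮k _ _ = contradiction d<k d≮k

  #-shift-≡ : ∀ k h → # k (shiftFrom k h) ≡ 0
  #-shift-≡ k h = trans (#-rowOf (shiftCount k h) k) counted
    where
    counted : shiftCount k h k ≡ 0
    counted with Fin.<-cmp k k
    ... | tri< _ k≢k _ = contradiction refl k≢k
    ... | tri≈ _ _ _   = refl
    ... | tri> _ k≢k _ = contradiction refl k≢k

  #-shift-> : ∀ k h {d} → k Fin.< d → # d (shiftFrom k h) ≡ # (closeLetter d) h
  #-shift-> k h {d} k<d = trans (#-rowOf (shiftCount k h) d) counted
    where
    counted : shiftCount k h d ≡ # (closeLetter d) h
    counted with Fin.<-cmp d k
    ... | tri< _ _ k≮d = contradiction k<d k≮d
    ... | tri≈ _ _ k≮d = contradiction k<d k≮d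
    ... | tri> _ _ _   = refl

  shiftFrom-last : ∀ {h} → # lastLetter h ≡ 0 → shiftFrom lastLetter h ≡ h
  shiftFrom-last {h} absent = row-ext counts
    where
    counts : ∀ d → # d (shiftFrom lastLetter h) ≡ # d h
    counts d with d Fin.≟ lastLetter
    ... | yes refl = trans (#-shift-≡ lastLetter h) (sym absent)
    ... | no d≢    = #-shift-< lastLetter h (ℕ.≤∧≢⇒< (Fin.≤fromℕ d) (d≢ ∘ Fin.toℕ-injective))

  relabel-shiftFrom : ∀ k h → relabel (suc k) (shiftFrom (suc k) h) ≡ shiftFrom (inject₁ k) h
  relabel-shiftFrom k h = relabel-unique (suc k)
    (trans (#-shift-> (inject₁ k) h k<) (sym (cong₂ _+_ (#-shift-≡ (suc k) h) (#-shift-< (suc k) h k<))))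
    (#-shift-≡ (inject₁ k) h)
    (λ d d≢cl d≢op → else d (Fin.<-cmp d (inject₁ k)) d≢cl d≢op)
    where
    k< : inject₁ k Fin.< suc k
    k< = ℕ.≤-reflexive (cong suc (Fin.toℕ-inject₁ k))
    else : ∀ d → Tri (d Fin.< inject₁ k) (d ≡ inject₁ k) (inject₁ k Fin.< d) → d ≢ inject₁ k → d ≢ suc k →
           # d (shiftFrom (inject₁ k) h) ≡ # d (shiftFrom (suc k) h)
    else d (tri< d< _ _) _ _ = trans (#-shift-< (inject₁ k) h d<) (sym (#-shift-< (suc k) h (ℕ.<-trans d< k<)))
    else d (tri≈ _ d≡ _) d≢cl _ = contradiction d≡ d≢cl
    else d (tri> _ _ d>) _ d≢op = trans (#-shift-> (inject₁ k) h d>) (sym (#-shift-> (suc k) h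
      (ℕ.≤∧≢⇒< (ℕ.≤-trans (ℕ.≤-reflexive (cong suc (sym (Fin.toℕ-inject₁ k)))) d>) (d≢op ∘ sym ∘ Fin.toℕ-injective))))

  shiftRow : Row (2 + m) → Row (2 + m)
  shiftRow = shiftFrom zero

  absent-map : ∀ {ℓ} {c} (φ : Row (2 + m) → Row (2 + m)) → (∀ h → # c (φ h) ≡ 0) → (t : Tensor (2 + m) ℓ) → Absent c (Vec.map φ t)
  absent-map φ absent []      = []
  absent-map φ absent (h ∷ t) = absent h ∷ absent-map φ absent t

  -- The largest letters are raised first. Each letter then moves into a place that has just been
  -- vacated, so its colour has no opening bracket and acts freely.
  shift-all : ∀ {ℓ} (t : Tensor (2 + m) ℓ) → Absent lastLetter t → Star _↝_ t (Vec.map shiftRow t)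
  shift-all {ℓ} t absent = Fin.>-weakInduction (λ k → Star _↝_ t (Vec.map (shiftFrom k) t))
    (subst (Star _↝_ t) (sym (unshifted absent)) Star.ε) down zero
    where
    unshifted : ∀ {ℓ} {t : Tensor (2 + m) ℓ} → Absent lastLetter t → Vec.map (shiftFrom lastLetter) t ≡ t
    unshifted []       = refl
    unshifted (p ∷ ps) = cong₂ _∷_ (shiftFrom-last p) (unshifted ps)
    down : ∀ k → Star _↝_ t (Vec.map (shiftFrom (suc k)) t) → Star _↝_ t (Vec.map (shiftFrom (inject₁ k)) t)
    down k path = path ◅◅ subst (Star _↝_ _) relabelled
      (Star.map (λ s → suc k , (λ ()) , s) (relabel-all (suc k) _ (absent⇒free (absent-map (shiftFrom (suc k)) (#-shift-≡ (suc k)) t))))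
      where
      relabelled : Vec.map (relabel (suc k)) (Vec.map (shiftFrom (suc k)) t) ≡ Vec.map (shiftFrom (inject₁ k)) t
      relabelled = trans (sym (Vec.map-∘ (relabel (suc k)) (shiftFrom (suc k)) t)) (Vec.map-cong (relabel-shiftFrom k) t)

  shift-pure : ∀ k K → shiftRow (pure (inject₁ k) K) ≡ pure (suc k) K
  shift-pure k K = row-ext counts
    where
    counts : ∀ d → # d (shiftRow (pure (inject₁ k) K)) ≡ # d (pure (suc k) K)
    counts zero = trans (#-shift-≡ zero _) (sym (#-pure-≢ (λ ()) K))
    counts (suc d) with d Fin.≟ k
    ... | yes refl = trans (#-shift-> zero _ (s≤s z≤n)) (trans (#-pure-≡ (inject₁ k) K) (sym (#-pure-≡ (suc k) K)))
    ... | no d≢k   = trans (#-shift-> zero _ (s≤s z≤n)) (trans (#-pure-≢ (d≢k ∘ Fin.inject₁-injective) K) (sym (#-pure-≢ (d≢k ∘ Fin.suc-injective) K)))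

-- Connectedness

map-size-⟷ : ∀ {ℓ} {R : Tensor n ℓ → Tensor n ℓ → Set} → (∀ {t t′} → R t t′ → Vec.map size t ≡ Vec.map size t′) →
             ∀ {t t′} → EqClosure R t t′ → Vec.map size t ≡ Vec.map size t′
map-size-⟷ = Eq.gfold isEquivalence (Vec.map size)

forwards : ∀ {A : Set} {R : A → A → Set} {x y} → Star R x y → EqClosure R x y
forwards = Star.map Sym.fwd

backwards : ∀ {A : Set} {R : A → A → Set} {x y} → Star R x y → EqClosure R y x
backwards {R = R} = Eq.symmetric R ∘ forwards

module _ {m : ℕ} where

  map-size-↝ : ∀ {ℓ i} {t t′ : Tensor (2 + m) ℓ} → t ↝[ i ] t′ → Vec.map size t ≡ Vec.map size t′
  map-size-↝ (_ , s) = sym (map-size-step s)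

  map-size-↝* : ∀ {ℓ i} {t t′ : Tensor (2 + m) ℓ} → Star _↝[ i ]_ t t′ → Vec.map size t ≡ Vec.map size t′
  map-size-↝* path = map-size-⟷ map-size-↝ (forwards path)

  lower : Fin (2 + m) → Row (2 + m) → Row (2 + m)
  lower i h = rowOf (λ c → # c h + δ c (closeLetter i) ∸ δ c (openLetter i))

  lower-raises : ∀ i {h} → 0 < # (openLetter i) h → Raises i (lower i h) h
  lower-raises i {h} 0<op = raises λ c → trans (cong (_+ δ c i) (#-rowOf _ c)) (ℕ.m∸n+n≡m (δ≤ c))
    where
    δ≤ : ∀ c → δ c (openLetter i) ≤ # c h + δ c (closeLetter i)
    δ≤ c with c Fin.≟ openLetter i
    ... | yes refl = ℕ.≤-trans 0<op (ℕ.m≤m+n _ _)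
    ... | no _     = z≤n

  -- The operator e_i: if the head cancels all openings of the tail, the leftmost remaining opening
  -- is in the head, otherwise in the tail.
  lowering : ∀ {ℓ} i (t : Tensor (2 + m) ℓ) → 0 < ε i t → ∃[ t₀ ] t₀ ↝[ i ] t
  lowering i (h ∷ t) 0<ε with ℕ.≤-<-connex (ε i t) (# (closeLetter i) h)
  ... | inj₁ ε≤ = lower i h ∷ t , 0 , here (subst (ε i t <_) (sym (raises-close r)) (s≤s ε≤)) r
    where
    r : Raises i (lower i h) h
    r = lower-raises i (subst (λ z → 0 < z + # i h) (ℕ.m≤n⇒m∸n≡0 ε≤) 0<ε)
  ... | inj₂ cl< with t₀ , p , s ← lowering i t (ℕ.≤-trans (s≤s z≤n) cl<) =
    h ∷ t₀ , suc p , there (s≤s⁻¹ (subst (# (closeLetter i) h <_) (ε-step s) cl<)) s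

  weight : Row (2 + m) → ℕ
  weight h = ListAction.sum (List.map toℕ (letters h))

  weight-raises : ∀ {i : Fin (1 + m)} {h h′} → Raises (suc i) h h′ → weight h′ ≡ suc (weight h)
  weight-raises {i} {h} {h′} (raises r) = ℕ.+-cancelˡ-≡ (toℕ i) _ _ (begin
    toℕ i + weight h′                   ≡⟨ cong (_+ weight h′) (Fin.toℕ-inject₁ i) ⟨
    ListAction.sum (List.map toℕ (inject₁ i ∷ letters h′)) ≡⟨ ListAction.sum-↭ (Perm.map⁺ toℕ perm) ⟨
    suc (toℕ i + weight h)              ≡⟨ ℕ.+-suc (toℕ i) (weight h) ⟨
    toℕ i + suc (weight h)              ∎)
    where
    open ≡-Reasoning
    perm = counts⇒↭ (suc i ∷ letters h) (inject₁ i ∷ letters h′) λ c →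
      trans (ℕ.+-comm (δ c (suc i)) (# c h)) (trans (r c) (ℕ.+-comm (# c h′) _))

  weights : ∀ {ℓ} → Tensor (2 + m) ℓ → ℕ
  weights []      = 0
  weights (h ∷ t) = weight h + weights t

  weights-step : ∀ {ℓ p} {i : Fin (1 + m)} {t t′ : Tensor (2 + m) ℓ} → Step (suc i) p t t′ → weights t′ ≡ suc (weights t)
  weights-step (here {t = t} _ r)  = cong (_+ weights t) (weight-raises r)
  weights-step (there {h = h} _ s) = trans (cong (weight h +_) (weights-step s)) (ℕ.+-suc (weight h) _)

  -- Terminates because each classical e_i lowers the sum of all letters by one.
  highest : ∀ {ℓ} (t : Tensor (2 + m) ℓ) → ∃[ t₀ ] Star _↝_ t₀ t × (∀ i → toℕ i ≢ 0 → ε i t₀ ≡ 0)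
  highest t = go (weights t) t refl
    where
    go : ∀ {ℓ} k (t : Tensor (2 + m) ℓ) → weights t ≡ k → ∃[ t₀ ] Star _↝_ t₀ t × (∀ i → toℕ i ≢ 0 → ε i t₀ ≡ 0)
    go k t eq with Fin.all? (λ (i : Fin (1 + m)) → ε (suc i) t ℕ.≟ 0)
    ... | yes all = t , Star.ε , λ { zero 0≢0 → contradiction refl 0≢0 ; (suc i) _ → all i }
    ... | no ¬all with i , ε≢0 , _ ← Fin.¬∀⟶∃¬-smallest (1 + m) _ (λ i → ε (suc i) t ℕ.≟ 0) ¬all
      with t₁ , s ← lowering (suc i) t (ℕ.n≢0⇒n>0 ε≢0) = descend k eq
      where
      descend : ∀ k → weights t ≡ k → ∃[ t₀ ] Star _↝_ t₀ t × (∀ i → toℕ i ≢ 0 → ε i t₀ ≡ 0)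
      descend zero    eq = contradiction (trans (sym (weights-step (proj₂ s))) eq) λ ()
      descend (suc k) eq with t₀ , path , hw ← go k t₁ (ℕ.suc-injective (trans (sym (weights-step (proj₂ s))) eq)) =
        t₀ , path ◅◅ ((suc i , (λ ()) , s) ◅ Star.ε) , hw

  nz : ∀ {ℓ} → Tensor (2 + m) ℓ → ℕ
  nz t = nonzeroEntries (Vec.map size t)

  -- In a lattice word the k-th nonempty row from the right only contains the first k letters,
  -- so n occurs only in the leftmost nonempty row.

  highest⇒free : ∀ {ℓ} b (t : Tensor (2 + m) ℓ) → (∀ i → b < toℕ i → ε i t ≡ 0) → b + nz t ≤ 2 + m → Free zero t
  highest⇒free b []      hw nz≤ = tt
  highest⇒free b (h ∷ t) hw nz≤ with size h in eq
  ... | zero = inj₁ (empty-# lastLetter {h} eq) , highest⇒free b t (λ i b<i → trans (sym (empty-ε i)) (hw i b<i)) nz≤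
    where
    empty-ε : ∀ i → ε i (h ∷ t) ≡ ε i t
    empty-ε i rewrite empty-# (closeLetter i) {h} eq | empty-# i {h} eq = ℕ.+-identityʳ _
  ... | suc _ = free (ℕ.≤-<-connex (1 + m) b) , highest⇒free (suc b) t tail-hw (subst (_≤ 2 + m) (ℕ.+-suc b (nz t)) nz≤)
    where
    absent : ∀ d → b < toℕ d → # d h ≡ 0
    absent d b<d = ℕ.m+n≡0⇒n≡0 (ε d t ∸ # (closeLetter d) h) (hw d b<d)
    tail-hw : ∀ i → suc b < toℕ i → ε i t ≡ 0
    tail-hw (suc i) (s≤s b<i) = trans (cong (ε (suc i) t ∸_) (sym (absent (inject₁ i) (subst (b <_) (sym (Fin.toℕ-inject₁ i)) b<i))))
      (ℕ.m+n≡0⇒m≡0 _ (hw (suc i) (ℕ.m≤n⇒m≤1+n b<i)))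
    nz≡0⇒ε≡0 : ∀ {ℓ} i (t : Tensor (2 + m) ℓ) → nz t ≡ 0 → ε i t ≡ 0
    nz≡0⇒ε≡0 i []      _ = refl
    nz≡0⇒ε≡0 i (h ∷ t) nz≡0 with size h in eq
    ... | zero rewrite empty-# (closeLetter i) {h} eq | empty-# i {h} eq = trans (ℕ.+-identityʳ _) (nz≡0⇒ε≡0 i t nz≡0)
    -- Here b is the number of nonempty factors already passed, and n has index 1 + m. While b < n -
    -- 1, n is too large a letter for this factor; from b = n - 1 on, all factors further left are
    -- empty.
    free : 1 + m ≤ b ⊎ b < 1 + m → # lastLetter h ≡ 0 ⊎ ε zero t ≡ 0
    free (inj₂ b<N) = inj₁ (absent lastLetter (subst (b <_) (sym (Fin.toℕ-fromℕ (1 + m))) b<N))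
    free (inj₁ N≤b) = inj₂ (nz≡0⇒ε≡0 zero t (ℕ.n≤0⇒n≡0 (ℕ.+-cancelˡ-≤ (2 + m) _ 0 (begin
      2 + m + nz t     ≤⟨ ℕ.+-monoˡ-≤ (nz t) (s≤s N≤b) ⟩
      suc b + nz t     ≡⟨ ℕ.+-suc b (nz t) ⟨
      b + suc (nz t)   ≤⟨ nz≤ ⟩
      2 + m            ≡⟨ ℕ.+-identityʳ (2 + m) ⟨
      2 + m + 0        ∎))))
      where open ℕ.≤-Reasoning

  data Jump {ℓ} (K : ℕ) : Tensor (2 + m) (suc ℓ) → Tensor (2 + m) (suc ℓ) → Set where
    classical : ∀ {t t′} → t ↝ t′ → Jump K t t′
    jump      : ∀ {c t t′} → c ≢ lastLetter → Star _↝[ zero ]_ t t′ →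
                ε lastLetter (pure c K ∷ t) ≡ 0 → ε lastLetter (pure c K ∷ t′) ≡ 0 →
                Jump K (pure c K ∷ t) (pure c K ∷ t′)

  map-size-jump : ∀ {ℓ K} {t t′ : Tensor (2 + m) (suc ℓ)} → Jump K t t′ → Vec.map size t ≡ Vec.map size t′
  map-size-jump (classical (_ , _ , s)) = map-size-↝ s
  map-size-jump {K = K} (jump {c} _ path _ _) = cong (size (pure c K) ∷_) (map-size-↝* path)

  record Lattice {ℓ} (K : ℕ) (c : Fin (2 + m)) (t : Tensor (2 + m) ℓ) : Set where
    field
      ε≡0  : ∀ i → c Fin.< i → ε i (pure c K ∷ t) ≡ 0
      free : Free zero t

  -- Among the classical colours n is only an opening letter and 1 only a closing one, so turning n
  -- into 1 can only lower ε.
  ε-relabel-zero : ∀ {ℓ} i (t : Tensor (2 + m) ℓ) → ε (suc i) (Vec.map (relabel zero) t) ≤ ε (suc i) t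
  ε-relabel-zero i t = ε-map-≤ (relabel zero) (λ h → op≤ h (cases zero (suc i))) (λ h → cl≤ h (cases zero (inject₁ i))) t
    where
    op≤ : ∀ h → Cases zero (suc i) → # (suc i) (relabel zero h) ≤ # (suc i) h
    op≤ h (isClose eq) = subst (λ d → # d (relabel zero h) ≤ # d h) (sym eq) (subst (_≤ # lastLetter h) (sym (#-relabel-close zero h)) z≤n)
    op≤ h (isElse p q) = ℕ.≤-reflexive (#-relabel-else zero h p q)
    cl≤ : ∀ h → Cases zero (inject₁ i) → # (inject₁ i) h ≤ # (inject₁ i) (relabel zero h)
    cl≤ h (isOpen eq)  = subst (λ d → # d h ≤ # d (relabel zero h)) (sym eq) (subst (# zero h ≤_) (sym (#-relabel-open zero h)) (ℕ.m≤m+n _ _))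
    cl≤ h (isClose eq) = contradiction (sym eq) Fin.fromℕ≢inject₁
    cl≤ h (isElse p q) = ℕ.≤-reflexive (sym (#-relabel-else zero h p q))

  -- Raising all letters by one takes the brackets of colour i to those of colour i + 1. Colour 0 is
  -- excluded, as its closing letter n has no successor.
  ε-shift : ∀ {ℓ} i → toℕ i ≢ 0 → (t : Tensor (2 + m) ℓ) → ε (suc i) (Vec.map shiftRow t) ≤ ε (inject₁ i) t
  ε-shift zero    0≢0 t = contradiction refl 0≢0
  ε-shift (suc i) _   t = ε-map-≤ shiftRow (λ h → ℕ.≤-reflexive (#-shift-> zero h {suc (suc i)} (s≤s z≤n)))
                                       (λ h → ℕ.≤-reflexive (sym (#-shift-> zero h {suc (inject₁ i)} (s≤s z≤n)))) t

  -- One round. It uses ε ≡ 0 for colour n - 1 only, but the next rounds draw this from ever smaller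
  -- colours, so `Lattice` keeps all colours above c. After the round the letter 1 is absent, so
  -- colour 0 is free again; the lattice word is responsible for the freedom of the first round
  -- only.
  lattice-jump : ∀ {ℓ K} (c : Fin (1 + m)) (t : Tensor (2 + m) ℓ) → Lattice K (inject₁ c) t →
    Σ[ t′ ∈ Tensor (2 + m) ℓ ] EqClosure (Jump K) (pure (inject₁ c) K ∷ t) (pure (suc c) K ∷ t′) × Lattice K (suc c) t′
  lattice-jump {K = K} c t lat = Vec.map shiftRow t₁ , first ◅ shifted , record { ε≡0 = shifted-ε ; free = absent⇒free (absent-map shiftRow (#-shift-≡ zero) t₁) }
    where
    open Lattice lat
    t₁ = Vec.map (relabel zero) t
    c≢last : inject₁ c ≢ lastLetter
    c≢last eq = Fin.fromℕ≢inject₁ (sym eq)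
    absent : Absent lastLetter (pure (inject₁ c) K ∷ t₁)
    absent = #-pure-≢ (c≢last ∘ sym) K ∷ absent-map (relabel zero) (#-relabel-close zero) t
    c<last : inject₁ c Fin.< lastLetter {suc m}
    c<last = subst₂ _<_ (sym (Fin.toℕ-inject₁ c)) (sym (Fin.toℕ-fromℕ (suc m))) (Fin.toℕ<n c)
    first : Sym.SymClosure (Jump K) (pure (inject₁ c) K ∷ t) (pure (inject₁ c) K ∷ t₁)
    first = Sym.fwd (jump c≢last (relabel-all zero t free) (ε≡0 lastLetter c<last) (ε-absent absent))
    shifted : EqClosure (Jump K) (pure (inject₁ c) K ∷ t₁) (pure (suc c) K ∷ Vec.map shiftRow t₁)
    shifted = subst (λ h → EqClosure (Jump K) (pure (inject₁ c) K ∷ t₁) (h ∷ Vec.map shiftRow t₁)) (shift-pure c K)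
      (forwards (Star.map classical (shift-all (pure (inject₁ c) K ∷ t₁) absent)))
    shifted-ε : ∀ i → suc c Fin.< i → ε i (pure (suc c) K ∷ Vec.map shiftRow t₁) ≡ 0
    shifted-ε (suc i@(suc i′)) (s≤s c<i) = ℕ.n≤0⇒n≡0 (begin
      ε (suc i) (pure (suc c) K ∷ Vec.map shiftRow t₁)      ≡⟨ cong (λ h → ε (suc i) (h ∷ Vec.map shiftRow t₁)) (shift-pure c K) ⟨
      ε (suc i) (Vec.map shiftRow (pure (inject₁ c) K ∷ t₁)) ≤⟨ ε-shift i (λ ()) (pure (inject₁ c) K ∷ t₁) ⟩
      ε (inject₁ i) (pure (inject₁ c) K ∷ t₁)              ≤⟨ ℕ.+-monoˡ-≤ (# (inject₁ i) (pure (inject₁ c) K)) (ℕ.∸-monoˡ-≤ (# (closeLetter (inject₁ i)) (pure (inject₁ c) K)) (ε-relabel-zero (inject₁ i′) t)) ⟩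
      ε (inject₁ i) (pure (inject₁ c) K ∷ t)               ≡⟨ ε≡0 (inject₁ i) (subst₂ _<_ (sym (Fin.toℕ-inject₁ c)) (sym (Fin.toℕ-inject₁ i)) c<i) ⟩
      0                                                    ∎)
      where open ℕ.≤-Reasoning

  toLast : ∀ {ℓ} (h : Row (2 + m)) (t : Tensor (2 + m) ℓ) → nz (h ∷ t) ≤ 2 + m →
           Σ[ t′ ∈ Tensor (2 + m) ℓ ] EqClosure (Jump (size h)) (h ∷ t) (pure lastLetter (size h) ∷ t′)
  toLast {ℓ} h t nz≤ with (h₀ ∷ t₀) , path , hw ← highest (h ∷ t) =
    proj₁ end , backwards (Star.map classical path) ◅◅ subst (λ k → EqClosure (Jump K) (k ∷ t₀) (pure lastLetter (size h) ∷ proj₁ end)) (sym h₀≡) (proj₂ end)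
    where
    K = size h
    same-sizes : Vec.map size (h₀ ∷ t₀) ≡ Vec.map size (h ∷ t)
    same-sizes = map-size-⟷ (λ (_ , _ , s) → map-size-↝ s) (forwards path)
    h₀≡ : h₀ ≡ pure zero K
    h₀≡ = trans (only⇒pure zero λ { zero 0≢0 → contradiction refl 0≢0 ; (suc d) _ → ℕ.m+n≡0⇒n≡0 (ε (suc d) t₀ ∸ # (inject₁ d) h₀) (hw (suc d) (λ ())) })
                (cong (pure zero) (Vec.∷-injectiveˡ same-sizes))
    nz₀≤ : nz (h₀ ∷ t₀) ≤ 2 + m
    nz₀≤ = subst (λ μ → nonzeroEntries μ ≤ 2 + m) (sym same-sizes) nz≤
    start : Lattice K zero t₀
    start = record
      { ε≡0  = λ i 0<i → subst (λ k → ε i (k ∷ t₀) ≡ 0) h₀≡ (hw i (ℕ.>⇒≢ 0<i))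
      ; free = proj₂ (highest⇒free 0 (h₀ ∷ t₀) (λ i 0<i → hw i (ℕ.>⇒≢ 0<i)) nz₀≤)
      }
    End : Fin (2 + m) → Set
    End c = ∀ t → Lattice K c t → Σ[ t′ ∈ Tensor (2 + m) ℓ ] EqClosure (Jump K) (pure c K ∷ t) (pure lastLetter K ∷ t′)
    end : Σ[ t′ ∈ Tensor (2 + m) ℓ ] EqClosure (Jump K) (pure zero K ∷ t₀) (pure lastLetter K ∷ t′)
    end = Fin.>-weakInduction End (λ t _ → t , Star.ε)
      (λ c rest t lat → let t₁ , p , lat₁ = lattice-jump c t lat ; t′ , q = rest t₁ lat₁ in t′ , p ◅◅ q)
      zero t₀ start

-- Lets the translation of an edge depend on a property of its source. A reversed edge is met at its
-- target, so the property must travel in both directions.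
EqClosure-invariant : ∀ {A : Set} {P : A → Set} {E F : A → A → Set} →
  (∀ {x y} → E x y → P x → P y) → (∀ {x y} → E x y → P y → P x) → (∀ {x y} → P x → E x y → F x y) →
  ∀ {x y} → P x → EqClosure E x y → EqClosure F x y
EqClosure-invariant to from f Px Star.ε               = Star.ε
EqClosure-invariant to from f Px (Sym.fwd e ◅ path) = Sym.fwd (f Px e) ◅ EqClosure-invariant to from f (to e Px) path
EqClosure-invariant to from f Px (Sym.bwd e ◅ path) = Sym.bwd (f (from e Px) e) ◅ EqClosure-invariant to from f (from e Px) path

module _ {m : ℕ} where

  penultimate : Fin (2 + m)
  penultimate = closeLetter lastLetter

  last≢zero : toℕ (lastLetter {suc m}) ≢ 0
  last≢zero ()

  close≢last : ∀ {i : Fin (2 + m)} → toℕ i ≢ 0 → closeLetter i ≢ lastLetter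
  close≢last {zero}  0≢0 _  = 0≢0 refl
  close≢last {suc i} _   eq = Fin.fromℕ≢inject₁ (sym eq)

  penultimate≢last : penultimate ≢ lastLetter
  penultimate≢last = close≢last last≢zero

  _↝ᵖ_ : ∀ {ℓ} → Tensor (2 + m) ℓ → Tensor (2 + m) ℓ → Set
  t ↝ᵖ t′ = ∃[ i ] (i ≢ lastLetter) × (t ↝[ i ] t′)

  -- Besides the classical arrows, these are the paths that remain available after adding
  -- any number of letters n as a new rightmost factor: they are lowered to n - 1 first.

  data Move {ℓ} : Tensor (2 + m) ℓ → Tensor (2 + m) ℓ → Set where
    classical : ∀ {t t′} → t ↝ t′ → Move t t′
    detour    : ∀ {t t′} → EqClosure _↝ᵖ_ t t′ → ε lastLetter t ≡ 0 → ε lastLetter t′ ≡ 0 → Move t t′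

  ↝-pure : ∀ {ℓ i c K} {t t′ : Tensor (2 + m) ℓ} → closeLetter i ≢ c → t ↝[ i ] t′ → (pure c K ∷ t) ↝[ i ] (pure c K ∷ t′)
  ↝-pure {c = c} {K} cl≢c = ↝-there (#-pure-≢ cl≢c K)

  ↝ᵖ-pure : ∀ {ℓ i K} {t t′ : Tensor (2 + m) ℓ} → i ≢ lastLetter → t ↝[ i ] t′ → (pure penultimate K ∷ t) ↝[ i ] (pure penultimate K ∷ t′)
  ↝ᵖ-pure i≢last = ↝-pure (i≢last ∘ closeLetter-injective)

  raise-penultimate : ∀ {ℓ} K {t : Tensor (2 + m) ℓ} → ε lastLetter t ≡ 0 → Star _↝[ lastLetter ]_ (pure penultimate K ∷ t) (pure lastLetter K ∷ t)
  raise-penultimate K {t} ε≡0 = subst (λ h → Star _↝[ lastLetter ]_ (pure penultimate K ∷ t) (h ∷ t)) (relabel-pure lastLetter K)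
    (relabel-head lastLetter ε≡0 (pure penultimate K))

  ↝-last : ∀ {ℓ} {t t′ : Tensor (2 + m) ℓ} → t ↝[ lastLetter ] t′ → t ↝ t′
  ↝-last s = lastLetter , last≢zero , s

  jump⇒move : ∀ {ℓ K} {t t′ : Tensor (2 + m) (suc ℓ)} → Jump K t t′ → Move t t′
  jump⇒move (classical s)               = classical s
  jump⇒move (jump c≢last path start end) = detour (forwards (Star.gmap (_ ∷_) (λ s → zero , (λ ()) , ↝-pure (c≢last ∘ sym) s) path)) start end

  module _ {ℓ} (E : Tensor (2 + m) (suc ℓ) → Tensor (2 + m) (suc ℓ) → Set) (classicalE : ∀ {t t′} → t ↝ t′ → E t t′) where

    frozen-last : ∀ K → (∀ {t t′} → EqClosure _↝ᵖ_ t t′ → ε lastLetter t ≡ 0 → ε lastLetter t′ ≡ 0 →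
                           EqClosure E (pure penultimate K ∷ t) (pure penultimate K ∷ t′)) →
                  ∀ {t t′} → EqClosure Move t t′ → EqClosure E (pure lastLetter K ∷ t) (pure lastLetter K ∷ t′)
    frozen-last K detourE = Eq.gfold (Eq.isEquivalence E) (pure lastLetter K ∷_) frozen
      where
      frozen : ∀ {t t′} → Move t t′ → EqClosure E (pure lastLetter K ∷ t) (pure lastLetter K ∷ t′)
      frozen (classical (i , i≢0 , s)) = Eq.return (classicalE (i , i≢0 , ↝-pure (close≢last i≢0) s))
      frozen (detour path start end)   =
        backwards (Star.map (classicalE ∘ ↝-last) (raise-penultimate K start))
        ◅◅ detourE path start end
        ◅◅ forwards (Star.map (classicalE ∘ ↝-last) (raise-penultimate K end))

  nz-tail : ∀ {ℓ} (h : Row (2 + m)) (t : Tensor (2 + m) ℓ) → nz t ≤ nz (h ∷ t)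
  nz-tail h t with size h
  ... | zero  = ℕ.≤-refl
  ... | suc _ = ℕ.n≤1+n _

  nz-nonempty : ∀ {ℓ} (h : Row (2 + m)) (t : Tensor (2 + m) ℓ) → size h ≢ 0 → nz (h ∷ t) ≡ suc (nz t)
  nz-nonempty h t h≢0 with size h
  ... | zero  = contradiction refl h≢0
  ... | suc _ = refl

  toLast-sizes : ∀ {ℓ} {h : Row (2 + m)} {t t′ : Tensor (2 + m) ℓ} → EqClosure (Jump (size h)) (h ∷ t) (pure lastLetter (size h) ∷ t′) →
                 Vec.map size t′ ≡ Vec.map size t
  toLast-sizes path = sym (Vec.∷-injectiveʳ (map-size-⟷ map-size-jump path))

  ε-penultimate : ∀ {ℓ} K (t : Tensor (2 + m) ℓ) → ε lastLetter t ≡ 0 → ε lastLetter (pure penultimate K ∷ t) ≡ 0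
  ε-penultimate K t eq = cong₂ _+_ (trans (cong (_∸ # penultimate (pure penultimate K)) eq) (ℕ.0∸n≡0 (# penultimate (pure penultimate K))))
                                 (#-pure-≢ (penultimate≢last ∘ sym) K)

  module _ {ℓ} (E : Tensor (2 + m) (suc ℓ) → Tensor (2 + m) (suc ℓ) → Set) (classicalE : ∀ {t t′} → t ↝ t′ → E t t′)
           (K : ℕ) (jumpE : ∀ {t t′} → Jump K t t′ → EqClosure E t t′)
           (detourE : ∀ {t t′} → EqClosure _↝ᵖ_ t t′ → ε lastLetter t ≡ 0 → ε lastLetter t′ ≡ 0 →
                      EqClosure E (pure penultimate K ∷ t) (pure penultimate K ∷ t′))
           (tails-connected : ∀ (t t′ : Tensor (2 + m) ℓ) → Vec.map size t ≡ Vec.map size t′ → nz t ≤ 1 + m → EqClosure Move t t′)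
           where

    connect : ∀ {h h′} {t t′ : Tensor (2 + m) ℓ} → size h ≡ K → Vec.map size (h ∷ t) ≡ Vec.map size (h′ ∷ t′) →
              nz (h ∷ t) ≤ 2 + m → nz t ≤ 1 + m → EqClosure E (h ∷ t) (h′ ∷ t′)
    connect {h} {h′} {t} {t′} refl eq nz≤ nzt≤
      with u , path ← toLast h t nz≤
         | u′ , path′ ← toLast h′ t′ (subst (λ μ → nonzeroEntries μ ≤ 2 + m) eq nz≤) =
      Eq.fold (Eq.isEquivalence E) jumpE path
      ◅◅ frozen-last E classicalE K detourE (tails-connected u u′
           (trans (toLast-sizes path) (trans (Vec.∷-injectiveʳ eq) (sym (toLast-sizes path′))))
           (subst (λ μ → nonzeroEntries μ ≤ 1 + m) (sym (toLast-sizes path)) nzt≤))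
      ◅◅ Eq.symmetric E (subst (λ K → EqClosure E (h′ ∷ t′) (pure lastLetter K ∷ u′)) (sym (Vec.∷-injectiveˡ eq))
           (Eq.fold (Eq.isEquivalence E) jumpE (subst (λ K → EqClosure (Jump K) (h′ ∷ t′) (pure lastLetter (size h′) ∷ u′)) (sym (Vec.∷-injectiveˡ eq)) path′)))

  -- The induction closes because a detour stays a detour behind n - 1 ⋯ n - 1: only the colour n -
  -- 1 could act on that factor, detours avoid this colour, and without a letter n it adds nothing
  -- to ε at the ends.
  moves-connected : ∀ {ℓ} (t t′ : Tensor (2 + m) ℓ) → Vec.map size t ≡ Vec.map size t′ → nz t ≤ 1 + m → EqClosure Move t t′
  moves-connected []      []        _  _   = Star.ε
  moves-connected (h ∷ t) (h′ ∷ t′) eq nz≤ =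
    connect Move classical (size h) (Eq.return ∘ jump⇒move)
      (λ {u} {u′} path start end → Eq.return (detour (Eq.gmap (pure penultimate (size h) ∷_) (λ (i , i≢last , s) → i , i≢last , ↝ᵖ-pure i≢last s) path)
                                            (ε-penultimate (size h) u start) (ε-penultimate (size h) u′ end)))
      moves-connected refl eq (ℕ.m≤n⇒m≤1+n nz≤) (ℕ.≤-trans (nz-tail h t) nz≤)

  -- With a rightmost factor c ⋯ c, c ≠ n, all 0-arrows acting on the other factors suffice.

  module _ {ℓ} (E : Tensor (2 + m) (suc ℓ) → Tensor (2 + m) (suc ℓ) → Set) (classicalE : ∀ {t t′} → t ↝ t′ → E t t′)
           (K : ℕ) (zeroE : ∀ {c t t′} → c ≢ lastLetter → t ↝[ zero ] t′ → E (pure c K ∷ t) (pure c K ∷ t′)) where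

    connect-nonempty : ∀ {h h′} {t t′ : Tensor (2 + m) ℓ} → size h ≡ K → K ≢ 0 → Vec.map size (h ∷ t) ≡ Vec.map size (h′ ∷ t′) →
                       nz (h ∷ t) ≤ 2 + m → EqClosure E (h ∷ t) (h′ ∷ t′)
    connect-nonempty {h} {h′} {t} {t′} refl K≢0 eq nz≤ =
      connect E classicalE K jumpE (λ path _ _ → Eq.gmap (pure penultimate K ∷_) penultimateE path) moves-connected refl eq nz≤
        (s≤s⁻¹ (subst (_≤ 2 + m) (nz-nonempty h t K≢0) nz≤))
      where
      jumpE : ∀ {t t′} → Jump K t t′ → EqClosure E t t′
      jumpE (classical s)          = Eq.return (classicalE s)
      jumpE (jump c≢last path _ _) = forwards (Star.gmap (_ ∷_) (zeroE c≢last) path)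
      penultimateE : ∀ {t t′} → t ↝ᵖ t′ → E (pure penultimate K ∷ t) (pure penultimate K ∷ t′)
      penultimateE (zero  , _ , s)      = zeroE penultimate≢last s
      penultimateE (suc i , i≢last , s) = classicalE (suc i , (λ ()) , ↝ᵖ-pure i≢last s)

  _↝⁺_ : ∀ {ℓ} → Tensor (2 + m) ℓ → Tensor (2 + m) ℓ → Set
  t ↝⁺ t′ = ∃[ i ] (t ↝[ i ] t′)

  empty-unique : {h h′ : Row (2 + m)} → size h ≡ 0 → size h′ ≡ 0 → h ≡ h′
  empty-unique {h} {h′} h≡0 h′≡0 = row-ext λ c → trans (empty-# c {h} h≡0) (sym (empty-# c {h′} h′≡0))

  crystal-connected : ∀ {ℓ} (t t′ : Tensor (2 + m) ℓ) → Vec.map size t ≡ Vec.map size t′ → nz t ≤ 2 + m → EqClosure _↝⁺_ t t′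
  crystal-connected []      []        _  _   = Star.ε
  crystal-connected (h ∷ t) (h′ ∷ t′) eq nz≤ with size h ℕ.≟ 0
  ... | no h≢0  = connect-nonempty _↝⁺_ (λ (i , _ , s) → i , s) (size h) (λ c≢last s → zero , ↝-pure (c≢last ∘ sym) s) refl h≢0 eq nz≤
  ... | yes h≡0 = subst (λ k → EqClosure _↝⁺_ (h ∷ t) (k ∷ t′)) (empty-unique {h} {h′} h≡0 (trans (sym (Vec.∷-injectiveˡ eq)) h≡0))
      (Eq.gmap (h ∷_) (λ (i , s) → i , ↝-there (empty-# (closeLetter i) {h} h≡0) s)
        (crystal-connected t t′ (Vec.∷-injectiveʳ eq) (ℕ.≤-trans (nz-tail h t) nz≤)))

-- The Yang–Baxter equation and the order of the factors

RSpec-content : ∀ {a b : Row (suc n)} {w b′ a′} → RSpec a b (w , b′ , a′) → ∀ c → # c b′ + # c a′ ≡ # c a + # c b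
RSpec-content {a = a} {b} {b′ = b′} {a′} spec c = conserve spec
  where
  RMatrix-content : ∀ {a b b′ a′ : Row (suc _)} {w} → RMatrix a b (w , b′ , a′) → # c b′ + # c a′ ≡ # c a + # c b
  RMatrix-content {a} {b} {b′} {a′} R = begin
    # c b′ + # c a′                        ≡⟨ cong (_+ # c a′) (left c) ⟩
    # c a + (# c b ∸ T c) + # c a′         ≡⟨ lemma (# c a) (# c b ∸ T c) (# c a′) ⟩
    # c a + (# c a′ + (# c b ∸ T c))       ≡⟨ cong (# c a +_) (right c) ⟩
    # c a + # c b                          ∎
    where
    open RMatrix R hiding (b′; a′)
    open ≡-Reasoning
    lemma : ∀ x y z → x + y + z ≡ x + (z + y)
    lemma = solve-∀
  conserve : ∀ {w} → RSpec a b (w , b′ , a′) → # c b′ + # c a′ ≡ # c a + # c b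
  conserve (forward _ R)  = RMatrix-content R
  conserve (backward _ R) = sym (RMatrix-content R)

module _ {m : ℕ} where

  σ-↝ : ∀ {ℓ i} k {t t′ : Tensor (2 + m) ℓ} → t ↝[ i ] t′ → σ k t ↝[ i ] σ k t′
  σ-↝ k (_ , s) = let p′ , s′ , _ = σ-step k s in p′ , s′

  absent-σ : ∀ {ℓ c} k {t : Tensor (2 + m) ℓ} → Absent c t → Absent c (σ k t)
  absent-σ zero    []           = []
  absent-σ (suc _) []           = []
  absent-σ zero    (p ∷ [])     = p ∷ []
  absent-σ {c = c} zero (_∷_ {x = h} p (_∷_ {x = k} q ps)) = ℕ.m+n≡0⇒n≡0 (# c (proj₁ (𝓡 k h))) none ∷ ℕ.m+n≡0⇒m≡0 (# c (proj₁ (𝓡 k h))) none ∷ ps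
    where
    none : # c (proj₁ (𝓡 k h)) + # c (proj₂ (𝓡 k h)) ≡ 0
    none = trans (RSpec-content (windingAndR-spec k h) c) (cong₂ _+_ q p)
  absent-σ (suc k) (p ∷ ps)     = p ∷ absent-σ k ps

  only-zero-unique : ∀ {ℓ} {t u : Tensor (2 + m) ℓ} → (∀ c → c ≢ zero → Absent c t) → (∀ c → c ≢ zero → Absent c u) →
                     Vec.map size t ≡ Vec.map size u → t ≡ u
  only-zero-unique {t = []}    {[]}    _ _ _ = refl
  only-zero-unique {t = h ∷ t} {k ∷ u} p q eq = cong₂ _∷_
    (trans (only⇒pure zero (λ c c≢0 → VecAll.head (p c c≢0))) (trans (cong (pure zero) (Vec.∷-injectiveˡ eq)) (sym (only⇒pure zero (λ c c≢0 → VecAll.head (q c c≢0))))))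
    (only-zero-unique (λ c c≢0 → VecAll.tail (p c c≢0)) (λ c c≢0 → VecAll.tail (q c c≢0)) (Vec.∷-injectiveʳ eq))

  braidˡ braidʳ : ∀ {ℓ} → Tensor (2 + m) ℓ → Tensor (2 + m) ℓ
  braidˡ t = σ 0 (σ 1 (σ 0 t))
  braidʳ t = σ 1 (σ 0 (σ 1 t))

  -- Both sides commute with all crystal operators and agree on 1 ⋯ 1 ⊗ 1 ⋯ 1 ⊗ 1 ⋯ 1.

  braid-three : (t : Tensor (2 + m) 3) → nz t ≤ 2 + m → braidˡ t ≡ braidʳ t
  braid-three t nz≤ = Star.fold (λ x y → braidˡ x ≡ braidʳ x → braidˡ y ≡ braidʳ y) (λ e rest eq → rest (transport e eq)) id
    (crystal-connected ones t sizes-ones (subst (λ μ → nonzeroEntries μ ≤ 2 + m) (sym sizes-ones) nz≤))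
    (only-zero-unique (λ c c≢0 → absent-σ 0 (absent-σ 1 (absent-σ 0 (absent c c≢0)))) (λ c c≢0 → absent-σ 1 (absent-σ 0 (absent-σ 1 (absent c c≢0)))) sizes-agree)
    where
    ones : Tensor (2 + m) 3
    ones = Vec.map (pure zero ∘ size) t
    sizes-ones : Vec.map size ones ≡ Vec.map size t
    sizes-ones = trans (sym (Vec.map-∘ size (pure zero ∘ size) t)) (Vec.map-cong (λ h → size-pure zero (size h)) t)
    absent : ∀ c → c ≢ zero → Absent c ones
    absent c c≢0 = absent-map (pure zero ∘ size) (λ h → #-pure-≢ c≢0 (size h)) t
    swaps : (μ : Vec ℕ 3) → swapAt 0 (swapAt 1 (swapAt 0 μ)) ≡ swapAt 1 (swapAt 0 (swapAt 1 μ))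
    swaps (x ∷ y ∷ z ∷ []) = refl
    sizes-σ : ∀ i j k (t : Tensor (2 + m) 3) → Vec.map size (σ i (σ j (σ k t))) ≡ swapAt i (swapAt j (swapAt k (Vec.map size t)))
    sizes-σ i j k t = trans (map-size-σ i (σ j (σ k t))) (cong (swapAt i) (trans (map-size-σ j (σ k t)) (cong (swapAt j) (map-size-σ k t))))
    sizes-agree : Vec.map size (braidˡ ones) ≡ Vec.map size (braidʳ ones)
    sizes-agree = trans (sizes-σ 0 1 0 ones) (trans (swaps (Vec.map size ones)) (sym (sizes-σ 1 0 1 ones)))
    transport : ∀ {x y} → Sym.SymClosure _↝⁺_ x y → braidˡ x ≡ braidʳ x → braidˡ y ≡ braidʳ y
    transport {x} {y} (Sym.fwd (i , s)) eq = proj₂ (step-deterministic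
      (proj₂ (subst (_↝[ i ] braidˡ y) eq (σ-↝ 0 (σ-↝ 1 (σ-↝ 0 s))))) (proj₂ (σ-↝ 1 (σ-↝ 0 (σ-↝ 1 s)))))
    transport {x} {y} (Sym.bwd (i , s)) eq = step-injective
      (proj₂ (subst (braidˡ y ↝[ i ]_) eq (σ-↝ 0 (σ-↝ 1 (σ-↝ 0 s))))) (proj₂ (σ-↝ 1 (σ-↝ 0 (σ-↝ 1 s))))

  nz-∷-mono : ∀ {a b} (h : Row (2 + m)) {t : Tensor (2 + m) a} {u : Tensor (2 + m) b} → nz t ≤ nz u → nz (h ∷ t) ≤ nz (h ∷ u)
  nz-∷-mono h t≤u with size h
  ... | zero  = t≤u
  ... | suc _ = s≤s t≤u

  σ-++ : ∀ {a b} k (u : Tensor (2 + m) a) (t : Tensor (2 + m) b) → suc k < a → σ k (u Vec.++ t) ≡ σ k u Vec.++ t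
  σ-++ zero    (h ∷ [])    t (s≤s ())
  σ-++ zero    (h ∷ k ∷ u) t _ = refl
  σ-++ (suc k) (h ∷ u)     t k< = cong (h ∷_) (σ-++ k u t (s≤s⁻¹ k<))

  yang-baxter : ∀ {ℓ} k (t : Tensor (2 + m) ℓ) → 2 + k < ℓ → nz t ≤ 2 + m →
                σ k (σ (suc k) (σ k t)) ≡ σ (suc k) (σ k (σ (suc k) t))
  yang-baxter (suc k) (h ∷ t) k< nz≤ = cong (h ∷_) (yang-baxter k t (s≤s⁻¹ k<) (ℕ.≤-trans (nz-tail h t) nz≤))
  yang-baxter zero (h ∷ []) (s≤s ()) nz≤
  yang-baxter zero (h ∷ k ∷ []) (s≤s (s≤s ())) nz≤
  yang-baxter zero (h ∷ k ∷ l ∷ t) _ nz≤ = trans (append 0 1 0 0<2 1<2 0<2)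
    (trans (cong (Vec._++ t) (braid-three u (ℕ.≤-trans (nz-∷-mono h {k ∷ l ∷ []} {k ∷ l ∷ t} (nz-∷-mono k {l ∷ []} {l ∷ t} (nz-∷-mono l {[]} {t} z≤n))) nz≤)))
           (sym (append 1 0 1 1<2 0<2 1<2)))
    where
    u : Tensor (2 + m) 3
    u = h ∷ k ∷ l ∷ []
    0<2 : 1 < 3
    0<2 = s≤s (s≤s z≤n)
    1<2 : 2 < 3
    1<2 = s≤s (s≤s (s≤s z≤n))
    append : ∀ i j k → suc i < 3 → suc j < 3 → suc k < 3 → σ i (σ j (σ k (u Vec.++ t))) ≡ σ i (σ j (σ k u)) Vec.++ t
    append i j k i< j< k< = trans (cong (σ i ∘ σ j) (σ-++ k u t k<)) (trans (cong (σ i) (σ-++ j (σ k u) t j<)) (σ-++ i (σ j (σ k u)) t i<))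

  nonzeroEntries-swapAt : ∀ {ℓ} k (μ : Vec ℕ ℓ) → nonzeroEntries (swapAt k μ) ≡ nonzeroEntries μ
  nonzeroEntries-swapAt zero    []                  = refl
  nonzeroEntries-swapAt (suc _) []                  = refl
  nonzeroEntries-swapAt zero    (x ∷ [])            = refl
  nonzeroEntries-swapAt zero    (zero  ∷ zero  ∷ μ) = refl
  nonzeroEntries-swapAt zero    (zero  ∷ suc _ ∷ μ) = refl
  nonzeroEntries-swapAt zero    (suc _ ∷ zero  ∷ μ) = refl
  nonzeroEntries-swapAt zero    (suc _ ∷ suc _ ∷ μ) = refl
  nonzeroEntries-swapAt (suc k) (zero  ∷ μ)         = nonzeroEntries-swapAt k μ
  nonzeroEntries-swapAt (suc k) (suc _ ∷ μ)         = cong suc (nonzeroEntries-swapAt k μ)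

  nz-σ : ∀ {ℓ} k (t : Tensor (2 + m) ℓ) → nz (σ k t) ≡ nz t
  nz-σ k t = trans (cong nonzeroEntries (map-size-σ k t)) (nonzeroEntries-swapAt k (Vec.map size t))

  nz-moveDown : ∀ {ℓ} i d (t : Tensor (2 + m) ℓ) → nz (moveDown i d t) ≡ nz t
  nz-moveDown i zero    t = refl
  nz-moveDown i (suc d) t = trans (nz-σ i (moveDown (suc i) d t)) (nz-moveDown (suc i) d t)

  σ-commute : ∀ {ℓ} i a (t : Tensor (2 + m) ℓ) → σ i (σ (2 + (i + a)) t) ≡ σ (2 + (i + a)) (σ i t)
  σ-commute zero    a []          = refl
  σ-commute (suc _) a []          = refl
  σ-commute zero    a (h ∷ [])    = refl
  σ-commute zero    a (h ∷ k ∷ t) = refl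
  σ-commute (suc i) a (h ∷ t)     = cong (h ∷_) (σ-commute i a t)

  moveDown-snoc : ∀ {ℓ} i d (t : Tensor (2 + m) ℓ) → moveDown i d (σ (i + d) t) ≡ moveDown i (suc d) t
  moveDown-snoc i zero    t = cong (λ k → σ k t) (ℕ.+-identityʳ i)
  moveDown-snoc i (suc d) t = cong (σ i) (trans (cong (λ k → moveDown (suc i) d (σ k t)) (ℕ.+-suc i d)) (moveDown-snoc (suc i) d t))

  moveDown-σ-above : ∀ {ℓ} i d a (t : Tensor (2 + m) ℓ) → moveDown i d (σ (suc (i + d + a)) t) ≡ σ (suc (i + d + a)) (moveDown i d t)
  moveDown-σ-above i zero    a t = refl
  moveDown-σ-above i (suc d) a t rewrite ℕ.+-suc i d =
    trans (cong (σ i) (moveDown-σ-above (suc i) d a t))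
          (subst (λ k → σ i (σ (2 + k) (moveDown (suc i) d t)) ≡ σ (2 + k) (σ i (moveDown (suc i) d t))) (sym (ℕ.+-assoc i d a))
                 (σ-commute i (d + a) (moveDown (suc i) d t)))

  moveDown-σ-below : ∀ {ℓ} i a d (t : Tensor (2 + m) ℓ) → moveDown (2 + (i + a)) d (σ i t) ≡ σ i (moveDown (2 + (i + a)) d t)
  moveDown-σ-below i a zero    t = refl
  moveDown-σ-below i a (suc d) t = trans
    (cong (σ (2 + (i + a))) (subst (λ k → moveDown (2 + k) d (σ i t) ≡ σ i (moveDown (2 + k) d t)) (ℕ.+-suc i a) (moveDown-σ-below i (suc a) d t)))
    (sym (σ-commute i a (moveDown (3 + (i + a)) d t)))

  -- The braid identity σ_i ⋯ σ_{j-1} σ_k = σ_{k+1} σ_i ⋯ σ_{j-1} for i ≤ k < j - 1, with k = i + a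
  -- and j = i + a + 2 + b: σ_k commutes inwards until it meets σ_k σ_{k+1}, and commutes outwards
  -- afterwards.
  moveDown-σ-across : ∀ {ℓ} i a b (t : Tensor (2 + m) ℓ) → i + (a + (2 + b)) < ℓ → nz t ≤ 2 + m →
                      moveDown i (a + (2 + b)) (σ (i + a) t) ≡ σ (suc (i + a)) (moveDown i (a + (2 + b)) t)
  moveDown-σ-across {ℓ} i zero b t i< nz≤ rewrite ℕ.+-identityʳ i = trans
    (cong (σ i ∘ σ (suc i)) (subst (λ k → moveDown (2 + k) b (σ i t) ≡ σ i (moveDown (2 + k) b t)) (ℕ.+-identityʳ i) (moveDown-σ-below i 0 b t)))
    (yang-baxter i (moveDown (2 + i) b t) (ℕ.≤-trans (s≤s (subst (_≤ i + (2 + b)) (ℕ.+-comm i 2) (ℕ.+-monoʳ-≤ i (ℕ.m≤m+n 2 b)))) i<)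
      (subst (_≤ 2 + m) (sym (nz-moveDown (2 + i) b t)) nz≤))
  moveDown-σ-across {ℓ} i (suc a) b t i< nz≤ rewrite ℕ.+-suc i a = trans
    (cong (σ i) (moveDown-σ-across (suc i) a b t (subst (_< ℓ) (ℕ.+-suc i (a + (2 + b))) i<) nz≤))
    (σ-commute i a (moveDown (suc i) (a + (2 + b)) t))

  headFree-σ : ∀ {ℓ} k (t : Tensor (2 + m) ℓ) → HeadFree t → HeadFree (σ (suc k) t)
  headFree-σ k []      free = tt
  headFree-σ k (h ∷ t) free = free

  -- σ_k only permutes the factors that can be brought to the right end: j = k and j = k + 1 change
  -- places, and for any other j the tensor is altered by some σ of positive index, which leaves the
  -- rightmost factor alone.
  safe-σ : ∀ {ℓ} k (t : Tensor (2 + m) ℓ) → suc k < ℓ → nz t ≤ 2 + m → Safe t → Safe (σ k t)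
  safe-σ {ℓ} k t k< nz≤ safe j j< with ℕ.≤-<-connex (2 + k) j
  ... | inj₁ 2+k≤j with b , refl ← ℕ.m≤n⇒∃[o]m+o≡n 2+k≤j =
    subst (λ d → HeadFree (moveDown 0 d (σ k t))) (k+[2+b] k b)
      (subst HeadFree (sym (moveDown-σ-across 0 k b t (subst (_< ℓ) (sym (k+[2+b] k b)) j<) nz≤))
        (headFree-σ k (moveDown 0 (k + (2 + b)) t) (safe (k + (2 + b)) (subst (_< ℓ) (sym (k+[2+b] k b)) j<))))
    where
    k+[2+b] : ∀ k b → k + (2 + b) ≡ 2 + (k + b)
    k+[2+b] = solve-∀
  ... | inj₂ (s≤s j≤1+k) with ℕ.m≤n⇒m<n∨m≡n j≤1+k
  ...   | inj₂ refl = subst HeadFree (sym (trans (sym (moveDown-snoc 0 k (σ k t))) (cong (moveDown 0 k) (σ-involutive k t)))) (safe k (ℕ.<-trans (ℕ.n<1+n k) k<))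
  ...   | inj₁ (s≤s j≤k) with ℕ.m≤n⇒m<n∨m≡n j≤k
  ...     | inj₂ refl = subst HeadFree (sym (moveDown-snoc 0 k t)) (safe (suc k) k<)
  ...     | inj₁ j<k with a , refl ← ℕ.m≤n⇒∃[o]m+o≡n j<k =
    subst HeadFree (sym (moveDown-σ-above 0 j a t)) (headFree-σ (j + a) (moveDown 0 j t) (safe j j<))

-- Bringing a largest factor to the right end

data At : ∀ {ℓ} → ℕ → ℕ → Vec ℕ ℓ → Set where
  here  : ∀ {ℓ M} {μ : Vec ℕ ℓ} → At 0 M (M ∷ μ)
  there : ∀ {ℓ k M x} {μ : Vec ℕ ℓ} → At k M μ → At (suc k) M (x ∷ μ)

at-< : ∀ {ℓ k M} {μ : Vec ℕ ℓ} → At k M μ → k < ℓ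
at-< here      = s≤s z≤n
at-< (there p) = s≤s (at-< p)

at-swap : ∀ {ℓ} k {M} {μ : Vec ℕ ℓ} → At (suc k) M μ → At k M (swapAt k μ)
at-swap zero    (there here)      = here
at-swap (suc k) (there p)         = there (at-swap k p)

all-swap : ∀ {ℓ} k {M} {μ : Vec ℕ ℓ} → VecAll.All (_≤ M) μ → VecAll.All (_≤ M) (swapAt k μ)
all-swap zero    []           = []
all-swap (suc _) []           = []
all-swap zero    (p ∷ [])     = p ∷ []
all-swap zero    (p ∷ q ∷ ps) = q ∷ p ∷ ps
all-swap (suc k) (p ∷ ps)     = p ∷ all-swap k ps

maximum : ∀ {ℓ} (x : ℕ) (μ : Vec ℕ ℓ) → ∃[ k ] ∃[ M ] At k M (x ∷ μ) × VecAll.All (_≤ M) (x ∷ μ)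
maximum x []      = 0 , x , here , ℕ.≤-refl ∷ []
maximum x (y ∷ μ) with k , M , at , all ← maximum y μ with ℕ.≤-total x M
... | inj₁ x≤M = suc k , M , there at , x≤M ∷ all
... | inj₂ M≤x = 0 , x , here , ℕ.≤-refl ∷ VecAll.map (λ y≤M → ℕ.≤-trans y≤M M≤x) all

module _ {m : ℕ} where

  Bounded : ∀ {ℓ} → ℕ → Tensor (2 + m) ℓ → Set
  Bounded M t = VecAll.All (_≤ M) (Vec.map size t)

  bounded-σ : ∀ {ℓ M} k (t : Tensor (2 + m) ℓ) → Bounded M t → Bounded M (σ k t)
  bounded-σ k t bounded = subst (VecAll.All (_≤ _)) (sym (map-size-σ k t)) (all-swap k bounded)

  bounded-moveDown : ∀ {ℓ M} i d (t : Tensor (2 + m) ℓ) → Bounded M t → Bounded M (moveDown i d t)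
  bounded-moveDown i zero    t bounded = bounded
  bounded-moveDown i (suc d) t bounded = bounded-σ i (moveDown (suc i) d t) (bounded-moveDown (suc i) d t bounded)

  moveDown-∷ : ∀ {ℓ} i d h (t : Tensor (2 + m) ℓ) → moveDown (suc i) d (h ∷ t) ≡ h ∷ moveDown i d t
  moveDown-∷ i zero    h t = refl
  moveDown-∷ i (suc d) h t = cong (σ (suc i)) (moveDown-∷ (suc i) d h t)

  -- A factor of size at most K that moves past c ⋯ c only leaves letters c behind.

  headFree-𝓡 : ∀ {ℓ c K} → c ≢ lastLetter → (t : Tensor (2 + m) ℓ) → Bounded K t → HeadFree (σ 0 (pure c K ∷ t))
  headFree-𝓡 {K = K} c≢last []      _          = #-pure-≢ (c≢last ∘ sym) K
  headFree-𝓡 {c = c} {K} c≢last (z ∷ t) (z≤K ∷ _) = free (windingAndR-spec z (pure c K))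
    where
    free : ∀ {w b′ a′} → RSpec z (pure c K) (w , b′ , a′) → # lastLetter a′ ≡ 0
    free {a′ = a′} (forward _ R) = ℕ.m+n≡0⇒m≡0 (# lastLetter a′) (trans (RMatrix.right R lastLetter) (#-pure-≢ (c≢last ∘ sym) K))
    free (backward K<z _)        = contradiction (subst (size z ≤_) (sym (size-pure c K)) z≤K) (ℕ.<⇒≱ K<z)

  -- Until its last step the travelling factor moves within t, and 𝓡 only permutes sizes, so it
  -- still has size at most K when it meets c ⋯ c.
  safe-pure : ∀ {ℓ c K} → c ≢ lastLetter → (t : Tensor (2 + m) ℓ) → Bounded K t → Safe (pure c K ∷ t)
  safe-pure {K = K} c≢last t bounded zero    _ = #-pure-≢ (c≢last ∘ sym) K
  safe-pure {c = c} {K} c≢last t bounded (suc d) _ =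
    subst (HeadFree ∘ σ 0) (sym (moveDown-∷ 0 d (pure c K) t)) (headFree-𝓡 c≢last (moveDown 0 d t) (bounded-moveDown 0 d t bounded))

  SafeStep : ∀ {ℓ} → Tensor (2 + m) ℓ → Tensor (2 + m) ℓ → Set
  SafeStep t t′ = ∃[ i ] (t ↝[ i ] t′) × (toℕ i ≡ 0 → Safe t)

  all-empty-unique : ∀ {ℓ} (t u : Tensor (2 + m) ℓ) → Bounded 0 t → Vec.map size t ≡ Vec.map size u → t ≡ u
  all-empty-unique []      []      _         _  = refl
  all-empty-unique (h ∷ t) (k ∷ u) (p ∷ ps) eq = cong₂ _∷_
    (empty-unique {h = h} {k} (ℕ.n≤0⇒n≡0 p) (trans (sym (Vec.∷-injectiveˡ eq)) (ℕ.n≤0⇒n≡0 p)))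
    (all-empty-unique t u ps (Vec.∷-injectiveʳ eq))

  connected-largest-first : ∀ {ℓ} h h′ (t t′ : Tensor (2 + m) ℓ) → Bounded (size h) (h ∷ t) →
    Vec.map size (h ∷ t) ≡ Vec.map size (h′ ∷ t′) → nz (h ∷ t) ≤ 2 + m → EqClosure SafeStep (h ∷ t) (h′ ∷ t′)
  connected-largest-first {ℓ} h h′ t t′ bounded eq nz≤ with size h ℕ.≟ 0
  ... | yes h≡0 = subst (EqClosure SafeStep (h ∷ t)) (all-empty-unique (h ∷ t) (h′ ∷ t′) (subst (λ K → Bounded K (h ∷ t)) h≡0 bounded) eq) Star.ε
  ... | no h≢0  = EqClosure-invariant
      (λ ((_ , s) , _) → subst (VecAll.All (_≤ K)) (map-size-↝ s)) (λ ((_ , s) , _) → subst (VecAll.All (_≤ K)) (sym (map-size-↝ s)))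
      (λ bounded (_ , safe) → safe bounded) bounded
      (connect-nonempty E (λ (i , i≢0 , s) → (i , s) , λ _ → i , s , λ i≡0 → contradiction i≡0 i≢0) K zeroE refl h≢0 eq nz≤)
    where
    K = size h
    E : Tensor (2 + m) (suc ℓ) → Tensor (2 + m) (suc ℓ) → Set
    -- The walk ignores the sizes of the other factors, so safety is conditional here. The bound is
    -- carried along the finished path, for which the first component provides invariance of sizes.
    E x y = (x ↝⁺ y) × (Bounded K x → SafeStep x y)
    zeroE : ∀ {c t t′} → c ≢ lastLetter → t ↝[ zero ] t′ → E (pure c K ∷ t) (pure c K ∷ t′)
    zeroE {t = t} c≢last s = (zero , s′) , λ bounded → zero , s′ , λ _ → safe-pure c≢last t (VecAll.tail bounded)
      where s′ = ↝-pure (c≢last ∘ sym) s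

  -- Conjugation by σ k: it brings the largest factor one place closer to the right end, and as an
  -- involution that preserves arrows and `Safe` it carries the path found there back.
  connected-largest-at : ∀ {ℓ M} k (t t′ : Tensor (2 + m) ℓ) → At k M (Vec.map size t) → Bounded M t →
    Vec.map size t ≡ Vec.map size t′ → nz t ≤ 2 + m → EqClosure SafeStep t t′
  connected-largest-at zero    (h ∷ t) (h′ ∷ t′) here bounded eq nz≤ = connected-largest-first h h′ t t′ bounded eq nz≤
  connected-largest-at {ℓ} (suc k) t t′ at bounded eq nz≤ = subst₂ (EqClosure SafeStep) (σ-involutive k t) (σ-involutive k t′)
    (Eq.gmap (σ k) id (EqClosure-invariant
      (λ (_ , s , _) → subst (λ μ → nonzeroEntries μ ≤ 2 + m) (map-size-↝ s)) (λ (_ , s , _) → subst (λ μ → nonzeroEntries μ ≤ 2 + m) (sym (map-size-↝ s)))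
      σ-safeStep nzσ≤
      (connected-largest-at k (σ k t) (σ k t′) (subst (At k _) (sym (map-size-σ k t)) (at-swap k at)) (bounded-σ k t bounded)
        (trans (map-size-σ k t) (trans (cong (swapAt k) eq) (sym (map-size-σ k t′)))) nzσ≤)))
    where
    nzσ≤ : nz (σ k t) ≤ 2 + m
    nzσ≤ = subst (_≤ 2 + m) (sym (nz-σ k t)) nz≤
    σ-safeStep : ∀ {x y : Tensor (2 + m) ℓ} → nz x ≤ 2 + m → SafeStep x y → SafeStep (σ k x) (σ k y)
    σ-safeStep {x} nz≤ (i , s , safe) = i , σ-↝ k s , λ i≡0 → safe-σ k x (at-< at) nz≤ (safe i≡0)

  safe-connected : ∀ {ℓ} (t t′ : Tensor (2 + m) ℓ) → Vec.map size t ≡ Vec.map size t′ → nz t ≤ 2 + m → EqClosure SafeStep t t′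
  safe-connected []      []      _  _   = Star.ε
  safe-connected (h ∷ t) t′ eq nz≤ with k , M , at , bounded ← maximum (size h) (Vec.map size t) =
    connected-largest-at k (h ∷ t) t′ at bounded eq nz≤

  regular : ∀ {ℓ} {μ : Vec ℕ ℓ} {H H′ : 𝓗 (2 + m) μ} → SafeStep (factors H) (factors H′) → RegularSubgraph (2 + m) μ H H′
  regular {H = H} {H′} (i , (_ , s) , safe) = i , step⇒arrow {H = H} {H′} s , λ i≡0 → begin
    D H′                       ≡⟨ D≡energy H′ ⟩
    energy (factors H′)        ≡⟨ energy-step (safe i≡0) (subst (λ i → Step i _ _ _) (Fin.toℕ-injective i≡0) s) ⟩
    energy (factors H) + 1     ≡⟨ cong (_+ 1) (D≡energy H) ⟨
    D H + 1                    ∎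
    where open ≡-Reasoning

  factors-injective : ∀ {ℓ} {μ : Vec ℕ ℓ} {x y : 𝓗 (2 + m) μ} → factors x ≡ factors y → x ≡ y
  factors-injective {x = mk𝓗 _ _} {mk𝓗 _ _} refl = refl

  -- The ends are variables tied to x and y by equations, so that the path can be matched on. Every
  -- tensor on it has sizes μ because arrows preserve sizes.
  lift : ∀ {ℓ} {μ : Vec ℕ ℓ} (x y : 𝓗 (2 + m) μ) {t u} → factors x ≡ t → factors y ≡ u →
         EqClosure SafeStep t u → EqClosure (RegularSubgraph (2 + m) μ) x y
  lift x y x≡ y≡ Star.ε = subst (EqClosure (RegularSubgraph _ _) x) (factors-injective (trans x≡ (sym y≡))) Star.ε
  lift {μ = μ} x@(mk𝓗 _ sizes-x) y {t} x≡ y≡ (_◅_ {j = v} e path) = edge (subst (λ t → Sym.SymClosure SafeStep t v) (sym x≡) e) ◅ lift middle y refl y≡ path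
    where
    sameSize : Sym.SymClosure SafeStep t v → Vec.map size v ≡ Vec.map size t
    sameSize (Sym.fwd (_ , s , _)) = sym (map-size-↝ s)
    sameSize (Sym.bwd (_ , s , _)) = map-size-↝ s
    middle : 𝓗 (2 + m) μ
    middle = mk𝓗 v (trans (sameSize e) (trans (cong (Vec.map size) (sym x≡)) sizes-x))
    edge : Sym.SymClosure SafeStep (factors x) v → Sym.SymClosure (RegularSubgraph (2 + m) μ) x middle
    edge (Sym.fwd s) = Sym.fwd (regular {H = x} {middle} s)
    edge (Sym.bwd s) = Sym.bwd (regular {H = middle} {x} s)

theorem5p24 : (n : ℕ) → 2 ≤ n → (ℓ : ℕ) (μ : Vec ℕ ℓ) → nonzeroEntries μ ≤ n → Connected (RegularSubgraph n μ)
theorem5p24 (suc (suc m)) (s≤s (s≤s _)) ℓ μ nz≤ x@(mk𝓗 t sizes-t) y@(mk𝓗 u sizes-u) = lift x y refl refl (safe-connected t u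
  (trans t≡μ (sym (recompute (Vec.≡-dec ℕ._≟_ (Vec.map size u) μ) sizes-u))) (subst (λ ν → nonzeroEntries ν ≤ 2 + m) (sym t≡μ) nz≤))
  where
  t≡μ : Vec.map size t ≡ μ
  t≡μ = recompute (Vec.≡-dec ℕ._≟_ (Vec.map size t) μ) sizes-t
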